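{- Let $p\in(0,1)$, $q=1-p$ and $\rho=p/q$. The asymptotic probability (as $n\to\infty$ with $p$ fixed) that a random graph $g$ in the Erdős–Rényi model $G(n,p)$ is connected satisfies $$\mathbb P(g\text{ is connected})\approx1-\sum_{k\ge1}P_k(\rho)\cdot\binom nk\cdot\frac{q^{nk}}{q^{k(k+1)/2}},$$ where $P_k(\rho)$ is the total weight of the species $\mathcal{IT}$ of irreducible tournaments with ties on $[k]$. In particular, if $p\ge1/2$ (that is, $\rho\ge1$), then $P_k(\rho)\ge0$ for any positive integer $k$.
   Context: $G(n,p)$ is the random labeled simple graph with vertex set $[n]=\{1,\dots,n\}$ in which each pair of distinct vertices is joined by an edge independently with probability $p$. A tournament with ties on $[k]$ is a directed graph with vertex set $[k]$ in which every pair of distinct vertices is joined either by exactly one directed edge (in one of the two directions) or by two oppositely directed edges (a tie). The weight of a tournament with ties $t$ is $w(t)=(\rho-1)^{\ell}$, where $\ell$ is the number of pairs of vertices joined by two edges (with $0^0=1$); weights may be negative if $\rho<1$. A tournament with ties is irreducible if it is strongly connected as a directed graph. The total weight of $\mathcal{IT}$ on $[k]$ is the sum of $w(t)$ over all irreducible tournaments with ties $t$ on $[k]$. Notation $\approx$: $p_n\approx\sum_{k\ge0}c_kg_k(n)$ (here $g_k(n)=\binom nk q^{nk-k(k+1)/2}$, the leading $1$ being the $k=0$ term) means that $g_{k+1}(n)=o(g_k(n))$ for every $k$ and, for every integer $r\ge0$, $p_n=\sum_{k=0}^rc_kg_k(n)+O(g_{r+1}(n))$ as $n\to\infty$. -}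

module Defs where

open import Algebra.Bundles using (RawSemiring)
open import Data.Bool using (Bool; true; false; T; T?; if_then_else_)
open import Data.Fin as Fin using (Fin; toℕ)
import Data.Fin.Properties as Fin
open import Data.Integer using (+_)
open import Data.List using (List; []; _∷_; map; foldr; filter; allFin; cartesianProduct; cartesianProductWith; length; upTo)
open import Data.Nat as ℕ using (ℕ; zero; suc)
import Data.Nat.Properties as ℕ
open import Data.Nat.Combinatorics using (_C_)
open import Data.Product using (∃; _×_; _,_)
open import Data.Rational as ℚ using (ℚ; 0ℚ; 1ℚ; ½)
import Data.Rational.Properties as ℚ
open import Data.Rational.Solver using (module +-*-Solver)
open import Data.Sum using (_⊎_; inj₁; inj₂)
open import Data.Vec using (Vec; []; _∷_; lookup)
open import Level using (0ℓ)
open import Relation.Binary.Construct.Closure.ReflexiveTransitive using (Star; _◅_; _◅◅_) renaming (ε to nil)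
open import Relation.Binary.PropositionalEquality
open import Relation.Nullary using (¬_; Dec; yes; no; contradiction)
open import Relation.Nullary.Decidable using (map′; _×-dec_; _⊎-dec_; _→-dec_; ¬?)
open import Relation.Unary using (Pred; Decidable)

------------------------------------------------------------------------
-- Real numbers: Cauchy sequences of rationals with pointwise operations,
-- considered up to the setoid equality _≈_.

Eventually : (ℕ → Set) → Set
Eventually P = ∃ λ N → ∀ n → N ℕ.≤ n → P n

IsCauchy : (ℕ → ℚ) → Set
IsCauchy x = ∀ ε → 0ℚ ℚ.< ε →
  ∃ λ N → ∀ m n → N ℕ.≤ m → N ℕ.≤ n → ℚ.∣ x m ℚ.- x n ∣ ℚ.≤ ε

record ℝ : Set where
  constructor mkℝ
  field
    seq    : ℕ → ℚ
    cauchy : IsCauchy seq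

open ℝ public

infix 4 _≈_ _≤_ _<_

_≈_ : ℝ → ℝ → Set
x ≈ y = ∀ ε → 0ℚ ℚ.< ε → Eventually λ n → ℚ.∣ seq x n ℚ.- seq y n ∣ ℚ.≤ ε

_≤_ : ℝ → ℝ → Set
x ≤ y = ∀ ε → 0ℚ ℚ.< ε → Eventually λ n → seq x n ℚ.≤ seq y n ℚ.+ ε

_<_ : ℝ → ℝ → Set
x < y = ∃ λ ε → 0ℚ ℚ.< ε × Eventually λ n → seq x n ℚ.+ ε ℚ.≤ seq y n

private
  ∣-∣-swap : ∀ a b → ℚ.∣ a ℚ.- b ∣ ≡ ℚ.∣ b ℚ.- a ∣
  ∣-∣-swap a b = trans (cong ℚ.∣_∣ (eq a b)) (ℚ.∣-p∣≡∣p∣ (b ℚ.- a))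
    where
    open +-*-Solver
    eq : ∀ a b → a ℚ.- b ≡ ℚ.- (b ℚ.- a)
    eq = solve 2 (λ a b → a :- b := :- (b :- a)) refl

  halve : ∀ e → e ℚ.* ½ ℚ.+ e ℚ.* ½ ≡ e
  halve e = trans (sym (ℚ.*-distribˡ-+ e ½ ½)) (ℚ.*-identityʳ e)

  *-pos : ∀ {a b} → 0ℚ ℚ.< a → 0ℚ ℚ.< b → 0ℚ ℚ.< a ℚ.* b
  *-pos {a} {b} 0<a 0<b = ℚ.positive⁻¹ _
    {{ℚ.pos*pos⇒pos a {{ℚ.positive 0<a}} b {{ℚ.positive 0<b}}}}

  half-pos : ∀ {e} → 0ℚ ℚ.< e → 0ℚ ℚ.< e ℚ.* ½
  half-pos 0<e = *-pos 0<e (ℚ.positive⁻¹ ½)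

  *-mono : ∀ {a b c d} → 0ℚ ℚ.≤ b → 0ℚ ℚ.≤ c → a ℚ.≤ b → c ℚ.≤ d → a ℚ.* c ℚ.≤ b ℚ.* d
  *-mono {a} {b} {c} {d} 0≤b 0≤c a≤b c≤d = ℚ.≤-trans
    (ℚ.*-monoʳ-≤-nonNeg c {{ℚ.nonNegative 0≤c}} a≤b)
    (ℚ.*-monoˡ-≤-nonNeg b {{ℚ.nonNegative 0≤b}} c≤d)

fromℚ : ℚ → ℝ
fromℚ a = mkℝ (λ _ → a) λ e 0<e → 0 , λ _ _ _ _ →
  subst (ℚ._≤ e) (cong ℚ.∣_∣ (sym (ℚ.+-inverseʳ a))) (ℚ.<⇒≤ 0<e)

fromℕ : ℕ → ℝ
fromℕ n = fromℚ (+ n ℚ./ 1)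

0ℝ 1ℝ : ℝ
0ℝ = fromℚ 0ℚ
1ℝ = fromℚ 1ℚ

infixl 6 _+_ _-_
infixl 7 _*_
infix  8 -_

_+_ : ℝ → ℝ → ℝ
x + y = mkℝ (λ n → seq x n ℚ.+ seq y n) proof
  where
  open +-*-Solver
  eq : ∀ a b c d → (a ℚ.+ b) ℚ.- (c ℚ.+ d) ≡ (a ℚ.- c) ℚ.+ (b ℚ.- d)
  eq = solve 4 (λ a b c d → (a :+ b) :- (c :+ d) := (a :- c) :+ (b :- d)) refl

  abstract
    proof : IsCauchy (λ n → seq x n ℚ.+ seq y n)
    proof e 0<e with cauchy x (e ℚ.* ½) (half-pos 0<e) | cauchy y (e ℚ.* ½) (half-pos 0<e)
    ... | M , hx | N , hy = M ℕ.⊔ N , λ m n ≤m ≤n → begin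
      ℚ.∣ (seq x m ℚ.+ seq y m) ℚ.- (seq x n ℚ.+ seq y n) ∣
        ≡⟨ cong ℚ.∣_∣ (eq (seq x m) (seq y m) (seq x n) (seq y n)) ⟩
      ℚ.∣ (seq x m ℚ.- seq x n) ℚ.+ (seq y m ℚ.- seq y n) ∣
        ≤⟨ ℚ.∣p+q∣≤∣p∣+∣q∣ (seq x m ℚ.- seq x n) (seq y m ℚ.- seq y n) ⟩
      ℚ.∣ seq x m ℚ.- seq x n ∣ ℚ.+ ℚ.∣ seq y m ℚ.- seq y n ∣
        ≤⟨ ℚ.+-mono-≤ (hx m n (ℕ.m⊔n≤o⇒m≤o M N ≤m) (ℕ.m⊔n≤o⇒m≤o M N ≤n))
                      (hy m n (ℕ.m⊔n≤o⇒n≤o M N ≤m) (ℕ.m⊔n≤o⇒n≤o M N ≤n)) ⟩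
      e ℚ.* ½ ℚ.+ e ℚ.* ½
        ≡⟨ halve e ⟩
      e ∎
      where open ℚ.≤-Reasoning

-_ : ℝ → ℝ
- x = mkℝ (λ n → ℚ.- seq x n) proof
  where
  open +-*-Solver
  eq : ∀ a b → (ℚ.- a) ℚ.- (ℚ.- b) ≡ b ℚ.- a
  eq = solve 2 (λ a b → (:- a) :- (:- b) := b :- a) refl

  abstract
    proof : IsCauchy (λ n → ℚ.- seq x n)
    proof e 0<e with cauchy x e 0<e
    ... | N , h = N , λ m n ≤m ≤n →
      subst (ℚ._≤ e) (cong ℚ.∣_∣ (sym (eq (seq x m) (seq x n)))) (h n m ≤n ≤m)

_-_ : ℝ → ℝ → ℝ
x - y = x + (- y)

private
  eventually-bounded : ∀ x → ∃ λ B → 0ℚ ℚ.< B × Eventually λ n → ℚ.∣ seq x n ∣ ℚ.≤ B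
  eventually-bounded x with cauchy x 1ℚ (ℚ.positive⁻¹ 1ℚ)
  ... | N , h = 1ℚ ℚ.+ ℚ.∣ seq x N ∣
              , ℚ.+-mono-<-≤ (ℚ.positive⁻¹ 1ℚ) (ℚ.0≤∣p∣ (seq x N))
              , N , λ n ≤n → begin
    ℚ.∣ seq x n ∣
      ≡⟨ cong ℚ.∣_∣ (eq (seq x n) (seq x N)) ⟩
    ℚ.∣ (seq x n ℚ.- seq x N) ℚ.+ seq x N ∣
      ≤⟨ ℚ.∣p+q∣≤∣p∣+∣q∣ (seq x n ℚ.- seq x N) (seq x N) ⟩
    ℚ.∣ seq x n ℚ.- seq x N ∣ ℚ.+ ℚ.∣ seq x N ∣
      ≤⟨ ℚ.+-monoˡ-≤ ℚ.∣ seq x N ∣ (h n N ≤n ℕ.≤-refl) ⟩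
    1ℚ ℚ.+ ℚ.∣ seq x N ∣ ∎
    where
    open ℚ.≤-Reasoning
    open +-*-Solver
    eq : ∀ a b → a ≡ (a ℚ.- b) ℚ.+ b
    eq = solve 2 (λ a b → a := (a :- b) :+ b) refl

  shrink : ∀ B e → 0ℚ ℚ.< B → 0ℚ ℚ.< e → ∃ λ d → 0ℚ ℚ.< d × B ℚ.* d ≡ e
  shrink B e 0<B 0<e = r ℚ.* e , *-pos 0<r 0<e
    , trans (sym (ℚ.*-assoc B r e))
            (trans (cong (ℚ._* e) (ℚ.*-inverseʳ B)) (ℚ.*-identityˡ e))
    where
    instance
      _ = ℚ.positive 0<B
      _ = ℚ.pos⇒nonZero B
    r = ℚ.1/ B
    0<r : 0ℚ ℚ.< r
    0<r = ℚ.positive⁻¹ r {{ℚ.1/pos⇒pos B}}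

  product-estimate : ∀ {A B d d′ e} a b c f → 0ℚ ℚ.< A → 0ℚ ℚ.< B →
    A ℚ.* d ≡ e ℚ.* ½ → B ℚ.* d′ ≡ e ℚ.* ½ →
    ℚ.∣ a ∣ ℚ.≤ A → ℚ.∣ f ∣ ℚ.≤ B → ℚ.∣ b ℚ.- f ∣ ℚ.≤ d → ℚ.∣ a ℚ.- c ∣ ℚ.≤ d′ →
    ℚ.∣ a ℚ.* b ℚ.- c ℚ.* f ∣ ℚ.≤ e
  product-estimate {A} {B} {d} {d′} {e} a b c f 0<A 0<B Ad Bd′ a≤A f≤B b-f≤d a-c≤d′ = begin
    ℚ.∣ a ℚ.* b ℚ.- c ℚ.* f ∣
      ≡⟨ cong ℚ.∣_∣ (eq a b c f) ⟩
    ℚ.∣ a ℚ.* (b ℚ.- f) ℚ.+ f ℚ.* (a ℚ.- c) ∣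
      ≤⟨ ℚ.∣p+q∣≤∣p∣+∣q∣ (a ℚ.* (b ℚ.- f)) (f ℚ.* (a ℚ.- c)) ⟩
    ℚ.∣ a ℚ.* (b ℚ.- f) ∣ ℚ.+ ℚ.∣ f ℚ.* (a ℚ.- c) ∣
      ≡⟨ cong₂ ℚ._+_ (ℚ.∣p*q∣≡∣p∣*∣q∣ a (b ℚ.- f)) (ℚ.∣p*q∣≡∣p∣*∣q∣ f (a ℚ.- c)) ⟩
    ℚ.∣ a ∣ ℚ.* ℚ.∣ b ℚ.- f ∣ ℚ.+ ℚ.∣ f ∣ ℚ.* ℚ.∣ a ℚ.- c ∣
      ≤⟨ ℚ.+-mono-≤
           (*-mono (ℚ.<⇒≤ 0<A) (ℚ.0≤∣p∣ (b ℚ.- f)) a≤A b-f≤d)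
           (*-mono (ℚ.<⇒≤ 0<B) (ℚ.0≤∣p∣ (a ℚ.- c)) f≤B a-c≤d′) ⟩
    A ℚ.* d ℚ.+ B ℚ.* d′
      ≡⟨ cong₂ ℚ._+_ Ad Bd′ ⟩
    e ℚ.* ½ ℚ.+ e ℚ.* ½
      ≡⟨ halve e ⟩
    e ∎
    where
    open ℚ.≤-Reasoning
    open +-*-Solver
    eq : ∀ a b c d → (a ℚ.* b) ℚ.- (c ℚ.* d) ≡ a ℚ.* (b ℚ.- d) ℚ.+ d ℚ.* (a ℚ.- c)
    eq = solve 4 (λ a b c d → (a :* b) :- (c :* d) := a :* (b :- d) :+ d :* (a :- c)) refl

_*_ : ℝ → ℝ → ℝ
x * y = mkℝ (λ n → seq x n ℚ.* seq y n) proof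
  where
  abstract
    proof : IsCauchy (λ n → seq x n ℚ.* seq y n)
    proof e 0<e =
      let A , 0<A , K , bx = eventually-bounded x
          B , 0<B , L , by = eventually-bounded y
          d  , 0<d  , Ad  = shrink A (e ℚ.* ½) 0<A (half-pos 0<e)
          d′ , 0<d′ , Bd′ = shrink B (e ℚ.* ½) 0<B (half-pos 0<e)
          M , hy = cauchy y d 0<d
          N , hx = cauchy x d′ 0<d′
      in (K ℕ.⊔ L) ℕ.⊔ (M ℕ.⊔ N) , λ m n ≤m ≤n →
        let KL≤m = ℕ.m⊔n≤o⇒m≤o (K ℕ.⊔ L) (M ℕ.⊔ N) ≤m
            KL≤n = ℕ.m⊔n≤o⇒m≤o (K ℕ.⊔ L) (M ℕ.⊔ N) ≤n
            MN≤m = ℕ.m⊔n≤o⇒n≤o (K ℕ.⊔ L) (M ℕ.⊔ N) ≤m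
            MN≤n = ℕ.m⊔n≤o⇒n≤o (K ℕ.⊔ L) (M ℕ.⊔ N) ≤n
        in product-estimate (seq x m) (seq y m) (seq x n) (seq y n) 0<A 0<B Ad Bd′
             (bx m (ℕ.m⊔n≤o⇒m≤o K L KL≤m))
             (by n (ℕ.m⊔n≤o⇒n≤o K L KL≤n))
             (hy m n (ℕ.m⊔n≤o⇒m≤o M N MN≤m) (ℕ.m⊔n≤o⇒m≤o M N MN≤n))
             (hx m n (ℕ.m⊔n≤o⇒n≤o M N MN≤m) (ℕ.m⊔n≤o⇒n≤o M N MN≤n))

∣_∣ : ℝ → ℝ
∣ x ∣ = mkℝ (λ n → ℚ.∣ seq x n ∣) proof
  where
  open +-*-Solver
  eq : ∀ a b → a ≡ (a ℚ.- b) ℚ.+ b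
  eq = solve 2 (λ a b → a := (a :- b) :+ b) refl
  eq′ : ∀ a b → (a ℚ.+ b) ℚ.- b ≡ a
  eq′ = solve 2 (λ a b → (a :+ b) :- b := a) refl

  one-sided : ∀ a b → ℚ.∣ a ∣ ℚ.- ℚ.∣ b ∣ ℚ.≤ ℚ.∣ a ℚ.- b ∣
  one-sided a b = begin
    ℚ.∣ a ∣ ℚ.- ℚ.∣ b ∣
      ≡⟨ cong (λ t → ℚ.∣ t ∣ ℚ.- ℚ.∣ b ∣) (eq a b) ⟩
    ℚ.∣ (a ℚ.- b) ℚ.+ b ∣ ℚ.- ℚ.∣ b ∣
      ≤⟨ ℚ.+-monoˡ-≤ (ℚ.- ℚ.∣ b ∣) (ℚ.∣p+q∣≤∣p∣+∣q∣ (a ℚ.- b) b) ⟩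
    (ℚ.∣ a ℚ.- b ∣ ℚ.+ ℚ.∣ b ∣) ℚ.- ℚ.∣ b ∣
      ≡⟨ eq′ ℚ.∣ a ℚ.- b ∣ ℚ.∣ b ∣ ⟩
    ℚ.∣ a ℚ.- b ∣ ∎
    where open ℚ.≤-Reasoning

  two-sided : ∀ a b → ℚ.∣ ℚ.∣ a ∣ ℚ.- ℚ.∣ b ∣ ∣ ℚ.≤ ℚ.∣ a ℚ.- b ∣
  two-sided a b with ℚ.∣p∣≡p∨∣p∣≡-p (ℚ.∣ a ∣ ℚ.- ℚ.∣ b ∣)
  ... | inj₁ h = subst (ℚ._≤ ℚ.∣ a ℚ.- b ∣) (sym h) (one-sided a b)
  ... | inj₂ h = subst₂ ℚ._≤_
    (trans (eq″ ℚ.∣ b ∣ ℚ.∣ a ∣) (sym h)) (∣-∣-swap b a) (one-sided b a)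
    where
    eq″ : ∀ a b → a ℚ.- b ≡ ℚ.- (b ℚ.- a)
    eq″ = solve 2 (λ a b → a :- b := :- (b :- a)) refl

  abstract
    proof : IsCauchy (λ n → ℚ.∣ seq x n ∣)
    proof e 0<e with cauchy x e 0<e
    ... | N , h = N , λ m n ≤m ≤n → ℚ.≤-trans (two-sided (seq x m) (seq x n)) (h m n ≤m ≤n)

-- Totalised by recip 0 = 0, so that a real can be inverted termwise: the
-- sequence of a positive real may have finitely many zero terms.
recip : ℚ → ℚ
recip a with a ℚ.≟ 0ℚ
... | yes _  = 0ℚ
... | no a≢0 = (ℚ.1/ a) {{ℚ.≢-nonZero a≢0}}

private
  *-recip : ∀ a → 0ℚ ℚ.< a → a ℚ.* recip a ≡ 1ℚ
  *-recip a 0<a with a ℚ.≟ 0ℚ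
  ... | yes a≡0 = contradiction (sym a≡0) (ℚ.<⇒≢ 0<a)
  ... | no a≢0 = ℚ.*-inverseʳ a {{ℚ.≢-nonZero a≢0}}

inv : (x : ℝ) → 0ℝ < x → ℝ
inv x (ε , 0<ε , K , ε≤) = mkℝ (λ n → recip (seq x n)) proof
  where
  ε≤x : ∀ n → K ℕ.≤ n → ε ℚ.≤ seq x n
  ε≤x n K≤n = subst (ℚ._≤ seq x n) (ℚ.+-identityˡ ε) (ε≤ n K≤n)

  eq : ∀ a b → 0ℚ ℚ.< a → 0ℚ ℚ.< b → (a ℚ.* b) ℚ.* (recip a ℚ.- recip b) ≡ b ℚ.- a
  eq a b 0<a 0<b = trans (rearrange a b (recip a) (recip b))
    (trans (cong₂ (λ s t → b ℚ.* s ℚ.- a ℚ.* t) (*-recip a 0<a) (*-recip b 0<b))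
           (cong₂ ℚ._-_ (ℚ.*-identityʳ b) (ℚ.*-identityʳ a)))
    where
    open +-*-Solver
    rearrange : ∀ a b r s → (a ℚ.* b) ℚ.* (r ℚ.- s) ≡ b ℚ.* (a ℚ.* r) ℚ.- a ℚ.* (b ℚ.* s)
    rearrange = solve 4 (λ a b r s → (a :* b) :* (r :- s) := b :* (a :* r) :- a :* (b :* s)) refl

  abstract
    proof : IsCauchy (λ n → recip (seq x n))
    proof e 0<e with cauchy x ((ε ℚ.* ε) ℚ.* e) (*-pos (*-pos 0<ε 0<ε) 0<e)
    ... | N , h = K ℕ.⊔ N , λ m n ≤m ≤n →
      let a = seq x m ; b = seq x n
          ε≤a = ε≤x m (ℕ.m⊔n≤o⇒m≤o K N ≤m)
          ε≤b = ε≤x n (ℕ.m⊔n≤o⇒m≤o K N ≤n)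
          0<a = ℚ.<-≤-trans 0<ε ε≤a
          0<b = ℚ.<-≤-trans 0<ε ε≤b
          D   = ℚ.∣ recip a ℚ.- recip b ∣
      in ℚ.*-cancelˡ-≤-pos (ε ℚ.* ε) {{ℚ.positive (*-pos 0<ε 0<ε)}} (begin
      (ε ℚ.* ε) ℚ.* D
        ≤⟨ ℚ.*-monoʳ-≤-nonNeg D {{ℚ.nonNegative (ℚ.0≤∣p∣ (recip a ℚ.- recip b))}}
             (*-mono (ℚ.<⇒≤ 0<a) (ℚ.<⇒≤ 0<ε) ε≤a ε≤b) ⟩
      (a ℚ.* b) ℚ.* D
        ≡⟨ cong (ℚ._* D) (ℚ.0≤p⇒∣p∣≡p (ℚ.<⇒≤ (*-pos 0<a 0<b))) ⟨
      ℚ.∣ a ℚ.* b ∣ ℚ.* D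
        ≡⟨ ℚ.∣p*q∣≡∣p∣*∣q∣ (a ℚ.* b) (recip a ℚ.- recip b) ⟨
      ℚ.∣ (a ℚ.* b) ℚ.* (recip a ℚ.- recip b) ∣
        ≡⟨ cong ℚ.∣_∣ (eq a b 0<a 0<b) ⟩
      ℚ.∣ b ℚ.- a ∣
        ≤⟨ h n m (ℕ.m⊔n≤o⇒n≤o K N ≤n) (ℕ.m⊔n≤o⇒n≤o K N ≤m) ⟩
      (ε ℚ.* ε) ℚ.* e ∎)
      where open ℚ.≤-Reasoning

0<1-p : ∀ p → p < 1ℝ → 0ℝ < 1ℝ - p
0<1-p p (ε , 0<ε , N , h) = ε , 0<ε , N , λ n N≤n →
  subst₂ ℚ._≤_ (eq (seq p n) ε) refl (ℚ.+-monoˡ-≤ (ℚ.- seq p n) (h n N≤n))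
  where
  open +-*-Solver
  eq : ∀ a e → (a ℚ.+ e) ℚ.- a ≡ 0ℚ ℚ.+ e
  eq = solve 2 (λ a e → (a :+ e) :- a := con 0ℚ :+ e) refl

ℝ-rawSemiring : RawSemiring _ _
ℝ-rawSemiring = record
  { Carrier = ℝ ; _≈_ = _≈_ ; _+_ = _+_ ; _*_ = _*_ ; 0# = 0ℝ ; 1# = 1ℝ }

open import Algebra.Definitions.RawSemiring ℝ-rawSemiring public using (_^_)

sum product : List ℝ → ℝ
sum     = foldr _+_ 0ℝ
product = foldr _*_ 1ℝ

------------------------------------------------------------------------
-- Asymptotic expansions of real sequences, as n → ∞

_=O_ _=o_ : (ℕ → ℝ) → (ℕ → ℝ) → Set
f =O g = ∃ λ C → Eventually λ n → ∣ f n ∣ ≤ C * ∣ g n ∣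
f =o g = ∀ ε → 0ℝ < ε → Eventually λ n → ∣ f n ∣ ≤ ε * ∣ g n ∣

-- f(n) ≈ Σ_{k ≥ 0} c_k g_k(n): the scale g is asymptotically decreasing, and
-- f is within O(g_{r+1}) of its r-th partial sum, which includes k = r.
Expansion : (f : ℕ → ℝ) (c : ℕ → ℝ) (g : ℕ → ℕ → ℝ) → Set
Expansion f c g =
    (∀ k → g (suc k) =o g k)
  × (∀ r → (λ n → f n - sum (map (λ k → c k * g k n) (upTo (suc r)))) =O g (suc r))

------------------------------------------------------------------------
-- Digraphs on Fin n, as Boolean adjacency matrices

Digraph : ℕ → Set
Digraph n = Vec (Vec Bool n) n

adj : ∀ {n} → Digraph n → Fin n → Fin n → Bool
adj A i j = lookup (lookup A i) j

Arc : ∀ {n} → Digraph n → Fin n → Fin n → Set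
Arc A i j = T (adj A i j)

Arc? : ∀ {n} (A : Digraph n) i j → Dec (Arc A i j)
Arc? A i j = T? (adj A i j)

allVec : ∀ {a} {A : Set a} → List A → (n : ℕ) → List (Vec A n)
allVec xs zero    = [] ∷ []
allVec xs (suc n) = cartesianProductWith _∷_ xs (allVec xs n)

-- every digraph on Fin n, exactly once
allDigraphs : (n : ℕ) → List (Digraph n)
allDigraphs n = allVec (allVec (false ∷ true ∷ []) n) n

-- the unordered pairs of distinct vertices, listed as (i , j) with i < j
pairs : (n : ℕ) → List (Fin n × Fin n)
pairs n = filter (λ (i , j) → i Fin.<? j) (cartesianProduct (allFin n) (allFin n))

StronglyConnected : ∀ {n} → Digraph n → Set
StronglyConnected A = ∀ i j → Star (Arc A) i j

-- Warshall's algorithm: reachability through intermediate vertices of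
-- index less than m.
module _ {n : ℕ} (A : Digraph n) where

  private
    Via : (m : ℕ) → m ℕ.≤ n → Fin n → Fin n → Set
    Via zero    _   i j = i ≡ j ⊎ Arc A i j
    Via (suc m) m<n i j = Via m (ℕ.<⇒≤ m<n) i j
      ⊎ (Via m (ℕ.<⇒≤ m<n) i (Fin.fromℕ< m<n) × Via m (ℕ.<⇒≤ m<n) (Fin.fromℕ< m<n) j)

    via? : ∀ m m≤n i j → Dec (Via m m≤n i j)
    via? zero    _   i j = (i Fin.≟ j) ⊎-dec Arc? A i j
    via? (suc m) m<n i j = via? m _ i j ⊎-dec (via? m _ i _ ×-dec via? m _ _ j)

    sound : ∀ m m≤n {i j} → Via m m≤n i j → Star (Arc A) i j
    sound zero    _   (inj₁ refl)    = nil
    sound zero    _   (inj₂ a)       = a ◅ nil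
    sound (suc m) m<n (inj₁ v)       = sound m _ v
    sound (suc m) m<n (inj₂ (v , w)) = sound m _ v ◅◅ sound m _ w

    compose : ∀ m m≤n {i k j} → toℕ k ℕ.< m →
              Via m m≤n i k → Via m m≤n k j → Via m m≤n i j
    compose (suc m) m<n {i} {k} {j} k<1+m v w with toℕ k ℕ.≟ m
    ... | yes k≡m = inj₂ (to v , from w)
      where
      k≡ : k ≡ Fin.fromℕ< m<n
      k≡ = Fin.toℕ-injective (trans k≡m (sym (Fin.toℕ-fromℕ< m<n)))
      to : Via (suc m) m<n i k → Via m (ℕ.<⇒≤ m<n) i (Fin.fromℕ< m<n)
      to (inj₁ a)       = subst (Via m _ i) k≡ a
      to (inj₂ (a , _)) = a
      from : Via (suc m) m<n k j → Via m (ℕ.<⇒≤ m<n) (Fin.fromℕ< m<n) j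
      from (inj₁ b)       = subst (λ t → Via m _ t j) k≡ b
      from (inj₂ (_ , b)) = b
    ... | no k≢m = go v w
      where
      k<m : toℕ k ℕ.< m
      k<m = ℕ.≤∧≢⇒< (ℕ.s≤s⁻¹ k<1+m) k≢m
      go : Via (suc m) m<n i k → Via (suc m) m<n k j → Via (suc m) m<n i j
      go (inj₁ a)       (inj₁ b)       = inj₁ (compose m _ k<m a b)
      go (inj₁ a)       (inj₂ (b , c)) = inj₂ (compose m _ k<m a b , c)
      go (inj₂ (a , b)) (inj₁ c)       = inj₂ (a , compose m _ k<m b c)
      go (inj₂ (a , _)) (inj₂ (_ , d)) = inj₂ (a , d)

    arc : ∀ m m≤n {i j} → i ≡ j ⊎ Arc A i j → Via m m≤n i j
    arc zero    _   a = a
    arc (suc m) m<n a = inj₁ (arc m _ a)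

    complete : ∀ {i j} → Star (Arc A) i j → Via n ℕ.≤-refl i j
    complete nil               = arc n _ (inj₁ refl)
    complete (_◅_ {j = k} a s) =
      compose n _ (Fin.toℕ<n k) (arc n _ (inj₂ a)) (complete s)

  stronglyConnected? : Dec (StronglyConnected A)
  stronglyConnected? = Fin.all? λ i → Fin.all? λ j →
    map′ (sound n _) complete (via? n ℕ.≤-refl i j)

------------------------------------------------------------------------
-- The random graph G(n,p)

-- A simple graph is a loopless symmetric digraph.
IsSimpleGraph : ∀ {n} → Digraph n → Set
IsSimpleGraph A = (∀ i → ¬ Arc A i i) × (∀ i j → Arc A i j → Arc A j i)

isSimpleGraph? : ∀ {n} → Decidable (IsSimpleGraph {n})
isSimpleGraph? A = Fin.all? (λ i → ¬? (Arc? A i i))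
  ×-dec Fin.all? (λ i → Fin.all? λ j → Arc? A i j →-dec Arc? A j i)

graphs : (n : ℕ) → List (Digraph n)
graphs n = filter isSimpleGraph? (allDigraphs n)

Connected : ∀ {n} → Digraph n → Set
Connected = StronglyConnected

connected? : ∀ {n} → Decidable (Connected {n})
connected? = stronglyConnected?

-- the probability that G(n,p) equals the given graph
graphProbability : ℝ → ∀ {n} → Digraph n → ℝ
graphProbability p {n} g =
  product (map (λ (i , j) → if adj g i j then p else 1ℝ - p) (pairs n))

ℙ[G_,_∈_] : (n : ℕ) (p : ℝ) {E : Pred (Digraph n) 0ℓ} → Decidable E → ℝ
ℙ[G n , p ∈ E? ] = sum (map (graphProbability p) (filter E? (graphs n)))

------------------------------------------------------------------------
-- Tournaments with ties

IsTournamentWithTies : ∀ {k} → Digraph k → Set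
IsTournamentWithTies A =
  (∀ i → ¬ Arc A i i) × (∀ i j → i ≢ j → Arc A i j ⊎ Arc A j i)

isTournamentWithTies? : ∀ {k} → Decidable (IsTournamentWithTies {k})
isTournamentWithTies? A = Fin.all? (λ i → ¬? (Arc? A i i))
  ×-dec Fin.all? (λ i → Fin.all? λ j →
          ¬? (i Fin.≟ j) →-dec (Arc? A i j ⊎-dec Arc? A j i))

tournamentsWithTies : (k : ℕ) → List (Digraph k)
tournamentsWithTies k = filter isTournamentWithTies? (allDigraphs k)

irreducibleTournaments : (k : ℕ) → List (Digraph k)
irreducibleTournaments k = filter stronglyConnected? (tournamentsWithTies k)

ties : ∀ {k} → Digraph k → ℕ
ties {k} t = length (filter (λ (i , j) → Arc? t i j ×-dec Arc? t j i) (pairs k))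

weight : ℝ → ∀ {k} → Digraph k → ℝ
weight ρ t = (ρ - 1ℝ) ^ ties t

P : ℕ → ℝ → ℝ
P k ρ = sum (map (weight ρ) (irreducibleTournaments k))

------------------------------------------------------------------------
-- The expansion of the connectedness probability

-- binom(n,k) q^(nk) / q^(k(k+1)/2); negative powers of q are powers of its inverse
g : (q : ℝ) → 0ℝ < q → ℕ → ℕ → ℝ
g q 0<q k n = fromℕ (n C k) * (q ^ (n ℕ.* k) * inv q 0<q ^ (k ℕ.* (k ℕ.+ 1) ℕ./ 2))

coefficient : ℝ → ℕ → ℝ
coefficient ρ zero      = 1ℝ
coefficient ρ k@(suc _) = - P k ρ

-- Weigh an edge by ρ and a non-edge by 1; then the graphs on n vertices have total
-- weight G n = (1 + ρ) ^ (n (n - 1) / 2).  With weight ρ - 1 for a tie, the tournaments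
-- with ties have the same total weight.  Splitting off the unique initial strong
-- component of a tournament shows that (1 , - P 1 , - P 2 , …) is the inverse of G for
-- the binomial convolution.  A graph either has a component with at least n - r vertices,
-- necessarily unique, or its vertices split into two parts of more than r vertices each
-- with no edge between them.  The second kind has total weight O(C(n,r+1) G(n-r-1)), so
-- G n = Σ_{j ≤ r} C(n,j) G j · C_{n-j} + O(C(n,r+1) G(n-r-1)), where C_m is the total
-- weight of the connected graphs, and convolving with the inverse of G isolates C_n.
-- All operations on real numbers are termwise, so the estimates are proved over ℚ, with
-- thresholds that depend on p only through a positive lower bound.

module Submission where

open import Defs using (Digraph; adj; Arc; Arc?; allVec; allDigraphs; pairs; StronglyConnected;
  stronglyConnected?; connected?; isSimpleGraph?; graphs; isTournamentWithTies?; irreducibleTournaments;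
  ties)
open import Algebra.Bundles using (CommutativeMonoid; CommutativeSemiring; CommutativeRing)
import Algebra.Properties.CommutativeSemigroup
import Algebra.Properties.CommutativeSemiring.Exp
import Algebra.Properties.Ring
import Algebra.Properties.Semiring.Exp
import Algebra.Properties.Semiring.Mult
import Algebra.Solver.Ring.NaturalCoefficients.Default
open import Algebra.Structures using (IsCommutativeRing)
open import Data.Bool using (Bool; true; false; T; T?; if_then_else_)
import Data.Bool.Properties as Bool
open import Data.Fin as Fin using (Fin; zero; suc)
import Data.Fin.Properties as Fin
open import Data.Fin.Subset as Subset using (Subset; ∁; _∈_; _∉_; _⊆_; _⊂_; _∪_; ⁅_⁆; Nonempty) renaming
  (∣_∣ to size)
open import Data.Fin.Subset.Induction using (Acc; acc; ⊂-wellFounded; ⊃-wellFounded)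
import Data.Fin.Subset.Properties as Subset
open import Data.List as List using (List; []; _∷_; foldr; filter; cartesianProduct;
  cartesianProductWith; allFin; length; upTo)
import Data.List.Properties as List
open import Data.Nat as ℕ using (ℕ; zero; suc; _!)
open import Data.Nat.Combinatorics using (_C_; nCk+nC[k+1]≡[n+1]C[k+1]; nCk≡nC[n∸k]; nCn≡1; nC1≡n;
  k>n⇒nCk≡0; k![n∸k]!∣n!)
open import Data.Nat.Combinatorics.Specification using (nCk≡n!/k![n-k]!)
open import Data.Nat.DivMod using (m/n*n≡m; m*n/n≡m)
import Data.Nat.Properties as ℕ
open import Data.Nat.Properties using (_!≢0; _!*_!≢0)
open import Data.Nat.Solver using () renaming (module +-*-Solver to ℕSolver)
open import Data.Product using (∃; _×_; _,_; proj₁; proj₂; uncurry)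
import Data.Product.Properties as Product
open import Data.Sum as Sum using (_⊎_; inj₁; inj₂)
open import Data.Unit using (⊤; tt)
open import Data.Vec as Vec using (Vec; []; _∷_; lookup; replicate; zipWith; here; there)
import Data.Vec.Properties as Vec
open import Function using (_∘_)
open import Level using (0ℓ)
open import Relation.Binary.Bundles using (Poset)
open import Relation.Binary.Construct.Closure.ReflexiveTransitive using (Star; _◅_; _◅◅_) renaming
  (ε to nil)
open import Relation.Binary.Definitions using (DecidableEquality)
open import Relation.Binary.PropositionalEquality as ≡ using (_≡_; _≢_)
import Relation.Binary.Reasoning.PartialOrder
import Relation.Binary.Reasoning.Setoid
open import Relation.Binary.Structures using (IsPartialOrder)
open import Relation.Nullary using (¬_; Dec; yes; no; does; contradiction)
open import Relation.Nullary.Decidable using (_×-dec_; _⊎-dec_; ¬?)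
open import Relation.Unary using (Pred; Decidable)

-- Binomial coefficients and triangular numbers

-- Weight 1 for a non-edge, and for a pair joined by one arc only, makes the pairs across a cut drop
-- out: a cut into S and its complement contributes a plain product, for graphs and for tournaments
-- alike, and one notion of cut serves both. As ρ - 1 may be negative, the tournament side consists
-- of identities; inequalities appear on the graph side only, where all weights are nonnegative.
--
-- The obstacle is that the convolution with the inverse of G is truncated, and what is lost at n -
-- j must not exceed what is allowed at n. The argument n - j is therefore truncated at r - j. Then
-- the index pairs fill the triangle i + j ≤ r, whose antidiagonal sums vanish except the first, and
-- since C(n,j) C(n-j,r+1-j) = C(n,r+1) C(r+1,j), each lost term is a constant times C(n,r+1)
-- G(n-r-1).
--
-- The estimate for graphs without a large component is a geometric series of ratio 1/2: a further
-- vertex on the smaller side of the cut costs at most a factor n in the binomial coefficient and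
-- saves a power of 1 + ρ that is eventually at least 2 n.

nC0≡1 : ∀ n → n C 0 ≡ 1
nC0≡1 n = ≡.trans (nCk≡nC[n∸k] {0} {n} ℕ.z≤n) (nCn≡1 n)

-- n (n - 1) / 2, the number of unordered pairs of n vertices; the recursive form follows that of
-- `Triangle`, where vertex 0 is paired with all the others.
triangular : ℕ → ℕ
triangular zero    = 0
triangular (suc n) = n ℕ.+ triangular n

binomial-factorial : ∀ a b → ((a ℕ.+ b) C a) ℕ.* (a ! ℕ.* b !) ≡ (a ℕ.+ b) !
binomial-factorial a b = ≡.subst (λ c → ((a ℕ.+ b) C a) ℕ.* (a ! ℕ.* c !) ≡ (a ℕ.+ b) !)
  (ℕ.m+n∸m≡n a b)
  (≡.trans (≡.cong (ℕ._* (a ! ℕ.* (a ℕ.+ b ℕ.∸ a) !)) (nCk≡n!/k![n-k]! (ℕ.m≤m+n a b)))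
           (m/n*n≡m (k![n∸k]!∣n! (ℕ.m≤m+n a b))))
  where instance _ = a !* (a ℕ.+ b ℕ.∸ a) !≢0

-- Both sides are the multinomial coefficient N! / (a! b! c!); multiplying by a! b! c! turns each of
-- them into N ! without any division.
trinomial : ∀ a b c →
  ((a ℕ.+ b ℕ.+ c) C a) ℕ.* ((b ℕ.+ c) C b) ≡ ((a ℕ.+ b ℕ.+ c) C (a ℕ.+ b)) ℕ.* ((a ℕ.+ b) C a)
trinomial a b c = ℕ.*-cancelʳ-≡ _ _ (a ! ℕ.* b ! ℕ.* c !) (begin
  (N C a) ℕ.* ((b ℕ.+ c) C b) ℕ.* (a ! ℕ.* b ! ℕ.* c !)
    ≡⟨ solve 5 (λ u v x y z → u :* v :* (x :* y :* z) := u :* (x :* (v :* (y :* z)))) ≡.refl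
         (N C a) ((b ℕ.+ c) C b) (a !) (b !) (c !) ⟩
  (N C a) ℕ.* (a ! ℕ.* (((b ℕ.+ c) C b) ℕ.* (b ! ℕ.* c !)))
    ≡⟨ ≡.cong (λ z → (N C a) ℕ.* (a ! ℕ.* z)) (binomial-factorial b c) ⟩
  (N C a) ℕ.* (a ! ℕ.* (b ℕ.+ c) !)
    ≡⟨ ≡.subst (λ M → (M C a) ℕ.* (a ! ℕ.* (b ℕ.+ c) !) ≡ M !) (≡.sym (ℕ.+-assoc a b c))
      (binomial-factorial a (b ℕ.+ c)) ⟩
  N !
    ≡⟨ binomial-factorial (a ℕ.+ b) c ⟨
  (N C (a ℕ.+ b)) ℕ.* ((a ℕ.+ b) ! ℕ.* c !)
    ≡⟨ ≡.cong (λ z → (N C (a ℕ.+ b)) ℕ.* (z ℕ.* c !)) (binomial-factorial a b) ⟨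
  (N C (a ℕ.+ b)) ℕ.* (((a ℕ.+ b) C a) ℕ.* (a ! ℕ.* b !) ℕ.* c !)
    ≡⟨ solve 5 (λ u v x y z → u :* (v :* (x :* y) :* z) := u :* v :* (x :* y :* z)) ≡.refl
         (N C (a ℕ.+ b)) ((a ℕ.+ b) C a) (a !) (b !) (c !) ⟩
  (N C (a ℕ.+ b)) ℕ.* ((a ℕ.+ b) C a) ℕ.* (a ! ℕ.* b ! ℕ.* c !) ∎)
  where
  open ≡.≡-Reasoning
  open ℕSolver
  N = a ℕ.+ b ℕ.+ c
  instance
    _ = a !* b !≢0
    _ = c !≢0
    _ = ℕ.m*n≢0 (a ! ℕ.* b !) (c !)

-- Choosing j of n elements and then m - j of the rest is choosing m and marking j of them. This
-- moves the binomials of a double sum onto the index m, and brings the error terms onto a common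
-- scale.
C-∸ : ∀ {n m j} → j ℕ.≤ m → m ℕ.≤ n → (n C j) ℕ.* ((n ℕ.∸ j) C (m ℕ.∸ j)) ≡ (n C m) ℕ.* (m C j)
C-∸ {n} {m} {j} j≤m m≤n with ℕ.m≤n⇒∃[o]m+o≡n j≤m
... | b , ≡.refl with ℕ.m≤n⇒∃[o]m+o≡n m≤n
... | c , ≡.refl = ≡.trans
  (≡.cong₂ (λ x y → ((j ℕ.+ b ℕ.+ c) C j) ℕ.* (x C y))
    (≡.trans (≡.cong (ℕ._∸ j) (ℕ.+-assoc j b c)) (ℕ.m+n∸m≡n j (b ℕ.+ c)))
    (ℕ.m+n∸m≡n j b))
  (trinomial j b c)

-- The exact ratio is (n - k) / (k + 1). The crude factor n is enough, as it is only compared with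
-- an exponential.
C-suc-≤ : ∀ n k → n C suc k ℕ.≤ n ℕ.* (n C k)
C-suc-≤ zero    k       = ℕ.≤-reflexive (k>n⇒nCk≡0 {0} {suc k} (ℕ.s≤s ℕ.z≤n))
C-suc-≤ (suc n) zero    = ℕ.≤-reflexive (≡.trans (nC1≡n (suc n))
  (≡.trans (≡.sym (ℕ.*-identityʳ (suc n))) (≡.cong (suc n ℕ.*_) (≡.sym (nC0≡1 (suc n))))))
C-suc-≤ (suc n) (suc k) = begin
  suc n C suc (suc k)                             ≡⟨ nCk+nC[k+1]≡[n+1]C[k+1] n (suc k) ⟨
  n C suc k ℕ.+ n C suc (suc k)                   ≤⟨ ℕ.+-mono-≤ (C-suc-≤ n k) (C-suc-≤ n (suc k)) ⟩
  n ℕ.* (n C k) ℕ.+ n ℕ.* (n C suc k)             ≡⟨ ℕ.*-distribˡ-+ n (n C k) (n C suc k) ⟨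
  n ℕ.* (n C k ℕ.+ n C suc k)                     ≡⟨ ≡.cong (n ℕ.*_) (nCk+nC[k+1]≡[n+1]C[k+1] n k) ⟩
  n ℕ.* (suc n C suc k)                           ≤⟨ ℕ.m≤n+m _ _ ⟩
  suc n ℕ.* (suc n C suc k)                       ∎
  where open ℕ.≤-Reasoning

C-+-≤ : ∀ n k a → n C (k ℕ.+ a) ℕ.≤ n ℕ.^ a ℕ.* (n C k)
C-+-≤ n k zero    = ℕ.≤-reflexive (≡.trans (≡.cong (n C_) (ℕ.+-identityʳ k)) (≡.sym (ℕ.+-identityʳ _)))
C-+-≤ n k (suc a) = begin
  n C (k ℕ.+ suc a)                 ≡⟨ ≡.cong (n C_) (ℕ.+-suc k a) ⟩
  n C suc (k ℕ.+ a)                 ≤⟨ C-suc-≤ n (k ℕ.+ a) ⟩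
  n ℕ.* (n C (k ℕ.+ a))             ≤⟨ ℕ.*-monoʳ-≤ n (C-+-≤ n k a) ⟩
  n ℕ.* (n ℕ.^ a ℕ.* (n C k))       ≡⟨ ℕ.*-assoc n (n ℕ.^ a) (n C k) ⟨
  n ℕ.^ suc a ℕ.* (n C k)           ∎
  where open ℕ.≤-Reasoning

-- The pairs inside the two blocks and the a b pairs across them.
triangular-+ : ∀ a b → triangular (a ℕ.+ b) ≡ triangular a ℕ.+ triangular b ℕ.+ a ℕ.* b
triangular-+ zero    b = ≡.sym (ℕ.+-identityʳ _)
triangular-+ (suc a) b = ≡.trans (≡.cong (a ℕ.+ b ℕ.+_) (triangular-+ a b))
  (solve 4 (λ a b t u → a :+ b :+ (t :+ u :+ a :* b) := a :+ t :+ u :+ (b :+ a :* b)) ≡.refl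
    a b (triangular a) (triangular b))
  where open ℕSolver

triangular-suc : ∀ k → k ℕ.* (k ℕ.+ 1) ℕ./ 2 ≡ triangular (suc k)
triangular-suc k = ≡.trans (≡.cong (ℕ._/ 2) (double k)) (m*n/n≡m (triangular (suc k)) 2)
  where
  open ℕSolver
  double : ∀ k → k ℕ.* (k ℕ.+ 1) ≡ triangular (suc k) ℕ.* 2
  double zero    = ≡.refl
  double (suc k) = ≡.trans (solve 1 (λ k → (con 1 :+ k) :* (con 1 :+ k :+ con 1) :=
    (con 1 :+ k) :* con 2 :+ k :* (k :+ con 1)) ≡.refl k)
    (≡.trans (≡.cong (suc k ℕ.* 2 ℕ.+_) (double k)) (≡.sym (ℕ.*-distribʳ-+ 2 (suc k) (triangular (suc k)))))

square : ∀ k → k ℕ.* k ≡ triangular k ℕ.+ triangular (suc k)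
square zero    = ≡.refl
square (suc k) = ≡.trans (solve 1 (λ k → (con 1 :+ k) :* (con 1 :+ k) := con 1 :+
  (k :+ k) :+ k :* k) ≡.refl k)
  (≡.trans (≡.cong (suc (k ℕ.+ k) ℕ.+_) (square k))
    (solve 2 (λ k t → con 1 :+ (k :+ k) :+ (t :+ (k :+ t)) := k :+ t :+
      (con 1 :+ k :+ (k :+ t))) ≡.refl k (triangular k)))
  where open ℕSolver

-- Finite sums and products

-- Stated for a commutative monoid because it serves twice, for sums and for products over the pairs
-- of vertices.
module BigOperator (M : CommutativeMonoid 0ℓ 0ℓ) where
  open CommutativeMonoid M
  open Algebra.Properties.CommutativeSemigroup commutativeSemigroup using (interchange)
  open Relation.Binary.Reasoning.Setoid setoid

  ⨁ : {A : Set} → List A → (A → Carrier) → Carrier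
  ⨁ xs f = foldr _∙_ ε (List.map f xs)

  module _ {A : Set} where

    ⨁-cong : ∀ (xs : List A) {f g} → (∀ x → f x ≈ g x) → ⨁ xs f ≈ ⨁ xs g
    ⨁-cong []       f≈g = refl
    ⨁-cong (x ∷ xs) f≈g = ∙-cong (f≈g x) (⨁-cong xs f≈g)

    ⨁-ε : ∀ (xs : List A) → ⨁ xs (λ _ → ε) ≈ ε
    ⨁-ε []       = refl
    ⨁-ε (x ∷ xs) = trans (identityˡ _) (⨁-ε xs)

    ⨁-∙ : ∀ (xs : List A) f g → ⨁ xs (λ x → f x ∙ g x) ≈ ⨁ xs f ∙ ⨁ xs g
    ⨁-∙ []       f g = sym (identityˡ ε)
    ⨁-∙ (x ∷ xs) f g = trans (∙-congˡ (⨁-∙ xs f g)) (interchange _ _ _ _)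

    ⨁-++ : ∀ (xs ys : List A) f → ⨁ (xs List.++ ys) f ≈ ⨁ xs f ∙ ⨁ ys f
    ⨁-++ []       ys f = sym (identityˡ _)
    ⨁-++ (x ∷ xs) ys f = trans (∙-congˡ (⨁-++ xs ys f)) (sym (assoc _ _ _))

    ⨁-filter : ∀ {P : Pred A 0ℓ} (P? : Decidable P) xs f →
      ⨁ (filter P? xs) f ≈ ⨁ xs (λ x → if does (P? x) then f x else ε)
    ⨁-filter P? []       f = refl
    ⨁-filter P? (x ∷ xs) f with does (P? x)
    ... | true  = ∙-congˡ (⨁-filter P? xs f)
    ... | false = trans (⨁-filter P? xs f) (sym (identityˡ _))

  module _ {A B : Set} where

    ⨁-map : ∀ (h : A → B) xs f → ⨁ (List.map h xs) f ≡ ⨁ xs (f ∘ h)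
    ⨁-map h xs f = ≡.cong (foldr _∙_ ε) (≡.sym (List.map-∘ xs))

    ⨁-comm : ∀ (xs : List A) (ys : List B) (f : A → B → Carrier) →
      ⨁ xs (λ x → ⨁ ys (f x)) ≈ ⨁ ys (λ y → ⨁ xs (λ x → f x y))
    ⨁-comm []       ys f = sym (⨁-ε ys)
    ⨁-comm (x ∷ xs) ys f =
      trans (∙-congˡ (⨁-comm xs ys f)) (sym (⨁-∙ ys (f x) _))

  ⨁-cartesianProductWith : ∀ {A B C : Set} (h : A → B → C) xs ys f →
    ⨁ (cartesianProductWith h xs ys) f ≈ ⨁ xs (λ x → ⨁ ys (λ y → f (h x y)))
  ⨁-cartesianProductWith h []       ys f = refl
  ⨁-cartesianProductWith h (x ∷ xs) ys f =
    trans (⨁-++ (List.map (h x) ys) _ f)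
          (∙-cong (reflexive (⨁-map (h x) ys f)) (⨁-cartesianProductWith h xs ys f))

  ⨁-allFin : ∀ n f → ⨁ (allFin (suc n)) f ≡ f zero ∙ ⨁ (allFin n) (f ∘ suc)
  ⨁-allFin n f = ≡.cong (f zero ∙_) (≡.trans
    (≡.cong (λ xs → ⨁ xs f) (≡.sym (List.map-tabulate (λ i → i) suc)))
    (⨁-map suc (allFin n) f))

  ⨁-pairs≈ : ∀ n h → ⨁ (pairs n) h ≈
    ⨁ (allFin n) (λ i → ⨁ (allFin n) λ j → if does (i Fin.<? j) then h (i , j) else ε)
  ⨁-pairs≈ n h = trans (⨁-filter (λ (i , j) → i Fin.<? j) (cartesianProduct (allFin n) (allFin n)) h)
    (⨁-cartesianProductWith _,_ (allFin n) (allFin n) _)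

  -- Splits off the pairs that contain vertex 0, to match the recursion of `Triangle`; no listed
  -- pair has 0 as its second entry, so that column only yields units.
  ⨁-pairs : ∀ n h → ⨁ (pairs (suc n)) h ≈
    ⨁ (allFin n) (λ j → h (zero , suc j)) ∙ ⨁ (pairs n) (λ (i , j) → h (suc i , suc j))
  ⨁-pairs n h = begin
    ⨁ (pairs (suc n)) h
      ≈⟨ ⨁-pairs≈ (suc n) h ⟩
    ⨁ (allFin (suc n)) (λ i → ⨁ (allFin (suc n)) λ j → k i j)
      ≈⟨ ⨁-cong (allFin (suc n)) (λ i → reflexive (⨁-allFin n (k i))) ⟩
    ⨁ (allFin (suc n)) (λ i → k i zero ∙ ⨁ (allFin n) (λ j → k i (suc j)))
      ≡⟨ ⨁-allFin n (λ i → k i zero ∙ ⨁ (allFin n) (λ j → k i (suc j))) ⟩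
    (ε ∙ ⨁ (allFin n) (λ j → h (zero , suc j))) ∙
    ⨁ (allFin n) (λ i → ε ∙ ⨁ (allFin n) (λ j → k (suc i) (suc j)))
      ≈⟨ ∙-cong (identityˡ _) (⨁-cong (allFin n) λ i → identityˡ _) ⟩
    ⨁ (allFin n) (λ j → h (zero , suc j)) ∙
    ⨁ (allFin n) (λ i → ⨁ (allFin n) (λ j → k (suc i) (suc j)))
      ≈⟨ ∙-congˡ (⨁-pairs≈ n (λ (i , j) → h (suc i , suc j))) ⟨
    ⨁ (allFin n) (λ j → h (zero , suc j)) ∙ ⨁ (pairs n) (λ (i , j) → h (suc i , suc j)) ∎
    where
    k : Fin (suc n) → Fin (suc n) → Carrier
    k i j = if does (i Fin.<? j) then h (i , j) else ε

  ⨁-upTo-suc : ∀ n f → ⨁ (upTo (suc n)) f ≡ f 0 ∙ ⨁ (upTo n) (f ∘ suc)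
  ⨁-upTo-suc n f = ≡.cong (f 0 ∙_) (≡.trans
    (≡.cong (λ ks → ⨁ ks f) (≡.sym (List.map-upTo suc n))) (⨁-map suc (upTo n) f))

  ⨁-upTo-∷ʳ : ∀ n f → ⨁ (upTo (suc n)) f ≈ ⨁ (upTo n) f ∙ f n
  ⨁-upTo-∷ʳ n f = trans (reflexive (≡.cong (λ ks → ⨁ ks f) (≡.sym (List.upTo-∷ʳ n))))
    (trans (⨁-++ (upTo n) (n ∷ []) f) (∙-congˡ (identityʳ (f n))))

  ⨁-cong-< : ∀ n {f g} → (∀ j → j ℕ.< n → f j ≈ g j) → ⨁ (upTo n) f ≈ ⨁ (upTo n) g
  ⨁-cong-< zero    f≈g = refl
  ⨁-cong-< (suc n) {f} {g} f≈g = trans (⨁-upTo-∷ʳ n f) (trans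
    (∙-cong (⨁-cong-< n λ j j<n → f≈g j (ℕ.m<n⇒m<1+n j<n)) (f≈g n ℕ.≤-refl))
    (sym (⨁-upTo-∷ʳ n g)))

  ⨁-upTo-+ : ∀ m n f → ⨁ (upTo (m ℕ.+ n)) f ≈ ⨁ (upTo m) f ∙ ⨁ (upTo n) (λ a → f (m ℕ.+ a))
  ⨁-upTo-+ zero    n f = sym (identityˡ _)
  ⨁-upTo-+ (suc m) n f = trans (reflexive (⨁-upTo-suc (m ℕ.+ n) f)) (trans
    (∙-congˡ (⨁-upTo-+ m n (f ∘ suc))) (trans (sym (assoc _ _ _))
    (∙-congʳ (reflexive (≡.sym (⨁-upTo-suc m f))))))

  -- Reindexing by antidiagonals m = i + j. Passing from r to r + 1 lengthens every inner sum by its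
  -- entry on the antidiagonal r + 1, and appends a last inner sum that has only one entry.
  ⨁-triangle : ∀ r (f : ℕ → ℕ → Carrier) →
    ⨁ (upTo (suc r)) (λ j → ⨁ (upTo (suc (r ℕ.∸ j))) (f j)) ≈
    ⨁ (upTo (suc r)) (λ m → ⨁ (upTo (suc m)) (λ j → f j (m ℕ.∸ j)))
  ⨁-triangle zero    f = refl
  ⨁-triangle (suc r) f = begin
    ⨁ (upTo (suc (suc r))) (λ j → ⨁ (upTo (suc (suc r ℕ.∸ j))) (f j))
      ≈⟨ ⨁-upTo-∷ʳ (suc r) _ ⟩
    ⨁ (upTo (suc r)) (λ j → ⨁ (upTo (suc (suc r ℕ.∸ j))) (f j)) ∙ ⨁ (upTo (suc (r ℕ.∸ r))) (f (suc r))
      ≈⟨ ∙-cong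
           (⨁-cong-< (suc r) λ j j≤r → trans
             (reflexive (≡.cong (λ k → ⨁ (upTo (suc k)) (f j)) (ℕ.+-∸-assoc 1 (ℕ.s≤s⁻¹ j≤r))))
             (trans (⨁-upTo-∷ʳ (suc (r ℕ.∸ j)) (f j))
               (∙-congˡ (reflexive (≡.cong (f j) (≡.sym (ℕ.+-∸-assoc 1 (ℕ.s≤s⁻¹ j≤r))))))))
           (trans (reflexive (≡.cong (λ k → ⨁ (upTo (suc k)) (f (suc r))) (ℕ.n∸n≡0 r)))
             (trans (identityʳ _) (reflexive (≡.cong (f (suc r)) (≡.sym (ℕ.n∸n≡0 r)))))) ⟩
    ⨁ (upTo (suc r)) (λ j → ⨁ (upTo (suc (r ℕ.∸ j))) (f j) ∙ f j (suc r ℕ.∸ j)) ∙ f (suc r) (r ℕ.∸ r)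
      ≈⟨ ∙-congʳ (⨁-∙ (upTo (suc r)) _ _) ⟩
    ⨁ (upTo (suc r)) (λ j → ⨁ (upTo (suc (r ℕ.∸ j))) (f j)) ∙ ⨁ (upTo (suc r))
      (λ j → f j (suc r ℕ.∸ j)) ∙ f (suc r) (r ℕ.∸ r)
      ≈⟨ assoc _ _ _ ⟩
    ⨁ (upTo (suc r)) (λ j → ⨁ (upTo (suc (r ℕ.∸ j))) (f j)) ∙
      (⨁ (upTo (suc r)) (λ j → f j (suc r ℕ.∸ j)) ∙ f (suc r) (r ℕ.∸ r))
      ≈⟨ ∙-cong (⨁-triangle r f) (sym (⨁-upTo-∷ʳ (suc r) _)) ⟩
    ⨁ (upTo (suc r)) (λ m → ⨁ (upTo (suc m)) (λ j → f j (m ℕ.∸ j))) ∙ ⨁ (upTo (suc (suc r)))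
      (λ j → f j (suc r ℕ.∸ j))
      ≈⟨ ⨁-upTo-∷ʳ (suc r) _ ⟨
    ⨁ (upTo (suc (suc r))) (λ m → ⨁ (upTo (suc m)) (λ j → f j (m ℕ.∸ j))) ∎

-- Digraphs without loops, cut by a subset of the vertices

-- A loopless digraph on Fin (suc n) is given by the pairs (arc 0 → 1+j , arc 1+j → 0)
-- together with the loopless digraph induced on the other vertices.
Triangle : ℕ → Set
Triangle zero    = ⊤
Triangle (suc n) = Vec (Bool × Bool) n × Triangle n

toDigraph : ∀ {n} → Triangle n → Digraph n
toDigraph {zero}  _       = []
toDigraph {suc n} (r , t) =
  (false ∷ Vec.map proj₁ r) ∷ zipWith _∷_ (Vec.map proj₂ r) (toDigraph t)

arcs : ∀ {n} → Triangle n → Fin n → Fin n → Bool × Bool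
arcs t i j = adj (toDigraph t) i j , adj (toDigraph t) j i

arcs-0-suc : ∀ {n} (r : Vec (Bool × Bool) n) t j →
  arcs (r , t) zero (suc j) ≡ lookup r j
arcs-0-suc r t j = ≡.cong₂ _,_ (Vec.lookup-map j proj₁ r)
  (≡.trans (≡.cong (λ v → lookup v zero) (Vec.lookup-zipWith _∷_ j (Vec.map proj₂ r) (toDigraph t)))
           (Vec.lookup-map j proj₂ r))

adj-suc-suc : ∀ {n} (r : Vec (Bool × Bool) n) t i j →
  adj (toDigraph (r , t)) (suc i) (suc j) ≡ adj (toDigraph t) i j
adj-suc-suc r t i j =
  ≡.cong (λ v → lookup v (suc j)) (Vec.lookup-zipWith _∷_ i (Vec.map proj₂ r) (toDigraph t))

loopless : ∀ {n} (t : Triangle n) i → ¬ Arc (toDigraph t) i i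
loopless t       zero    = λ ()
loopless (r , t) (suc i) = ≡.subst (λ b → ¬ T b) (≡.sym (adj-suc-suc r t i i)) (loopless t i)

booleans : List Bool
booleans = false ∷ true ∷ []

arcPairs : List (Bool × Bool)
arcPairs = cartesianProduct booleans booleans

triangles : ∀ n → List (Triangle n)
triangles zero    = tt ∷ []
triangles (suc n) = cartesianProduct (allVec arcPairs n) (triangles n)

subsets : ∀ n → List (Subset n)
subsets = allVec booleans

select : ∀ {A : Set} {n} (S : Subset n) → Vec A n → Vec A (size S)
select []          []       = []
select (true  ∷ S) (x ∷ xs) = x ∷ select S xs
select (false ∷ S) (x ∷ xs) = select S xs

restrict : ∀ {n} (S : Subset n) → Triangle n → Triangle (size S)
restrict []          _       = tt
restrict (true  ∷ S) (r , t) = select S r , restrict S t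
restrict (false ∷ S) (r , t) = restrict S t

swap : Bool × Bool → Bool × Bool
swap (a , b) = b , a

-- Recursive form of the condition CutBy below; the recursion is the one that factors
-- the weighted sum over all triangles with a given cut.
Cut : Bool × Bool → ∀ {n} → Subset n → Triangle n → Set
Cut c []          _       = ⊤
Cut c (true  ∷ S) (r , t) = select (∁ S) r ≡ replicate _ c × Cut c S t
Cut c (false ∷ S) (r , t) = select S r ≡ replicate _ (swap c) × Cut c S t

_≟ᵃ_ : DecidableEquality (Bool × Bool)
_≟ᵃ_ = Product.≡-dec Bool._≟_ Bool._≟_

_≟ᵛ_ : ∀ {n} → DecidableEquality (Vec (Bool × Bool) n)
_≟ᵛ_ = Vec.≡-dec _≟ᵃ_

cut? : ∀ c {n} (S : Subset n) t → Dec (Cut c S t)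
cut? c []          _       = yes tt
cut? c (true  ∷ S) (r , t) = (select (∁ S) r ≟ᵛ replicate _ c) ×-dec cut? c S t
cut? c (false ∷ S) (r , t) = (select S r ≟ᵛ replicate _ (swap c)) ×-dec cut? c S t

-- Strongly connected blocks

size+size∁ : ∀ {n} (S : Subset n) → size S ℕ.+ size (∁ S) ≡ n
size+size∁ []          = ≡.refl
size+size∁ (true  ∷ S) = ≡.cong suc (size+size∁ S)
size+size∁ (false ∷ S) = ≡.trans (ℕ.+-suc _ _) (≡.cong suc (size+size∁ S))

size-∪ : ∀ {n} (S T : Subset n) → size (S ∪ T) ℕ.≤ size S ℕ.+ size T
size-∪ []          []          = ℕ.z≤n
size-∪ (true  ∷ S) (true  ∷ T) = ℕ.s≤s (ℕ.≤-trans (size-∪ S T) (ℕ.+-monoʳ-≤ (size S) (ℕ.n≤1+n _)))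
size-∪ (true  ∷ S) (false ∷ T) = ℕ.s≤s (size-∪ S T)
size-∪ (false ∷ S) (true  ∷ T) = ℕ.≤-trans (ℕ.s≤s (size-∪ S T)) (ℕ.≤-reflexive (≡.sym (ℕ.+-suc (size S) _)))
size-∪ (false ∷ S) (false ∷ T) = size-∪ S T

-- The increasing enumeration of S: vertex a of `restrict S t` is vertex `embed S a` of t.
embed : ∀ {n} (S : Subset n) → Fin (size S) → Fin n
embed (true  ∷ S) zero    = zero
embed (true  ∷ S) (suc a) = suc (embed S a)
embed (false ∷ S) a       = suc (embed S a)

embed-injective : ∀ {n} (S : Subset n) {a b} → embed S a ≡ embed S b → a ≡ b
embed-injective (true  ∷ S) {zero}  {zero}  _  = ≡.refl
embed-injective (true  ∷ S) {suc a} {suc b} eq = ≡.cong suc (embed-injective S (Fin.suc-injective eq))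
embed-injective (false ∷ S) eq = embed-injective S (Fin.suc-injective eq)

embed-∈ : ∀ {n} (S : Subset n) a → embed S a ∈ S
embed-∈ (true  ∷ S) zero    = here
embed-∈ (true  ∷ S) (suc a) = there (embed-∈ S a)
embed-∈ (false ∷ S) a       = there (embed-∈ S a)

∈⇒embed : ∀ {n} {S : Subset n} {x} → x ∈ S → ∃ λ a → x ≡ embed S a
∈⇒embed here = zero , ≡.refl
∈⇒embed {S = true ∷ _} (there x∈S) with ∈⇒embed x∈S
... | a , ≡.refl = suc a , ≡.refl
∈⇒embed {S = false ∷ _} (there x∈S) with ∈⇒embed x∈S
... | a , ≡.refl = a , ≡.refl

-- The image of a subset under `embed S`.
expand : ∀ {n} (S : Subset n) → Subset (size S) → Subset n
expand []          _       = []
expand (true  ∷ S) (b ∷ T) = b ∷ expand S T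
expand (false ∷ S) T       = false ∷ expand S T

expand⁺ : ∀ {n} (S : Subset n) {T a} → a ∈ T → embed S a ∈ expand S T
expand⁺ (true  ∷ S) here        = here
expand⁺ (true  ∷ S) (there a∈T) = there (expand⁺ S a∈T)
expand⁺ (false ∷ S) a∈T         = there (expand⁺ S a∈T)

expand⁻ : ∀ {n} (S : Subset n) {T x} → x ∈ expand S T → ∃ λ a → x ≡ embed S a × a ∈ T
expand⁻ (true ∷ S) {_ ∷ _} here = zero , ≡.refl , here
expand⁻ (true ∷ S) {_ ∷ _} (there x∈) with expand⁻ S x∈
... | a , ≡.refl , a∈T = suc a , ≡.refl , there a∈T
expand⁻ (false ∷ S) (there x∈) with expand⁻ S x∈
... | a , ≡.refl , a∈T = a , ≡.refl , a∈T

lookup-select : ∀ {A : Set} {n} (S : Subset n) (xs : Vec A n) a →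
  lookup (select S xs) a ≡ lookup xs (embed S a)
lookup-select (true  ∷ S) (x ∷ xs) zero    = ≡.refl
lookup-select (true  ∷ S) (x ∷ xs) (suc a) = lookup-select S xs a
lookup-select (false ∷ S) (x ∷ xs) a       = lookup-select S xs a

adj-restrict : ∀ {n} (S : Subset n) (t : Triangle n) a b →
  adj (toDigraph (restrict S t)) a b ≡ adj (toDigraph t) (embed S a) (embed S b)
adj-restrict (true ∷ S) (r , t) zero zero = ≡.refl
adj-restrict (true ∷ S) (r , t) zero (suc b) = ≡.cong proj₁ (≡.trans
  (arcs-0-suc (select S r) (restrict S t) b)
  (≡.trans (lookup-select S r b) (≡.sym (arcs-0-suc r t (embed S b)))))
adj-restrict (true ∷ S) (r , t) (suc a) zero = ≡.cong proj₂ (≡.trans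
  (arcs-0-suc (select S r) (restrict S t) a)
  (≡.trans (lookup-select S r a) (≡.sym (arcs-0-suc r t (embed S a)))))
adj-restrict (true ∷ S) (r , t) (suc a) (suc b) = ≡.trans
  (adj-suc-suc (select S r) (restrict S t) a b)
  (≡.trans (adj-restrict S t a b) (≡.sym (adj-suc-suc r t (embed S a) (embed S b))))
adj-restrict (false ∷ S) (r , t) a b =
  ≡.trans (adj-restrict S t a b) (≡.sym (adj-suc-suc r t (embed S a) (embed S b)))

-- The recursive `Cut` is the form that can be summed, this one is for arguments about paths. For c
-- = (true , false) every pair across is joined by a single arc leaving S; for c = (false , false)
-- no arc runs across.
CutBy : Bool × Bool → ∀ {n} → Subset n → Triangle n → Set
CutBy c S t = ∀ i j → i ∈ S → j ∉ S → arcs t i j ≡ c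

select≡replicate⁺ : ∀ {A : Set} {n} (S : Subset n) (xs : Vec A n) {x} →
  (∀ i → i ∈ S → lookup xs i ≡ x) → select S xs ≡ replicate _ x
select≡replicate⁺ []          []       _ = ≡.refl
select≡replicate⁺ (true  ∷ S) (x ∷ xs) h =
  ≡.cong₂ _∷_ (h zero here) (select≡replicate⁺ S xs λ i i∈S → h (suc i) (there i∈S))
select≡replicate⁺ (false ∷ S) (x ∷ xs) h = select≡replicate⁺ S xs λ i i∈S → h (suc i) (there i∈S)

select≡replicate⁻ : ∀ {A : Set} {n} (S : Subset n) (xs : Vec A n) {x} →
  select S xs ≡ replicate _ x → ∀ i → i ∈ S → lookup xs i ≡ x
select≡replicate⁻ (true  ∷ S) (x ∷ xs) eq zero    here        = Vec.∷-injectiveˡ eq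
select≡replicate⁻ (true  ∷ S) (x ∷ xs) eq (suc i) (there i∈S) =
  select≡replicate⁻ S xs (Vec.∷-injectiveʳ eq) i i∈S
select≡replicate⁻ (false ∷ S) (x ∷ xs) eq (suc i) (there i∈S) = select≡replicate⁻ S xs eq i i∈S

arcs-suc-suc : ∀ {n} (r : Vec (Bool × Bool) n) t i j → arcs (r , t) (suc i) (suc j) ≡ arcs t i j
arcs-suc-suc r t i j = ≡.cong₂ _,_ (adj-suc-suc r t i j) (adj-suc-suc r t j i)

Cut⇒CutBy : ∀ c {n} (S : Subset n) t → Cut c S t → CutBy c S t
Cut⇒CutBy c (true ∷ S) (r , t) _ zero zero _ j∉S = contradiction here j∉S
Cut⇒CutBy c (true ∷ S) (r , t) (eq , _) zero (suc j) _ j∉S = ≡.trans (arcs-0-suc r t j)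
  (select≡replicate⁻ (∁ S) r eq j (Subset.x∉p⇒x∈∁p (j∉S ∘ there)))
Cut⇒CutBy c (true ∷ S) (r , t) _ (suc i) zero _ j∉S = contradiction here j∉S
Cut⇒CutBy c (true ∷ S) (r , t) (_ , cut) (suc i) (suc j) (there i∈S) j∉S =
  ≡.trans (arcs-suc-suc r t i j) (Cut⇒CutBy c S t cut i j i∈S (j∉S ∘ there))
Cut⇒CutBy c (false ∷ S) (r , t) (eq , _) (suc i) zero (there i∈S) _ =
  ≡.cong swap (≡.trans (arcs-0-suc r t i) (select≡replicate⁻ S r eq i i∈S))
Cut⇒CutBy c (false ∷ S) (r , t) (_ , cut) (suc i) (suc j) (there i∈S) j∉S =
  ≡.trans (arcs-suc-suc r t i j) (Cut⇒CutBy c S t cut i j i∈S (j∉S ∘ there))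

CutBy⇒Cut : ∀ c {n} (S : Subset n) t → CutBy c S t → Cut c S t
CutBy⇒Cut c []          _       _   = tt
CutBy⇒Cut c (true ∷ S)  (r , t) cut =
  select≡replicate⁺ (∁ S) r (λ j j∈∁S → ≡.trans (≡.sym (arcs-0-suc r t j))
    (cut zero (suc j) here λ { (there j∈S) → Subset.x∈p⇒x∉∁p j∈S j∈∁S })) ,
  CutBy⇒Cut c S t λ i j i∈S j∉S → ≡.trans (≡.sym (arcs-suc-suc r t i j))
    (cut (suc i) (suc j) (there i∈S) λ { (there j∈S) → j∉S j∈S })
CutBy⇒Cut c (false ∷ S) (r , t) cut =
  select≡replicate⁺ S r (λ i i∈S → ≡.trans (≡.sym (arcs-0-suc r t i))
    (≡.cong swap (cut (suc i) zero (there i∈S) λ ()))) ,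
  CutBy⇒Cut c S t λ i j i∈S j∉S → ≡.trans (≡.sym (arcs-suc-suc r t i j))
    (cut (suc i) (suc j) (there i∈S) λ { (there j∈S) → j∉S j∈S })

module _ {n} (A : Digraph n) where

  ReachableFrom : Fin n → Subset n → Set
  ReachableFrom x T = x ∈ T × (∀ {j} → j ∈ T → Star (Arc A) x j) ×
                      (∀ {i j} → i ∈ T → Arc A i j → j ∈ T)

  -- Heads of arcs that leave T are added until no arc leaves T; each addition enlarges T, so the
  -- process stops.
  reachableSet : ∀ x → ∃ (ReachableFrom x)
  reachableSet x = grow ⁅ x ⁆ (⊃-wellFounded _) (Subset.x∈⁅x⁆ x) single
    where
    single : ∀ {j} → j ∈ ⁅ x ⁆ → Star (Arc A) x j
    single j∈ with ≡.refl ← Subset.x∈⁅y⁆⇒x≡y x j∈ = nil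
    grow : ∀ T → Acc Subset._⊃_ T → x ∈ T → (∀ {j} → j ∈ T → Star (Arc A) x j) → ∃ (ReachableFrom x)
    grow T (acc rec) x∈T reach
      with Fin.any? (λ i → Fin.any? λ j → (i Subset.∈? T) ×-dec (¬? (j Subset.∈? T) ×-dec Arc? A i j))
    ... | yes (i , j , i∈T , j∉T , a) = grow (T ∪ ⁅ j ⁆)
        (rec (Subset.p⊆p∪q ⁅ j ⁆ , j , Subset.q⊆p∪q T ⁅ j ⁆ (Subset.x∈⁅x⁆ j) , j∉T))
        (Subset.p⊆p∪q ⁅ j ⁆ x∈T) reach′
      where
      reach′ : ∀ {k} → k ∈ T ∪ ⁅ j ⁆ → Star (Arc A) x k
      reach′ k∈ with Subset.x∈p∪q⁻ T ⁅ j ⁆ k∈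
      ... | inj₁ k∈T = reach k∈T
      ... | inj₂ k∈j with ≡.refl ← Subset.x∈⁅y⁆⇒x≡y j k∈j = reach i∈T ◅◅ (a ◅ nil)
    ... | no ¬out = T , x∈T , reach , λ {i} {j} i∈T a → closed i j i∈T a (j Subset.∈? T)
      where
      closed : ∀ i j → i ∈ T → Arc A i j → Dec (j ∈ T) → j ∈ T
      closed i j i∈T a (yes j∈T) = j∈T
      closed i j i∈T a (no j∉T)  = contradiction (i , j , i∈T , j∉T , a) ¬out

  Unreachable : Subset n → Set
  Unreachable T = Nonempty T × (∃ λ j → j ∉ T) × (∀ {i j} → i ∈ T → j ∉ T → ¬ Arc A j i)

  -- Deciding strong connectedness gives no witness when it fails. The complement of the set
  -- reachable from a suitable x is one: no arc enters it from outside.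
  strong⊎unreachable : StronglyConnected A ⊎ ∃ Unreachable
  strong⊎unreachable = all⊎ from
    where
    all⊎ : ∀ {m} {P : Fin m → Set} {Q : Set} → (∀ x → P x ⊎ Q) → (∀ x → P x) ⊎ Q
    all⊎ {zero}  f = inj₁ λ ()
    all⊎ {suc m} f with f zero | all⊎ (f ∘ suc)
    ... | inj₂ q | _       = inj₂ q
    ... | inj₁ _ | inj₂ q  = inj₂ q
    ... | inj₁ p | inj₁ ps = inj₁ λ { zero → p ; (suc i) → ps i }
    from : ∀ x → (∀ j → Star (Arc A) x j) ⊎ ∃ Unreachable
    from x with reachableSet x
    ... | T , x∈T , reach , closed with Subset.nonempty? (∁ T)
    ...   | no ¬ne = inj₁ λ j → reach (Subset.x∉∁p⇒x∈p λ j∈ → ¬ne (j , j∈))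
    ...   | yes ne = inj₂ (∁ T , ne , (x , Subset.x∈p⇒x∉∁p x∈T) ,
                           λ i∈ j∉ a → Subset.x∈∁p⇒x∉p i∈ (closed (Subset.x∉∁p⇒x∈p j∉) a))

module _ {n} (t : Triangle n) where

  Strong : Subset n → Set
  Strong S = StronglyConnected (toDigraph (restrict S t))

  -- The second component of the cut says that an arc which ends in S starts in S. Hence a path
  -- inside S′ that ends at z lies in S, as is seen by tracing it back from its end.
  strong-⊆ : ∀ {a S S′ z} → CutBy (a , false) S t → Strong S′ → z ∈ S → z ∈ S′ → S′ ⊆ S
  strong-⊆ {a} {S} {S′} cut strong z∈S z∈S′ y∈S′ with ∈⇒embed z∈S′ | ∈⇒embed y∈S′
  ... | b , ≡.refl | d , ≡.refl = backwards z∈S (strong d b)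
    where
    backwards : ∀ {u v} → embed S′ v ∈ S → Star (Arc (toDigraph (restrict S′ t))) u v → embed S′ u ∈ S
    backwards v∈S nil = v∈S
    backwards {u} v∈S (_◅_ {j = w} arc path) with embed S′ u Subset.∈? S
    ... | yes u∈S = u∈S
    ... | no  u∉S = contradiction
      (≡.subst T (≡.trans (adj-restrict S′ t u w) (≡.cong proj₂
        (cut _ _ (backwards v∈S path) u∉S))) arc) λ ()

  strong-unique : ∀ {a S S′ z} → CutBy (a , false) S t → CutBy (a , false) S′ t →
    Strong S → Strong S′ → z ∈ S → z ∈ S′ → S ≡ S′
  strong-unique cut cut′ strong strong′ z∈S z∈S′ = Subset.⊆-antisym
    (strong-⊆ cut′ strong z∈S′ z∈S) (strong-⊆ cut strong′ z∈S z∈S′)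

  module _ (c : Bool × Bool) (forced : ∀ {i j} → i ≢ j → ¬ Arc (toDigraph t) j i → arcs t i j ≡ c) where

    -- If S is not strong, it has a proper part that no arc enters from the rest of S. By `forced`
    -- these missing arcs determine the pairs completely, so the part is again a cut set; towards
    -- the vertices outside S the cut is inherited. The hypothesis `forced` holds for tournaments
    -- with c = (true , false) and for graphs with c = (false , false).
    strong⊎smaller : ∀ {S} → CutBy c S t → Strong S ⊎ ∃ λ U → U ⊂ S × Nonempty U × CutBy c U t
    strong⊎smaller {S} cut with strong⊎unreachable (toDigraph (restrict S t))
    ... | inj₁ strong = inj₁ strong
    ... | inj₂ (T , (a , a∈T) , (b , b∉T) , noArc) = inj₂
      (U , (U⊆S , embed S b , embed-∈ S b , b∉U) , (embed S a , expand⁺ S a∈T) , cutU)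
      where
      U = expand S T
      U⊆S : U ⊆ S
      U⊆S x∈U with expand⁻ S x∈U
      ... | a , ≡.refl , _ = embed-∈ S a
      b∉U : embed S b ∉ U
      b∉U b∈U with expand⁻ S b∈U
      ... | b′ , eq , b′∈T with ≡.refl ← embed-injective S eq = b∉T b′∈T
      cutU : CutBy c U t
      cutU i j i∈U j∉U with j Subset.∈? S
      ... | no j∉S = cut i j (U⊆S i∈U) j∉S
      ... | yes j∈S with expand⁻ S i∈U | ∈⇒embed j∈S
      ...   | d , ≡.refl , d∈T | e , ≡.refl = forced
        (λ eq → j∉U (≡.subst (_∈ U) eq i∈U))
        (λ arc → noArc d∈T (j∉U ∘ expand⁺ S) (≡.subst Data.Bool.T (≡.sym (adj-restrict S t e d)) arc))

    -- Descent: a nonempty cut set that is minimal under inclusion is strong.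
    strong-exists : ∀ {S} → Acc _⊂_ S → Nonempty S → CutBy c S t →
      ∃ λ U → Nonempty U × CutBy c U t × Strong U
    strong-exists {S} (acc rec) ne cut with strong⊎smaller cut
    ... | inj₁ strong = S , ne , cut , strong
    ... | inj₂ (U , U⊂S , neU , cutU) = strong-exists (rec U⊂S) neU cutU

  fullCut : ∀ c → CutBy c Subset.⊤ t
  fullCut c i j _ j∉⊤ = contradiction Subset.∈⊤ j∉⊤

  -- For x in S only and y in S′ only, the cut by S demands the arc from x to y and the cut by S′
  -- forbids it.
  tournament-strong-meet : ∀ {S S′} → CutBy (true , false) S t → CutBy (true , false) S′ t →
    Nonempty S → Nonempty S′ → ∃ λ z → z ∈ S × z ∈ S′
  tournament-strong-meet {S} {S′} cut cut′ (x , x∈S) (y , y∈S′) with x Subset.∈? S′ | y Subset.∈? S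
  ... | yes x∈S′ | _       = x , x∈S , x∈S′
  ... | no  _    | yes y∈S = y , y∈S , y∈S′
  ... | no  x∉S′ | no  y∉S = contradiction
    (≡.trans (≡.sym (≡.cong proj₁ (cut x y x∈S y∉S))) (≡.cong proj₂ (cut′ y x y∈S′ x∉S′))) λ ()

  module _ (symmetric : ∀ i j → i ≢ j → adj (toDigraph t) i j ≡ adj (toDigraph t) j i) where

    forced-no : ∀ {i j} → i ≢ j → ¬ Arc (toDigraph t) j i → arcs t i j ≡ (false , false)
    forced-no {i} {j} i≢j ¬arc with adj (toDigraph t) i j | adj (toDigraph t) j i | symmetric i j i≢j
    ... | _ | false | ≡.refl = ≡.refl
    ... | _ | true  | ≡.refl = contradiction tt ¬arc

  CutBy-∁ : ∀ {S} → CutBy (false , false) S t → CutBy (false , false) (∁ S) t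
  CutBy-∁ cut i j i∈ j∉ = ≡.cong swap (cut j i (Subset.x∉∁p⇒x∈p j∉) (Subset.x∈∁p⇒x∉p i∈))

  CutBy-∪ : ∀ {S U} → CutBy (false , false) S t → CutBy (false , false) U t →
            CutBy (false , false) (S ∪ U) t
  CutBy-∪ {S} {U} cut cut′ i j i∈ j∉ with Subset.x∈p∪q⁻ S U i∈
  ... | inj₁ i∈S = cut i j i∈S (j∉ ∘ Subset.p⊆p∪q U)
  ... | inj₂ i∈U = cut′ i j i∈U (j∉ ∘ Subset.q⊆p∪q S U)

  module _ (forced : ∀ {i j} → i ≢ j → ¬ Arc (toDigraph t) j i → arcs t i j ≡ (false , false))
           (r : ℕ) (large : r ℕ.+ r ℕ.+ r ℕ.< n) where

    Large : Subset n → Set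
    Large S = size (∁ S) ℕ.≤ r × CutBy (false , false) S t × Strong S

    -- The complement is taken to be the smaller side, so that the index j = `size (∁ S)` of
    -- `middleTerm` satisfies j ≤ n - j; `split-bound` relies on this.
    Middle : Subset n → Set
    Middle S = r ℕ.< size (∁ S) × size (∁ S) ℕ.≤ size S × CutBy (false , false) S t

    size∁∁ : ∀ (S : Subset n) → size (∁ (∁ S)) ≡ size S
    size∁∁ S = ℕ.+-cancelˡ-≡ (size (∁ S)) _ _ (≡.trans (size+size∁ (∁ S))
      (≡.trans (≡.sym (size+size∁ S)) (ℕ.+-comm (size S) _)))

    middle : ∀ {S} → r ℕ.< size S → r ℕ.< size (∁ S) → CutBy (false , false) S t → ∃ Middle
    middle {S} r<S r<∁S cut with ℕ.≤-total (size (∁ S)) (size S)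
    ... | inj₁ ∁S≤S = S , r<∁S , ∁S≤S , cut
    ... | inj₂ S≤∁S = ∁ S , ≡.subst (r ℕ.<_) (≡.sym (size∁∁ S)) r<S
                    , ≡.subst (ℕ._≤ size (∁ S)) (≡.sym (size∁∁ S)) S≤∁S , CutBy-∁ cut

    -- A cut set S with at least n - r vertices is shrunk until it is connected: if it is not,
    -- it splits into U and ∁ W, and W has at most 2 r vertices when U has at most r.
    large⊎middle : ∀ {S} → Acc _⊂_ S → size (∁ S) ℕ.≤ r → CutBy (false , false) S t → ∃ Large ⊎ ∃ Middle
    large⊎middle {S} (acc rec) ∁S≤r cut with strong⊎smaller (false , false) forced cut
    ... | inj₁ strong = inj₁ (S , ∁S≤r , cut , strong)
    ... | inj₂ (U , U⊂S , (u , u∈U) , cutU) with size (∁ U) ℕ.≤? r | size U ℕ.≤? r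
    ...   | yes ∁U≤r | _      = large⊎middle (rec U⊂S) ∁U≤r cutU
    ...   | no  ∁U≰r | no U≰r = inj₂ (middle (ℕ.≰⇒> U≰r) (ℕ.≰⇒> ∁U≰r) cutU)
    ...   | no  _    | yes U≤r = remainder (size W ℕ.≤? r)
      where
      W = ∁ S ∪ U
      W≤2r : size W ℕ.≤ r ℕ.+ r
      W≤2r = ℕ.≤-trans (size-∪ (∁ S) U) (ℕ.+-mono-≤ ∁S≤r U≤r)
      cutW : CutBy (false , false) W t
      cutW = CutBy-∪ (CutBy-∁ cut) cutU
      ∁W⊂S : ∁ W ⊂ S
      ∁W⊂S = (λ x∈ → Subset.x∉∁p⇒x∈p (Subset.x∈∁p⇒x∉p x∈ ∘ Subset.p⊆p∪q U))
           , u , proj₁ U⊂S u∈U , Subset.x∈p⇒x∉∁p (Subset.q⊆p∪q (∁ S) U u∈U)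
      -- The bound n > 3 r enters here: W takes at most 2 r vertices, so more than r remain.
      r<∁W : r ℕ.< size (∁ W)
      r<∁W = ℕ.+-cancelˡ-< (r ℕ.+ r) r _ (ℕ.<-≤-trans large (ℕ.≤-trans
        (ℕ.≤-reflexive (≡.sym (size+size∁ W))) (ℕ.+-monoˡ-≤ (size (∁ W)) W≤2r)))
      remainder : Dec (size W ℕ.≤ r) → ∃ Large ⊎ ∃ Middle
      remainder (yes W≤r) = large⊎middle (rec ∁W⊂S) (ℕ.≤-trans (ℕ.≤-reflexive (size∁∁ W)) W≤r)
        (CutBy-∁ cutW)
      remainder (no  W≰r) = inj₂ (middle (ℕ.≰⇒> W≰r) r<∁W cutW)

    -- Two vertex sets that miss at most r vertices each cannot be disjoint, and strong cut sets
    -- that meet coincide.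
    large-unique : ∀ {S S′} → Large S → Large S′ → S ≡ S′
    large-unique {S} {S′} (∁S≤r , cut , strong) (∁S′≤r , cut′ , strong′) with Subset.nonempty?
      (S Subset.∩ S′)
    ... | yes (z , z∈) = strong-unique cut cut′ strong strong′
            (proj₁ (Subset.x∈p∩q⁻ S S′ z∈)) (proj₂ (Subset.x∈p∩q⁻ S S′ z∈))
    ... | no disjoint = contradiction (begin
      size S′ ℕ.+ size (∁ S′)    ≤⟨ ℕ.+-mono-≤ (Subset.p⊆q⇒∣p∣≤∣q∣ S′⊆∁S) ∁S′≤r ⟩
      size (∁ S) ℕ.+ r           ≤⟨ ℕ.+-monoˡ-≤ r ∁S≤r ⟩
      r ℕ.+ r                    ≤⟨ ℕ.m≤m+n (r ℕ.+ r) r ⟩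
      r ℕ.+ r ℕ.+ r              ∎)
      (ℕ.<⇒≱ (≡.subst (r ℕ.+ r ℕ.+ r ℕ.<_) (≡.sym (size+size∁ S′)) large))
      where
      open ℕ.≤-Reasoning
      S′⊆∁S : S′ ⊆ ∁ S
      S′⊆∁S x∈S′ = Subset.x∉p⇒x∈∁p λ x∈S → disjoint (_ , Subset.x∈p∩q⁺ (x∈S , x∈S′))

-- Weighted enumeration of digraphs

module Weighted (S : CommutativeSemiring 0ℓ 0ℓ) where
  open CommutativeSemiring S hiding (zero)
  open Algebra.Properties.Semiring.Exp semiring
  open Algebra.Properties.CommutativeSemigroup *-commutativeSemigroup
    using (interchange; x∙yz≈y∙xz)
  open Relation.Binary.Reasoning.Setoid setoid
  open BigOperator +-commutativeMonoid public
    renaming (⨁ to ∑; ⨁-upTo-suc to ∑-upTo-suc; ⨁-upTo-∷ʳ to ∑-upTo-∷ʳ; ⨁-cong-< to ∑-cong-<;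
      ⨁-upTo-+ to ∑-upTo-+; ⨁-triangle to ∑-triangle; ⨁-cong to ∑-cong; ⨁-ε to ∑-0; ⨁-∙ to ∑-+;
        ⨁-comm to ∑-comm;
      ⨁-cartesianProductWith to ∑-cartesianProductWith; ⨁-filter to ∑-filter; ⨁-++ to ∑-++; ⨁-map to ∑-map)
  module ∏ = BigOperator *-commutativeMonoid
  open ∏ using () renaming (⨁ to ∏; ⨁-cong to ∏-cong; ⨁-allFin to ∏-allFin; ⨁-pairs to ∏-pairs;
    ⨁-pairs≈ to ∏-pairs≈)

  𝟙 : ∀ {P : Set} → Dec P → Carrier
  𝟙 P? = if does P? then 1# else 0#

  𝟙-yes : ∀ {P : Set} (P? : Dec P) → P → 𝟙 P? ≈ 1#
  𝟙-yes (yes _) _ = refl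
  𝟙-yes (no ¬p) p = contradiction p ¬p

  𝟙-no : ∀ {P : Set} (P? : Dec P) → ¬ P → 𝟙 P? ≈ 0#
  𝟙-no (yes p) ¬p = contradiction p ¬p
  𝟙-no (no _)  _  = refl

  𝟙-⇔ : ∀ {P Q : Set} (P? : Dec P) (Q? : Dec Q) → (P → Q) → (Q → P) → 𝟙 P? ≈ 𝟙 Q?
  𝟙-⇔ (yes p) Q? f g = sym (𝟙-yes Q? (f p))
  𝟙-⇔ (no ¬p) Q? f g = sym (𝟙-no Q? (¬p ∘ g))

  𝟙-× : ∀ {P Q : Set} (P? : Dec P) (Q? : Dec Q) → 𝟙 (P? ×-dec Q?) ≈ 𝟙 P? * 𝟙 Q?
  𝟙-× (yes _) Q? = sym (*-identityˡ _)
  𝟙-× (no _)  Q? = sym (zeroˡ _)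

  if≈𝟙* : ∀ b x → (if b then x else 0#) ≈ (if b then 1# else 0#) * x
  if≈𝟙* true  x = sym (*-identityˡ x)
  if≈𝟙* false x = sym (zeroˡ x)

  ∑-filter-𝟙 : ∀ {A : Set} {P : Pred A 0ℓ} (P? : Decidable P) xs f →
    ∑ (filter P? xs) f ≈ ∑ xs (λ x → 𝟙 (P? x) * f x)
  ∑-filter-𝟙 P? xs f = trans (∑-filter P? xs f) (∑-cong xs λ x → if≈𝟙* (does (P? x)) (f x))

  module _ {A : Set} where

    *-∑ : ∀ a (xs : List A) f → a * ∑ xs f ≈ ∑ xs (λ x → a * f x)
    *-∑ a []       f = zeroʳ a
    *-∑ a (x ∷ xs) f = trans (distribˡ a _ _) (+-congˡ (*-∑ a xs f))

    ∑-* : ∀ a (xs : List A) f → ∑ xs f * a ≈ ∑ xs (λ x → f x * a)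
    ∑-* a xs f = trans (*-comm _ a) (trans (*-∑ a xs f) (∑-cong xs λ x → *-comm a (f x)))

  ∑-*-∑ : ∀ {A B : Set} (xs : List A) (ys : List B) (f : A → Carrier) (g : B → Carrier) →
    ∑ xs (λ x → ∑ ys (λ y → f x * g y)) ≈ ∑ xs f * ∑ ys g
  ∑-*-∑ xs ys f g =
    trans (∑-cong xs λ x → sym (*-∑ (f x) ys g)) (sym (∑-* (∑ ys g) xs f))

  module Rows {A : Set} (xs : List A) (φ : A → Carrier) where

    rowWeight : ∀ {n} → Vec A n → Carrier
    rowWeight []      = 1#
    rowWeight (x ∷ r) = φ x * rowWeight r

    rowTotal : ∀ n → ∑ (allVec xs n) rowWeight ≈ ∑ xs φ ^ n
    rowTotal zero    = +-identityʳ 1#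
    rowTotal (suc n) = begin
      ∑ (allVec xs (suc n)) rowWeight
        ≈⟨ ∑-cartesianProductWith _∷_ xs (allVec xs n) rowWeight ⟩
      ∑ xs (λ x → ∑ (allVec xs n) (λ r → φ x * rowWeight r))
        ≈⟨ ∑-*-∑ xs (allVec xs n) φ rowWeight ⟩
      ∑ xs φ * ∑ (allVec xs n) rowWeight
        ≈⟨ *-congˡ (rowTotal n) ⟩
      ∑ xs φ ^ suc n ∎

    -- The entries at S and those at its complement range independently of each other.
    ∑-rows : ∀ {n} (S : Subset n)
      (f : Vec A (size S) → Carrier) (h : Vec A (size (∁ S)) → Carrier) →
      ∑ (allVec xs n) (λ r → rowWeight r * (f (select S r) * h (select (∁ S) r))) ≈
      ∑ (allVec xs (size S)) (λ r → rowWeight r * f r) *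
      ∑ (allVec xs (size (∁ S))) (λ r → rowWeight r * h r)
    ∑-rows [] f h = begin
      1# * (f [] * h []) + 0#                    ≈⟨ +-identityʳ _ ⟩
      1# * (f [] * h [])                         ≈⟨ *-congʳ (*-identityˡ 1#) ⟨
      1# * 1# * (f [] * h [])                    ≈⟨ interchange _ _ _ _ ⟩
      1# * f [] * (1# * h [])                    ≈⟨ *-cong (+-identityʳ _) (+-identityʳ _) ⟨
      (1# * f [] + 0#) * (1# * h [] + 0#)        ∎
    ∑-rows {suc n} (true ∷ S) f h = begin
      ∑ (allVec xs (suc n)) _
        ≈⟨ ∑-cartesianProductWith _∷_ xs (allVec xs n) _ ⟩
      ∑ xs (λ x → ∑ (allVec xs n) λ r →
        φ x * rowWeight r * (f (x ∷ select S r) * h (select (∁ S) r)))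
        ≈⟨ ∑-cong xs (λ x → trans
             (∑-cong (allVec xs n) λ r → *-assoc (φ x) _ _)
             (sym (*-∑ (φ x) (allVec xs n) _))) ⟩
      ∑ xs (λ x → φ x * ∑ (allVec xs n) λ r →
        rowWeight r * (f (x ∷ select S r) * h (select (∁ S) r)))
        ≈⟨ ∑-cong xs (λ x → trans
             (*-congˡ (∑-rows S (λ r → f (x ∷ r)) h)) (sym (*-assoc (φ x) _ _))) ⟩
      ∑ xs (λ x → φ x * ∑ (allVec xs (size S)) (λ r → rowWeight r * f (x ∷ r)) * H)
        ≈⟨ ∑-* H xs _ ⟨
      ∑ xs (λ x → φ x * ∑ (allVec xs (size S)) (λ r → rowWeight r * f (x ∷ r))) * H
        ≈⟨ *-congʳ (∑-cong xs λ x → trans (*-∑ (φ x) (allVec xs (size S)) _)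
             (∑-cong (allVec xs (size S)) λ r → sym (*-assoc (φ x) _ _))) ⟩
      ∑ xs (λ x → ∑ (allVec xs (size S)) (λ r → φ x * rowWeight r * f (x ∷ r))) * H
        ≈⟨ *-congʳ (∑-cartesianProductWith _∷_ xs (allVec xs (size S)) _) ⟨
      ∑ (allVec xs (suc (size S))) (λ r → rowWeight r * f r) * H ∎
      where H = ∑ (allVec xs (size (∁ S))) (λ r → rowWeight r * h r)
    ∑-rows {suc n} (false ∷ S) f h = begin
      ∑ (allVec xs (suc n)) _
        ≈⟨ ∑-cartesianProductWith _∷_ xs (allVec xs n) _ ⟩
      ∑ xs (λ x → ∑ (allVec xs n) λ r →
        φ x * rowWeight r * (f (select S r) * h (x ∷ select (∁ S) r)))
        ≈⟨ ∑-cong xs (λ x → trans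
             (∑-cong (allVec xs n) λ r → *-assoc (φ x) _ _)
             (sym (*-∑ (φ x) (allVec xs n) _))) ⟩
      ∑ xs (λ x → φ x * ∑ (allVec xs n) λ r →
        rowWeight r * (f (select S r) * h (x ∷ select (∁ S) r)))
        ≈⟨ ∑-cong xs (λ x → trans
             (*-congˡ (∑-rows S f (λ r → h (x ∷ r)))) (x∙yz≈y∙xz (φ x) F _)) ⟩
      ∑ xs (λ x → F * (φ x * ∑ (allVec xs (size (∁ S))) (λ r → rowWeight r * h (x ∷ r))))
        ≈⟨ *-∑ F xs _ ⟨
      F * ∑ xs (λ x → φ x * ∑ (allVec xs (size (∁ S))) (λ r → rowWeight r * h (x ∷ r)))
        ≈⟨ *-congˡ (∑-cong xs λ x → trans (*-∑ (φ x) (allVec xs (size (∁ S))) _)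
             (∑-cong (allVec xs (size (∁ S))) λ r → sym (*-assoc (φ x) _ _))) ⟩
      F * ∑ xs (λ x → ∑ (allVec xs (size (∁ S))) (λ r → φ x * rowWeight r * h (x ∷ r)))
        ≈⟨ *-congˡ (∑-cartesianProductWith _∷_ xs (allVec xs (size (∁ S))) _) ⟨
      F * ∑ (allVec xs (suc (size (∁ S)))) (λ r → rowWeight r * h r) ∎
      where F = ∑ (allVec xs (size S)) (λ r → rowWeight r * f r)

  module _ (φ : Bool × Bool → Carrier) where
    open Rows arcPairs φ

    weightΔ : ∀ {n} → Triangle n → Carrier
    weightΔ {zero}  _       = 1#
    weightΔ {suc n} (r , t) = rowWeight r * weightΔ t

    total : ℕ → Carrier
    total n = ∑ (triangles n) weightΔ

    strongTotal : ℕ → Carrier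
    strongTotal n = ∑ (triangles n) λ t → weightΔ t * 𝟙 (stronglyConnected? (toDigraph t))

    ∑-triangles : ∀ n f → ∑ (triangles (suc n)) f ≈
      ∑ (allVec arcPairs n) (λ r → ∑ (triangles n) (λ t → f (r , t)))
    ∑-triangles n = ∑-cartesianProductWith _,_ (allVec arcPairs n) (triangles n)

    total≈ : ∀ n → total n ≈ ∑ arcPairs φ ^ triangular n
    total≈ zero    = +-identityʳ 1#
    total≈ (suc n) = begin
      total (suc n)
        ≈⟨ ∑-triangles n weightΔ ⟩
      ∑ (allVec arcPairs n) (λ r → ∑ (triangles n) (λ t → rowWeight r * weightΔ t))
        ≈⟨ ∑-*-∑ (allVec arcPairs n) (triangles n) rowWeight weightΔ ⟩
      ∑ (allVec arcPairs n) rowWeight * total n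
        ≈⟨ *-cong (rowTotal n) (total≈ n) ⟩
      ∑ arcPairs φ ^ n * ∑ arcPairs φ ^ triangular n
        ≈⟨ ^-homo-* (∑ arcPairs φ) n (triangular n) ⟨
      ∑ arcPairs φ ^ triangular (suc n) ∎

  module _ {A : Set} (xs : List A) (φ : A → Carrier) (_≟_ : DecidableEquality A)
           (pick : ∀ c → ∑ xs (λ x → φ x * 𝟙 (x ≟ c)) ≈ φ c) where
    open Rows xs φ

    -- `pick` is the case of a single entry and stands in for the statement that `xs` lists every
    -- element exactly once; it is checked for arc pairs and for Booleans.
    ∑-allVec-pick : ∀ {n} (v : Vec A n) →
      ∑ (allVec xs n) (λ r → rowWeight r * 𝟙 (Vec.≡-dec _≟_ r v)) ≈ rowWeight v
    ∑-allVec-pick []          = trans (+-identityʳ _) (*-identityˡ 1#)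
    ∑-allVec-pick {suc n} (c ∷ v) = begin
      ∑ (allVec xs (suc n)) (λ r → rowWeight r * 𝟙 (Vec.≡-dec _≟_ r (c ∷ v)))
        ≈⟨ ∑-cartesianProductWith _∷_ xs (allVec xs n) _ ⟩
      ∑ xs (λ x → ∑ (allVec xs n) λ r → φ x * rowWeight r * 𝟙 (Vec.≡-dec _≟_ (x ∷ r) (c ∷ v)))
        ≈⟨ ∑-cong xs (λ x → ∑-cong (allVec xs n) λ r → trans
             (*-congˡ (trans
               (𝟙-⇔ (Vec.≡-dec _≟_ (x ∷ r) (c ∷ v)) ((x ≟ c) ×-dec Vec.≡-dec _≟_ r v)
                    Vec.∷-injective (uncurry (≡.cong₂ _∷_)))
               (𝟙-× (x ≟ c) (Vec.≡-dec _≟_ r v))))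
             (interchange (φ x) (rowWeight r) _ _)) ⟩
      ∑ xs (λ x → ∑ (allVec xs n) λ r →
        φ x * 𝟙 (x ≟ c) * (rowWeight r * 𝟙 (Vec.≡-dec _≟_ r v)))
        ≈⟨ ∑-*-∑ xs (allVec xs n) _ _ ⟩
      ∑ xs (λ x → φ x * 𝟙 (x ≟ c)) * ∑ (allVec xs n) (λ r → rowWeight r * 𝟙 (Vec.≡-dec _≟_ r v))
        ≈⟨ *-cong (pick c) (∑-allVec-pick v) ⟩
      rowWeight (c ∷ v) ∎

  module _ {A : Set} (xs : List A) (φ : A → Carrier) where
    open Rows xs φ

    rowWeight-replicate : ∀ n c → rowWeight (replicate n c) ≈ φ c ^ n
    rowWeight-replicate zero    c = refl
    rowWeight-replicate (suc n) c = *-congˡ (rowWeight-replicate n c)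

  module _ (φ : Bool × Bool → Carrier) where
    open Rows arcPairs φ

    private
      hit : ∀ {x y z w : Carrier} → y ≈ 0# → z ≈ 0# → w ≈ 0# → (x * 1# + (y + (z + (w + 0#)))) ≈ x
      hit {x} {y} {z} {w} y0 z0 w0 = begin
        x * 1# + (y + (z + (w + 0#)))    ≈⟨ +-cong (*-identityʳ x) (+-cong y0 (+-cong z0 (+-congʳ w0))) ⟩
        x + (0# + (0# + (0# + 0#)))      ≈⟨ +-congˡ (trans (+-identityˡ _)
          (trans (+-identityˡ _) (+-identityˡ _))) ⟩
        x + 0#                           ≈⟨ +-identityʳ x ⟩
        x ∎

    pick-arcs : ∀ c → ∑ arcPairs (λ x → φ x * 𝟙 (x ≟ᵃ c)) ≈ φ c
    pick-arcs (false , false) = hit (zeroʳ _) (zeroʳ _) (zeroʳ _)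
    pick-arcs (false , true)  = trans (trans (+-congʳ (zeroʳ _)) (+-identityˡ _))
      (trans (+-congˡ (sym (+-identityˡ _))) (hit refl (zeroʳ _) (zeroʳ _)))
    pick-arcs (true , false)  = trans (trans (+-congʳ (zeroʳ _))
      (trans (+-identityˡ _) (trans (+-congʳ (zeroʳ _)) (+-identityˡ _))))
      (trans (+-congˡ (sym (trans (+-identityˡ _) (+-identityˡ _)))) (hit refl refl (zeroʳ _)))
    pick-arcs (true , true)   = trans (trans (+-congʳ (zeroʳ _)) (trans (+-identityˡ _)
      (trans (+-congʳ (zeroʳ _)) (trans (+-identityˡ _) (trans (+-congʳ (zeroʳ _)) (+-identityˡ _))))))
      (trans (+-identityʳ _) (*-identityʳ _))

    ∑-constantRow : ∀ n c →
      ∑ (allVec arcPairs n) (λ r → rowWeight r * 𝟙 (r ≟ᵛ replicate n c)) ≈ φ c ^ n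
    ∑-constantRow n c = trans (∑-allVec-pick arcPairs φ _≟ᵃ_ pick-arcs (replicate n c))
                              (rowWeight-replicate arcPairs φ n c)

    module _ (c : Bool × Bool) (φ-swap : φ (swap c) ≈ φ c) where

      -- The pairs inside S, those inside its complement and those across are chosen independently,
      -- and the cut fixes the last ones. The recursion removes vertex 0; when it lies outside S,
      -- its pairs with S are read from the other end, hence `swap c` and the hypothesis `φ-swap`.
      ∑-cut : ∀ {n} (S : Subset n) (F : Triangle (size S) → Carrier) →
        ∑ (triangles n) (λ t → weightΔ φ t * (𝟙 (cut? c S t) * F (restrict S t))) ≈
        ∑ (triangles (size S)) (λ t → weightΔ φ t * F t) * total φ (size (∁ S)) *
        φ c ^ (size S ℕ.* size (∁ S))
      ∑-cut [] F = begin
        1# * (1# * F tt) + 0#  ≈⟨ +-congʳ (*-congˡ (*-identityˡ _)) ⟩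
        1# * F tt + 0#         ≈⟨ *-identityʳ _ ⟨
        (1# * F tt + 0#) * 1#  ≈⟨ *-congˡ (+-identityʳ 1#) ⟨
        (1# * F tt + 0#) * (1# + 0#) ≈⟨ *-identityʳ _ ⟨
        (1# * F tt + 0#) * (1# + 0#) * 1# ∎
      ∑-cut {suc n} (true ∷ S) F = begin
        ∑ (triangles (suc n)) _
          ≈⟨ ∑-triangles φ n _ ⟩
        ∑ rows (λ r → ∑ (triangles n) λ t → rowWeight r * weightΔ φ t *
          (𝟙 ((select (∁ S) r ≟ᵛ replicate _ c) ×-dec cut? c S t) * F (select S r , restrict S t)))
          ≈⟨ ∑-cong rows (λ r → ∑-cong (triangles n) λ t → trans
               (*-congˡ (trans (*-congʳ (𝟙-× (select (∁ S) r ≟ᵛ replicate _ c) (cut? c S t)))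
                               (*-assoc _ _ _)))
               (interchange (rowWeight r) _ _ _)) ⟩
        ∑ rows (λ r → ∑ (triangles n) λ t → rowWeight r * E (select (∁ S) r) *
          (weightΔ φ t * (𝟙 (cut? c S t) * F (select S r , restrict S t))))
          ≈⟨ ∑-cong rows (λ r → *-∑ _ (triangles n) _) ⟨
        ∑ rows (λ r → rowWeight r * E (select (∁ S) r) *
          ∑ (triangles n) (λ t → weightΔ φ t * (𝟙 (cut? c S t) * F (select S r , restrict S t))))
          ≈⟨ ∑-cong rows (λ r → trans (*-congˡ (∑-cut S (λ t → F (select S r , t))))
               (trans (*-assoc _ _ _) (trans (*-congˡ (trans (*-congˡ (*-assoc _ _ _))
                 (trans (sym (*-assoc _ _ _))
                (trans (*-congʳ (*-comm _ _)) refl)))) (sym (*-assoc _ _ _))))) ⟩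
        ∑ rows (λ r → rowWeight r * (X (select S r) * E (select (∁ S) r)) * Y)
          ≈⟨ ∑-* Y rows _ ⟨
        ∑ rows (λ r → rowWeight r * (X (select S r) * E (select (∁ S) r))) * Y
          ≈⟨ *-congʳ (∑-rows S X E) ⟩
        ∑ (allVec arcPairs (size S)) (λ r → rowWeight r * X r) *
        ∑ (allVec arcPairs b) (λ r → rowWeight r * E r) * Y
          ≈⟨ *-congʳ (*-cong X≈ (∑-constantRow b c)) ⟩
        Z * φ c ^ b * (total φ b * φ c ^ (a ℕ.* b))
          ≈⟨ interchange Z (φ c ^ b) _ _ ⟩
        Z * total φ b * (φ c ^ b * φ c ^ (a ℕ.* b))
          ≈⟨ *-congˡ (^-homo-* (φ c) b (a ℕ.* b)) ⟨
        Z * total φ b * φ c ^ (suc a ℕ.* b) ∎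
        where
        rows = allVec arcPairs n
        a = size S
        b = size (∁ S)
        Y = total φ b * φ c ^ (a ℕ.* b)
        Z = ∑ (triangles (suc a)) (λ t → weightΔ φ t * F t)
        E : Vec (Bool × Bool) b → Carrier
        E r = 𝟙 (r ≟ᵛ replicate b c)
        X : Vec (Bool × Bool) a → Carrier
        X r = ∑ (triangles a) λ t → weightΔ φ t * F (r , t)
        X≈ : ∑ (allVec arcPairs a) (λ r → rowWeight r * X r) ≈ Z
        X≈ = begin
          ∑ (allVec arcPairs a) (λ r → rowWeight r * X r)
            ≈⟨ ∑-cong (allVec arcPairs a) (λ r → trans (*-∑ (rowWeight r) (triangles a) _)
                 (∑-cong (triangles a) λ t → sym (*-assoc (rowWeight r) _ _))) ⟩
          ∑ (allVec arcPairs a) (λ r → ∑ (triangles a) λ t → rowWeight r * weightΔ φ t * F (r , t))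
            ≈⟨ ∑-triangles φ a _ ⟨
          Z ∎
      ∑-cut {suc n} (false ∷ S) F = begin
        ∑ (triangles (suc n)) _
          ≈⟨ ∑-triangles φ n _ ⟩
        ∑ rows (λ r → ∑ (triangles n) λ t → rowWeight r * weightΔ φ t *
          (𝟙 ((select S r ≟ᵛ replicate _ (swap c)) ×-dec cut? c S t) * F (restrict S t)))
          ≈⟨ ∑-cong rows (λ r → ∑-cong (triangles n) λ t → trans
               (*-congˡ (trans (*-congʳ (𝟙-× (select S r ≟ᵛ replicate _ (swap c)) (cut? c S t)))
                               (*-assoc _ _ _)))
               (interchange (rowWeight r) _ _ _)) ⟩
        ∑ rows (λ r → ∑ (triangles n) λ t → rowWeight r * E (select S r) *
          (weightΔ φ t * (𝟙 (cut? c S t) * F (restrict S t))))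
          ≈⟨ ∑-*-∑ rows (triangles n) _ _ ⟩
        ∑ rows (λ r → rowWeight r * E (select S r)) *
        ∑ (triangles n) (λ t → weightΔ φ t * (𝟙 (cut? c S t) * F (restrict S t)))
          ≈⟨ *-cong (∑-cong rows λ r → *-congˡ (sym (*-identityʳ _))) (∑-cut S F) ⟩
        ∑ rows (λ r → rowWeight r * (E (select S r) * 1#)) * (Z * total φ b * φ c ^ (a ℕ.* b))
          ≈⟨ *-congʳ (∑-rows S E (λ _ → 1#)) ⟩
        ∑ (allVec arcPairs a) (λ r → rowWeight r * E r) *
        ∑ (allVec arcPairs b) (λ r → rowWeight r * 1#) * (Z * total φ b * φ c ^ (a ℕ.* b))
          ≈⟨ *-congʳ (*-cong (trans (∑-constantRow a (swap c)) (^-congˡ a φ-swap))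
               (∑-cong (allVec arcPairs b) λ r → *-identityʳ _)) ⟩
        φ c ^ a * R * (Z * total φ b * φ c ^ (a ℕ.* b))
          ≈⟨ *-congˡ (*-comm _ _) ⟩
        φ c ^ a * R * (φ c ^ (a ℕ.* b) * (Z * total φ b))
          ≈⟨ interchange _ _ _ _ ⟩
        φ c ^ a * φ c ^ (a ℕ.* b) * (R * (Z * total φ b))
          ≈⟨ *-cong (sym (^-homo-* (φ c) a (a ℕ.* b))) (x∙yz≈y∙xz R Z _) ⟩
        φ c ^ (a ℕ.+ a ℕ.* b) * (Z * (R * total φ b))
          ≈⟨ *-comm _ _ ⟩
        Z * (R * total φ b) * φ c ^ (a ℕ.+ a ℕ.* b)
          ≈⟨ *-cong (*-congˡ total-suc) (reflexive (≡.cong (φ c ^_) (≡.sym (ℕ.*-suc a b)))) ⟩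
        Z * total φ (suc b) * φ c ^ (a ℕ.* suc b) ∎
        where
        rows = allVec arcPairs n
        a = size S
        b = size (∁ S)
        Z = ∑ (triangles a) (λ t → weightΔ φ t * F t)
        R = ∑ (allVec arcPairs b) rowWeight
        E : Vec (Bool × Bool) a → Carrier
        E r = 𝟙 (r ≟ᵛ replicate a (swap c))
        total-suc : R * total φ b ≈ total φ (suc b)
        total-suc = trans (sym (∑-*-∑ (allVec arcPairs b) (triangles b) rowWeight (weightΔ φ)))
                          (sym (∑-triangles φ b _))

  -- From Boolean matrices to triangles

  ∑-allVec-∷ : ∀ {A : Set} {m} (xs : List A) (ys : List (Vec A m)) n
    (F : Vec (Vec A (suc m)) n → Carrier) →
    ∑ (allVec (cartesianProductWith _∷_ xs ys) n) F ≈
    ∑ (allVec xs n) (λ c → ∑ (allVec ys n) (λ M → F (zipWith _∷_ c M)))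
  ∑-allVec-∷ xs ys zero    F = sym (+-identityʳ _)
  ∑-allVec-∷ xs ys (suc n) F = begin
    ∑ (allVec zs (suc n)) F
      ≈⟨ ∑-cartesianProductWith _∷_ zs (allVec zs n) F ⟩
    ∑ zs (λ z → ∑ (allVec zs n) λ M → F (z ∷ M))
      ≈⟨ ∑-cartesianProductWith _∷_ xs ys _ ⟩
    ∑ xs (λ x → ∑ ys λ y → ∑ (allVec zs n) λ M → F ((x ∷ y) ∷ M))
      ≈⟨ ∑-cong xs (λ x → ∑-cong ys λ y → ∑-allVec-∷ xs ys n _) ⟩
    ∑ xs (λ x → ∑ ys λ y → ∑ (allVec xs n) λ c → ∑ (allVec ys n) λ M → F ((x ∷ y) ∷ zipWith _∷_ c M))
      ≈⟨ ∑-cong xs (λ x → ∑-comm ys (allVec xs n) _) ⟩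
    ∑ xs (λ x → ∑ (allVec xs n) λ c → ∑ ys λ y → ∑ (allVec ys n) λ M → F ((x ∷ y) ∷ zipWith _∷_ c M))
      ≈⟨ ∑-cong xs (λ x → ∑-cong (allVec xs n) λ c →
           ∑-cartesianProductWith _∷_ ys (allVec ys n) (λ M → F (zipWith _∷_ (x ∷ c) M))) ⟨
    ∑ xs (λ x → ∑ (allVec xs n) λ c → ∑ (allVec ys (suc n)) λ M → F (zipWith _∷_ (x ∷ c) M))
      ≈⟨ ∑-cartesianProductWith _∷_ xs (allVec xs n) _ ⟨
    ∑ (allVec xs (suc n)) (λ c → ∑ (allVec ys (suc n)) λ M → F (zipWith _∷_ c M)) ∎
    where zs = cartesianProductWith _∷_ xs ys

  ∑-allVec-, : ∀ {A B : Set} (xs : List A) (ys : List B) n (F : Vec A n → Vec B n → Carrier) →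
    ∑ (allVec xs n) (λ u → ∑ (allVec ys n) (λ v → F u v)) ≈
    ∑ (allVec (cartesianProduct xs ys) n) (λ r → F (Vec.map proj₁ r) (Vec.map proj₂ r))
  ∑-allVec-, xs ys zero    F = +-identityʳ _
  ∑-allVec-, xs ys (suc n) F = begin
    ∑ (allVec xs (suc n)) (λ u → ∑ (allVec ys (suc n)) (λ v → F u v))
      ≈⟨ ∑-cartesianProductWith _∷_ xs (allVec xs n) _ ⟩
    ∑ xs (λ x → ∑ (allVec xs n) λ u → ∑ (allVec ys (suc n)) (λ v → F (x ∷ u) v))
      ≈⟨ ∑-cong xs (λ x → ∑-cong (allVec xs n) λ u → ∑-cartesianProductWith _∷_ ys (allVec ys n) _) ⟩
    ∑ xs (λ x → ∑ (allVec xs n) λ u → ∑ ys λ y → ∑ (allVec ys n) (λ v → F (x ∷ u) (y ∷ v)))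
      ≈⟨ ∑-cong xs (λ x → ∑-comm (allVec xs n) ys _) ⟩
    ∑ xs (λ x → ∑ ys λ y → ∑ (allVec xs n) λ u → ∑ (allVec ys n) (λ v → F (x ∷ u) (y ∷ v)))
      ≈⟨ ∑-cong xs (λ x → ∑-cong ys λ y → ∑-allVec-, xs ys n (λ u v → F (x ∷ u) (y ∷ v))) ⟩
    ∑ xs (λ x → ∑ ys λ y → ∑ (allVec (cartesianProduct xs ys) n) λ r → G ((x , y) ∷ r))
      ≈⟨ ∑-cartesianProductWith _,_ xs ys _ ⟨
    ∑ (cartesianProduct xs ys) (λ z → ∑ (allVec (cartesianProduct xs ys) n) λ r → G (z ∷ r))
      ≈⟨ ∑-cartesianProductWith _∷_ (cartesianProduct xs ys) (allVec (cartesianProduct xs ys) n) G ⟨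
    ∑ (allVec (cartesianProduct xs ys) (suc n)) G ∎
    where
    G : Vec _ (suc n) → Carrier
    G r = F (Vec.map proj₁ r) (Vec.map proj₂ r)

  -- Once the first row is split off, `∑-allVec-∷` separates the first column from the minor, and
  -- `∑-allVec-,` zips that row and column into the arc pairs stored by `Triangle`. Matrices with a
  -- nonzero diagonal entry contribute 0.
  ∑-allDigraphs : ∀ n (F : Digraph n → Carrier) → (∀ A i → Arc A i i → F A ≈ 0#) →
    ∑ (allDigraphs n) F ≈ ∑ (triangles n) (F ∘ toDigraph)
  ∑-allDigraphs zero    F loop≈0 = refl
  ∑-allDigraphs (suc n) F loop≈0 = begin
    ∑ (allDigraphs (suc n)) F
      ≈⟨ ∑-cartesianProductWith _∷_ (allVec booleans (suc n)) (allVec (allVec booleans (suc n)) n) F ⟩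
    ∑ (allVec booleans (suc n)) (λ v → ∑ (allVec (allVec booleans (suc n)) n) λ M → F (v ∷ M))
      ≈⟨ ∑-cartesianProductWith _∷_ booleans (allVec booleans n) _ ⟩
    H false + (H true + 0#)
      ≈⟨ +-congˡ (trans (+-identityʳ _) (H-true)) ⟩
    H false + 0#
      ≈⟨ +-identityʳ _ ⟩
    H false
      ≈⟨ ∑-cong (allVec booleans n) (λ r → ∑-allVec-∷ booleans (allVec booleans n) n _) ⟩
    ∑ (allVec booleans n) (λ r → ∑ (allVec booleans n) λ c → ∑ (allDigraphs n) λ M → F
      ((false ∷ r) ∷ zipWith _∷_ c M))
      ≈⟨ ∑-cong (allVec booleans n) (λ r → ∑-cong (allVec booleans n) λ c →
           ∑-allDigraphs n (λ M → F ((false ∷ r) ∷ zipWith _∷_ c M)) λ M i a →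
             loop≈0 _ (suc i) (≡.subst T (≡.sym (≡.cong (λ v → lookup v (suc i))
               (Vec.lookup-zipWith _∷_ i c M))) a)) ⟩
    ∑ (allVec booleans n) (λ r → ∑ (allVec booleans n) λ c → ∑ (triangles n) λ t → F
      ((false ∷ r) ∷ zipWith _∷_ c (toDigraph t)))
      ≈⟨ ∑-allVec-, booleans booleans n _ ⟩
    ∑ (allVec arcPairs n) (λ r → ∑ (triangles n) λ t → F (toDigraph (r , t)))
      ≈⟨ ∑-cartesianProductWith _,_ (allVec arcPairs n) (triangles n) (F ∘ toDigraph) ⟨
    ∑ (triangles (suc n)) (F ∘ toDigraph) ∎
    where
    H : Bool → Carrier
    H b = ∑ (allVec booleans n) λ r → ∑ (allVec (allVec booleans (suc n)) n) λ M → F ((b ∷ r) ∷ M)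
    H-true : H true ≈ 0#
    H-true = trans (∑-cong (allVec booleans n) λ r →
      trans (∑-cong (allVec (allVec booleans (suc n)) n) λ M → loop≈0 ((true ∷ r) ∷ M) zero tt)
            (∑-0 (allVec (allVec booleans (suc n)) n))) (∑-0 (allVec booleans n))

  -- Graphs and tournaments with ties as supports of weights

  module _ (φ : Bool × Bool → Carrier) where
    open Rows arcPairs φ

    ∏-lookup : ∀ {n} (r : Vec (Bool × Bool) n) → ∏ (allFin n) (φ ∘ lookup r) ≈ rowWeight r
    ∏-lookup {zero}  []      = refl
    ∏-lookup {suc n} (x ∷ r) =
      trans (reflexive (∏-allFin n (φ ∘ lookup (x ∷ r)))) (*-congˡ (∏-lookup r))

    ∏-pairs-arcs : ∀ {n} (t : Triangle n) →
      ∏ (pairs n) (λ (i , j) → φ (arcs t i j)) ≈ weightΔ φ t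
    ∏-pairs-arcs {zero}  _       = refl
    ∏-pairs-arcs {suc n} (r , t) = trans (∏-pairs n _) (*-cong
      (trans (∏-cong (allFin n) λ j → reflexive (≡.cong φ (arcs-0-suc r t j))) (∏-lookup r))
      (trans (∏-cong (pairs n) λ (i , j) → reflexive (≡.cong φ
               (≡.cong₂ _,_ (adj-suc-suc r t i j) (adj-suc-suc r t j i))))
             (∏-pairs-arcs t)))

    module _ {Q : Pred (Bool × Bool) 0ℓ} (Q? : Decidable Q) (Q-swap : ∀ {x} → Q x → Q (swap x))
             (¬Q⇒0 : ∀ x → ¬ Q x → φ x ≈ 0#) where

      allRow⊎0 : ∀ {n} (r : Vec (Bool × Bool) n) → (∀ i → Q (lookup r i)) ⊎ rowWeight r ≈ 0#
      allRow⊎0 [] = inj₁ λ ()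
      allRow⊎0 (x ∷ r) with Q? x | allRow⊎0 r
      ... | no ¬Qx | _        = inj₂ (trans (*-congʳ (¬Q⇒0 x ¬Qx)) (zeroˡ _))
      ... | yes _  | inj₂ r≈0 = inj₂ (trans (*-congˡ r≈0) (zeroʳ _))
      ... | yes Qx | inj₁ Qr  = inj₁ λ { zero → Qx ; (suc i) → Qr i }

      -- A single pair outside Q makes the product vanish, so a triangle either satisfies Q
      -- throughout or can be discarded from a weighted sum; `Q-swap` is for pairs read in the
      -- opposite order.
      allArcs⊎0 : ∀ {n} (t : Triangle n) → (∀ i j → i ≢ j → Q (arcs t i j)) ⊎ weightΔ φ t ≈ 0#
      allArcs⊎0 {zero}  _       = inj₁ λ ()
      allArcs⊎0 {suc n} (r , t) with allRow⊎0 r | allArcs⊎0 t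
      ... | inj₂ r≈0 | _        = inj₂ (trans (*-congʳ r≈0) (zeroˡ _))
      ... | inj₁ _   | inj₂ t≈0 = inj₂ (trans (*-congˡ t≈0) (zeroʳ _))
      ... | inj₁ Qr  | inj₁ Qt  = inj₁ λ where
        zero    zero    i≢j → contradiction ≡.refl i≢j
        zero    (suc j) _   → ≡.subst Q (≡.sym (arcs-0-suc r t j)) (Qr j)
        (suc i) zero    _   → Q-swap (≡.subst Q (≡.sym (arcs-0-suc r t i)) (Qr i))
        (suc i) (suc j) i≢j → ≡.subst Q
          (≡.sym (≡.cong₂ _,_ (adj-suc-suc r t i j) (adj-suc-suc r t j i)))
          (Qt i j (i≢j ∘ ≡.cong suc))

  ^-length-filter : ∀ {A : Set} {P : Pred A 0ℓ} (P? : Decidable P) x (ys : List A) →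
    x ^ length (filter P? ys) ≈ ∏ ys (λ y → if does (P? y) then x else 1#)
  ^-length-filter P? x []       = refl
  ^-length-filter P? x (y ∷ ys) with does (P? y)
  ... | true  = *-congˡ (^-length-filter P? x ys)
  ... | false = trans (^-length-filter P? x ys) (sym (*-identityˡ _))

  -- The value 0 on forbidden pairs builds the class of digraphs into the weight: sums over all
  -- triangles become sums over simple graphs here, and over tournaments with ties for
  -- `tournamentWeight`.
  graphWeight : Carrier → Carrier → Bool × Bool → Carrier
  graphWeight p q (true  , true)  = p
  graphWeight p q (false , false) = q
  graphWeight p q (true  , false) = 0#
  graphWeight p q (false , true)  = 0#

  tournamentWeight : Carrier → Bool × Bool → Carrier
  tournamentWeight x (true  , true)  = x
  tournamentWeight x (false , false) = 0#
  tournamentWeight x (true  , false) = 1#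
  tournamentWeight x (false , true)  = 1#

  IsEdge : Bool × Bool → Set
  IsEdge (a , b) = a ≡ b

  IsJoined : Bool × Bool → Set
  IsJoined (a , b) = T a ⊎ T b

  graphs⊎0 : ∀ p q {n} (t : Triangle n) →
    (∀ i j → i ≢ j → IsEdge (arcs t i j)) ⊎ weightΔ (graphWeight p q) t ≈ 0#
  graphs⊎0 p q = allArcs⊎0 (graphWeight p q) (uncurry Bool._≟_) ≡.sym λ where
    (false , false) a≢b → contradiction ≡.refl a≢b
    (false , true)  _   → refl
    (true  , false) _   → refl
    (true  , true)  a≢b → contradiction ≡.refl a≢b

  tournaments⊎0 : ∀ x {n} (t : Triangle n) →
    (∀ i j → i ≢ j → IsJoined (arcs t i j)) ⊎ weightΔ (tournamentWeight x) t ≈ 0#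
  tournaments⊎0 x = allArcs⊎0 (tournamentWeight x) (λ (a , b) → T? a ⊎-dec T? b)
    (λ { (inj₁ a) → inj₂ a ; (inj₂ b) → inj₁ b }) λ where
    (false , false) _  → refl
    (false , true)  ¬Q → contradiction (inj₂ tt) ¬Q
    (true  , _)     ¬Q → contradiction (inj₁ tt) ¬Q

  𝟙-* : ∀ {P : Set} (P? : Dec P) {x y} → (P → x ≈ y) → (¬ P → y ≈ 0#) → 𝟙 P? * x ≈ y
  𝟙-* (yes p) x≈y y≈0 = trans (*-identityˡ _) (x≈y p)
  𝟙-* (no ¬p) x≈y y≈0 = trans (zeroˡ _) (sym (y≈0 ¬p))

  𝟙-graph : ∀ p q {n} (t : Triangle n) →
    𝟙 (isSimpleGraph? (toDigraph t)) *
    ∏ (pairs n) (λ (i , j) → if adj (toDigraph t) i j then p else q) ≈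
    weightΔ (graphWeight p q) t
  𝟙-graph p q {n} t = 𝟙-* (isSimpleGraph? A)
    (λ (_ , arc-sym) → trans
      (∏-cong (pairs n) λ (i , j) → edge (adj A i j) (adj A j i) (arc-sym i j) (arc-sym j i))
      (∏-pairs-arcs (graphWeight p q) t))
    (λ ¬simple → Sum.[ (λ edges → contradiction (loopless t , arc-sym edges) ¬simple) , (λ w≈0 → w≈0) ]′
      (graphs⊎0 p q t))
    where
    A = toDigraph t
    arc-sym : (∀ i j → i ≢ j → IsEdge (arcs t i j)) → ∀ i j → Arc A i j → Arc A j i
    arc-sym edges i j a with i Fin.≟ j
    ... | yes ≡.refl = a
    ... | no i≢j     = ≡.subst T (edges i j i≢j) a
    edge : ∀ a b → (T a → T b) → (T b → T a) → (if a then p else q) ≈ graphWeight p q (a , b)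
    edge false false _ _ = refl
    edge true  true  _ _ = refl
    edge true  false f _ with () ← f tt
    edge false true  _ g with () ← g tt

  𝟙-tournament : ∀ x {n} (t : Triangle n) →
    𝟙 (isTournamentWithTies? (toDigraph t)) * x ^ ties (toDigraph t) ≈
    weightΔ (tournamentWeight x) t
  𝟙-tournament x {n} t = 𝟙-* (isTournamentWithTies? A) (λ (_ , join) → ties≈ join)
    (λ ¬tour → Sum.[ (λ join → contradiction (loopless t , join) ¬tour) , (λ w≈0 → w≈0) ]′
      (tournaments⊎0 x t))
    where
    A = toDigraph t
    tie : ∀ a b → T a ⊎ T b → (if does (T? a ×-dec T? b) then x else 1#) ≈ tournamentWeight x (a , b)
    tie true  true  _ = refl
    tie true  false _ = refl
    tie false true  _ = refl
    tie false false (inj₁ ())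
    tie false false (inj₂ ())
    module _ (join : ∀ i j → i ≢ j → IsJoined (arcs t i j)) where
      joined : ∀ i j (i<j? : Dec (i Fin.< j)) →
        (if does i<j? then (if does (Arc? A i j ×-dec Arc? A j i) then x else 1#) else 1#) ≈
        (if does i<j? then tournamentWeight x (arcs t i j) else 1#)
      joined i j (no _)    = refl
      joined i j (yes i<j) = tie (adj A i j) (adj A j i) (join i j (Fin.<⇒≢ i<j))

      ties≈ : x ^ ties A ≈ weightΔ (tournamentWeight x) t
      ties≈ = begin
        x ^ ties A
          ≈⟨ ^-length-filter (λ (i , j) → Arc? A i j ×-dec Arc? A j i) x (pairs n) ⟩
        ∏ (pairs n) (λ (i , j) → if does (Arc? A i j ×-dec Arc? A j i) then x else 1#)
          ≈⟨ ∏-pairs≈ n _ ⟩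
        ∏ (allFin n) (λ i → ∏ (allFin n) λ j →
          if does (i Fin.<? j) then (if does (Arc? A i j ×-dec Arc? A j i) then x else 1#) else 1#)
          ≈⟨ ∏-cong (allFin n) (λ i → ∏-cong (allFin n) λ j → joined i j (i Fin.<? j)) ⟩
        ∏ (allFin n) (λ i → ∏ (allFin n) λ j →
          if does (i Fin.<? j) then tournamentWeight x (arcs t i j) else 1#)
          ≈⟨ ∏-pairs≈ n _ ⟨
        ∏ (pairs n) (λ (i , j) → tournamentWeight x (arcs t i j))
          ≈⟨ ∏-pairs-arcs (tournamentWeight x) t ⟩
        weightΔ (tournamentWeight x) t ∎

  ∑-filter-strong : ∀ n {P : Pred (Digraph n) 0ℓ} (P? : Decidable P) (f : Digraph n → Carrier) φ →
    (∀ A → P A → ∀ i → ¬ Arc A i i) →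
    (∀ t → 𝟙 (P? (toDigraph t)) * f (toDigraph t) ≈ weightΔ φ t) →
    ∑ (filter stronglyConnected? (filter P? (allDigraphs n))) f ≈ strongTotal φ n
  ∑-filter-strong n P? f φ P⇒loopless 𝟙f≈φ = begin
    ∑ (filter stronglyConnected? (filter P? (allDigraphs n))) f
      ≈⟨ ∑-filter-𝟙 stronglyConnected? (filter P? (allDigraphs n)) f ⟩
    ∑ (filter P? (allDigraphs n)) (λ A → 𝟙 (stronglyConnected? A) * f A)
      ≈⟨ ∑-filter-𝟙 P? (allDigraphs n) _ ⟩
    ∑ (allDigraphs n) (λ A → 𝟙 (P? A) * (𝟙 (stronglyConnected? A) * f A))
      ≈⟨ ∑-allDigraphs n _ (λ A i a → trans
           (*-congʳ (𝟙-no (P? A) λ PA → P⇒loopless A PA i a)) (zeroˡ _)) ⟩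
    ∑ (triangles n) (λ t → 𝟙 (P? (toDigraph t)) * (𝟙 (stronglyConnected? (toDigraph t)) * f (toDigraph t)))
      ≈⟨ ∑-cong (triangles n) (λ t → trans (*-congˡ (*-comm _ _))
           (trans (sym (*-assoc _ _ _)) (*-congʳ (𝟙f≈φ t)))) ⟩
    strongTotal φ n ∎

  connectedGraphs : ∀ p q n →
    ∑ (filter connected? (graphs n)) (λ A → ∏ (pairs n) (λ (i , j) → if adj A i j then p else q)) ≈
    strongTotal (graphWeight p q) n
  connectedGraphs p q n =
    ∑-filter-strong n isSimpleGraph? _ (graphWeight p q) (λ _ → proj₁) (𝟙-graph p q)

  irreducibleTournaments≈ : ∀ x n →
    ∑ (irreducibleTournaments n) (λ A → x ^ ties A) ≈ strongTotal (tournamentWeight x) n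
  irreducibleTournaments≈ x n =
    ∑-filter-strong n isTournamentWithTies? _ (tournamentWeight x) (λ _ → proj₁) (𝟙-tournament x)

  -- Counting by a unique cut set

  ∑-unique : ∀ n {Q : Pred (Subset n) 0ℓ} (Q? : Decidable Q) S → Q S → (∀ {S′} → Q S′ → S′ ≡ S) →
    ∑ (subsets n) (λ S′ → 𝟙 (Q? S′)) ≈ 1#
  ∑-unique n {Q} Q? S QS unique = begin
    ∑ (subsets n) (λ S′ → 𝟙 (Q? S′))
      ≈⟨ ∑-cong (subsets n) (λ S′ → trans
           (𝟙-⇔ (Q? S′) (Vec.≡-dec Bool._≟_ S′ S) unique (λ { ≡.refl → QS }))
           (trans (sym (*-identityˡ _)) (*-congʳ (sym (rowWeight-1 S′))))) ⟩
    ∑ (subsets n) (λ S′ → Rows.rowWeight booleans (λ _ → 1#) S′ * 𝟙 (Vec.≡-dec Bool._≟_ S′ S))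
      ≈⟨ ∑-allVec-pick booleans (λ _ → 1#) Bool._≟_ pick S ⟩
    Rows.rowWeight booleans (λ _ → 1#) S
      ≈⟨ rowWeight-1 S ⟩
    1# ∎
    where
    rowWeight-1 : ∀ {m} (v : Vec Bool m) → Rows.rowWeight booleans (λ _ → 1#) v ≈ 1#
    rowWeight-1 []      = refl
    rowWeight-1 (b ∷ v) = trans (*-identityˡ _) (rowWeight-1 v)
    pick : ∀ c → ∑ booleans (λ x → 1# * 𝟙 (x Bool.≟ c)) ≈ 1#
    pick false = trans (+-cong (*-identityʳ _) (trans (+-identityʳ _) (zeroʳ _))) (+-identityʳ _)
    pick true  = trans (+-cong (zeroʳ _) (trans (+-identityʳ _) (*-identityʳ _))) (+-identityˡ _)

  -- The crossing pairs contribute a power of `φ c`; normalising `φ c` to 1 is what leaves a bare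
  -- product of the two sides.
  ∑-strong-cut : ∀ φ c → φ (swap c) ≈ φ c → φ c ≈ 1# → ∀ {n} (S : Subset n) →
    ∑ (triangles n) (λ t → weightΔ φ t * (𝟙 (cut? c S t) * 𝟙
      (stronglyConnected? (toDigraph (restrict S t))))) ≈
    strongTotal φ (size S) * total φ (size (∁ S))
  ∑-strong-cut φ c φ-swap φc≈1 S =
    trans (∑-cut φ c φ-swap S (λ t → 𝟙 (stronglyConnected? (toDigraph t))))
          (trans (*-congˡ (1^ (size S ℕ.* size (∁ S)))) (*-identityʳ _))
    where
    1^ : ∀ k → φ c ^ k ≈ 1#
    1^ zero    = refl
    1^ (suc k) = trans (*-cong φc≈1 (1^ k)) (*-identityˡ 1#)

  ∑-graph-cut : ∀ φ c → φ (swap c) ≈ φ c → φ c ≈ 1# → ∀ {n} (S : Subset n) →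
    ∑ (triangles n) (λ t → weightΔ φ t * 𝟙 (cut? c S t)) ≈ total φ (size S) * total φ (size (∁ S))
  ∑-graph-cut φ c φ-swap φc≈1 {n} S =
    trans (∑-cong (triangles n) λ t → *-congˡ (sym (*-identityʳ _)))
    (trans (∑-cut φ c φ-swap S (λ _ → 1#))
    (trans (*-cong (*-congʳ (∑-cong (triangles (size S)) λ t → *-identityʳ _)) (1^ (size S ℕ.* size (∁ S))))
           (*-identityʳ _)))
    where
    1^ : ∀ k → φ c ^ k ≈ 1#
    1^ zero    = refl
    1^ (suc k) = trans (*-cong φc≈1 (1^ k)) (*-identityˡ 1#)

  -- A nonempty strong cut set exists by descent from the full vertex set, and it is unique because
  -- any two nonempty cut sets of a tournament meet. Inserting this count, which is 1, and
  -- exchanging the sums leaves one factored sum for each vertex set.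
  tournament-recurrence : ∀ x n → let φ = tournamentWeight x in
    total φ (suc n) ≈ ∑ (subsets (suc n)) (λ S →
      𝟙 (Subset.nonempty? S) * (strongTotal φ (size S) * total φ (size (∁ S))))
  tournament-recurrence x n = begin
    total φ (suc n)
      ≈⟨ ∑-cong (triangles (suc n)) count ⟩
    ∑ (triangles (suc n)) (λ t → weightΔ φ t * ∑ (subsets (suc n)) λ S → 𝟙 (initial? t S))
      ≈⟨ ∑-cong (triangles (suc n)) (λ t → *-∑ _ (subsets (suc n)) _) ⟩
    ∑ (triangles (suc n)) (λ t → ∑ (subsets (suc n)) λ S → weightΔ φ t * 𝟙 (initial? t S))
      ≈⟨ ∑-comm (triangles (suc n)) (subsets (suc n)) _ ⟩
    ∑ (subsets (suc n)) (λ S → ∑ (triangles (suc n)) λ t → weightΔ φ t * 𝟙 (initial? t S))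
      ≈⟨ ∑-cong (subsets (suc n)) (λ S → trans
           (∑-cong (triangles (suc n)) λ t → trans
             (*-congˡ (trans (𝟙-× (Subset.nonempty? S) (cut? c S t ×-dec strong? t S))
                             (*-congˡ (𝟙-× (cut? c S t) (strong? t S)))))
             (x∙yz≈y∙xz _ _ _))
           (trans (sym (*-∑ _ (triangles (suc n)) _)) (*-congˡ (∑-strong-cut φ c refl refl S)))) ⟩
    ∑ (subsets (suc n)) (λ S → 𝟙 (Subset.nonempty? S) * (strongTotal φ (size S) * total φ (size (∁ S)))) ∎
    where
    φ = tournamentWeight x
    c = true , false
    Initial : Triangle (suc n) → Subset (suc n) → Set
    Initial t S = Nonempty S × Cut c S t × Strong t S
    strong? : ∀ t S → Dec (Strong t S)
    strong? t S = stronglyConnected? (toDigraph (restrict S t))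
    initial? : ∀ t S → Dec (Initial t S)
    initial? t S = Subset.nonempty? S ×-dec (cut? c S t ×-dec strong? t S)
    count : ∀ t → weightΔ φ t ≈ weightΔ φ t * ∑ (subsets (suc n)) (λ S → 𝟙 (initial? t S))
    count t with tournaments⊎0 x t
    ... | inj₂ w≈0 = trans w≈0 (sym (trans (*-congʳ w≈0)
      (zeroˡ (∑ (subsets (suc n)) λ S → 𝟙 (initial? t S)))))
    ... | inj₁ join with strong-exists t c forced (⊂-wellFounded Subset.⊤) (zero , Subset.∈⊤) (fullCut t c)
      where
      forced : ∀ {i j} → i ≢ j → ¬ Arc (toDigraph t) j i → arcs t i j ≡ c
      forced {i} {j} i≢j ¬arc with adj (toDigraph t) i j | adj (toDigraph t) j i | join i j i≢j
      ... | true  | false | _ = ≡.refl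
      ... | false | false | inj₁ ()
      ... | false | false | inj₂ ()
      ... | _     | true  | _ = contradiction tt ¬arc
    ... | S , ne , cut , strong = sym (trans (*-congˡ (∑-unique (suc n) (initial? t) S
      (ne , CutBy⇒Cut c S t cut , strong) unique)) (*-identityʳ _))
      where
      unique : ∀ {S′} → Initial t S′ → S′ ≡ S
      unique {S′} (ne′ , cut′ , strong′) with tournament-strong-meet t (Cut⇒CutBy c S′ t cut′) cut ne′ ne
      ... | z , z∈S′ , z∈S = strong-unique t (Cut⇒CutBy c S′ t cut′) cut strong′ strong z∈S′ z∈S

  module _ {φ ψ : Bool × Bool → Carrier} (a : Carrier) (φ≈aψ : ∀ x → φ x ≈ a * ψ x) where

    rowWeight-scale : ∀ {n} (r : Vec (Bool × Bool) n) →
      Rows.rowWeight arcPairs φ r ≈ a ^ n * Rows.rowWeight arcPairs ψ r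
    rowWeight-scale []      = sym (*-identityˡ 1#)
    rowWeight-scale (x ∷ r) = trans (*-cong (φ≈aψ x) (rowWeight-scale r)) (interchange a _ _ _)

    weightΔ-scale : ∀ {n} (t : Triangle n) → weightΔ φ t ≈ a ^ triangular n * weightΔ ψ t
    weightΔ-scale {zero}  _       = sym (*-identityˡ 1#)
    weightΔ-scale {suc n} (r , t) = trans (*-cong (rowWeight-scale r) (weightΔ-scale t))
      (trans (interchange _ _ _ _) (*-congʳ (sym (^-homo-* a n (triangular n)))))

    -- Each of the `triangular n` pairs contributes one factor a. This is the passage between the
    -- edge weights p, q and ρ, 1.
    strongTotal-scale : ∀ n → strongTotal φ n ≈ a ^ triangular n * strongTotal ψ n
    strongTotal-scale n = trans
      (∑-cong (triangles n) λ t → trans (*-congʳ (weightΔ-scale t)) (*-assoc _ _ _))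
      (sym (*-∑ (a ^ triangular n) (triangles n) _))

-- Sums over subsets as binomial sums

module Binomial (S : CommutativeSemiring 0ℓ 0ℓ) (ι : ℕ → CommutativeSemiring.Carrier S)
  (ι-0 : CommutativeSemiring._≈_ S (ι 0) (CommutativeSemiring.0# S))
  (ι-1 : CommutativeSemiring._≈_ S (ι 1) (CommutativeSemiring.1# S))
  (ι-+ : ∀ m n → CommutativeSemiring._≈_ S (ι (m ℕ.+ n)) (CommutativeSemiring._+_ S (ι m) (ι n))) where
  open Weighted S
  open CommutativeSemiring S hiding (zero)
  open Relation.Binary.Reasoning.Setoid setoid

  ∑-subsets : ∀ n {f} → ∑ (subsets (suc n)) f ≈
    ∑ (subsets n) (λ S → f (false ∷ S)) + ∑ (subsets n) (λ S → f (true ∷ S))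
  ∑-subsets n = trans (∑-cartesianProductWith _∷_ booleans (subsets n) _) (+-congˡ (+-identityʳ _))

  ∑-subsets-∁ : ∀ n (F : ℕ → ℕ → Carrier) →
    ∑ (subsets n) (λ S → F (size S) (size (∁ S))) ≈ ∑ (subsets n) (λ S → F (size (∁ S)) (size S))
  ∑-subsets-∁ zero    F = refl
  ∑-subsets-∁ (suc n) F = trans (∑-subsets n) (trans (+-comm _ _) (trans
    (+-cong (∑-subsets-∁ n (λ a b → F (suc a) b)) (∑-subsets-∁ n (λ a b → F a (suc b))))
    (sym (∑-subsets n))))

  -- Pascal's rule: the subsets without and with vertex 0 give its two summands. The index is the
  -- size of the complement because the expansion counts the vertices outside the large component.
  ∑-subsets-size : ∀ n (F : ℕ → ℕ → Carrier) →
    ∑ (subsets n) (λ S → F (size (∁ S)) (size S)) ≈ ∑ (upTo (suc n)) (λ j → ι (n C j) * F j (n ℕ.∸ j))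
  ∑-subsets-size zero    F = +-congʳ (trans (sym (*-identityˡ _)) (*-congʳ (sym ι-1)))
  ∑-subsets-size (suc n) F = begin
    ∑ (subsets (suc n)) (λ S → F (size (∁ S)) (size S))
      ≈⟨ ∑-subsets n ⟩
    ∑ (subsets n) (λ S → F (suc (size (∁ S))) (size S)) + ∑ (subsets n)
      (λ S → F (size (∁ S)) (suc (size S)))
      ≈⟨ +-cong (∑-subsets-size n (λ a b → F (suc a) b)) (∑-subsets-size n (λ a b → F a (suc b))) ⟩
    X + ∑ (upTo (suc n)) (λ j → ι (n C j) * F j (suc (n ℕ.∸ j)))
      ≈⟨ +-congˡ (reflexive (∑-upTo-suc n _)) ⟩
    X + (ι (n C 0) * F 0 (suc n) + ∑ (upTo n) (λ j → ι (n C suc j) * F (suc j) (suc (n ℕ.∸ suc j))))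
      ≈⟨ +-congˡ (+-cong (*-congʳ (reflexive (≡.cong ι (≡.trans (nC0≡1 n) (≡.sym (nC0≡1 (suc n)))))))
           (∑-cong-< n λ j j<n → *-congˡ (reflexive (≡.cong (F (suc j)) (≡.sym (ℕ.+-∸-assoc 1 j<n)))))) ⟩
    X + (first + ∑ (upTo n) (λ j → ι (n C suc j) * F (suc j) (n ℕ.∸ j)))
      ≈⟨ +-congˡ (+-congˡ (trans (sym (+-identityʳ _)) (+-congˡ (sym
           (trans (*-congʳ (trans (reflexive (≡.cong ι (k>n⇒nCk≡0 (ℕ.n<1+n n)))) ι-0)) (zeroˡ _)))))) ⟩
    X + (first + (∑ (upTo n) (λ j → ι (n C suc j) * F (suc j) (n ℕ.∸ j)) + ι (n C suc n) * F (suc n)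
      (n ℕ.∸ n)))
      ≈⟨ +-congˡ (+-congˡ (∑-upTo-∷ʳ n _)) ⟨
    X + (first + Y)
      ≈⟨ trans (sym (+-assoc _ _ _)) (trans (+-congʳ (+-comm _ _)) (+-assoc _ _ _)) ⟩
    first + (X + Y)
      ≈⟨ +-congˡ (∑-+ (upTo (suc n)) _ _) ⟨
    first + ∑ (upTo (suc n)) (λ j → ι (n C j) * F (suc j) (n ℕ.∸ j) + ι (n C suc j) * F (suc j) (n ℕ.∸ j))
      ≈⟨ +-congˡ (∑-cong (upTo (suc n)) λ j → trans (sym (distribʳ _ _ _)) (*-congʳ
           (trans (sym (ι-+ (n C j) (n C suc j))) (reflexive (≡.cong ι (nCk+nC[k+1]≡[n+1]C[k+1] n j)))))) ⟩
    first + ∑ (upTo (suc n)) (λ j → ι (suc n C suc j) * F (suc j) (n ℕ.∸ j))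
      ≡⟨ ∑-upTo-suc (suc n) _ ⟨
    ∑ (upTo (suc (suc n))) (λ j → ι (suc n C j) * F j (suc n ℕ.∸ j)) ∎
    where
    X = ∑ (upTo (suc n)) (λ j → ι (n C j) * F (suc j) (n ℕ.∸ j))
    Y = ∑ (upTo (suc n)) (λ j → ι (n C suc j) * F (suc j) (n ℕ.∸ j))
    first = ι (suc n C 0) * F 0 (suc n)

-- Estimates in an ordered ring

record OrderedRing : Set₁ where
  infix  4 _≤_
  infixl 6 _+_
  infixl 7 _*_
  infix  8 -_
  field
    Carrier           : Set
    _≤_               : Carrier → Carrier → Set
    _+_ _*_           : Carrier → Carrier → Carrier
    -_                : Carrier → Carrier
    0# 1#             : Carrier
    isCommutativeRing : IsCommutativeRing _≡_ _+_ _*_ -_ 0# 1#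
    isPartialOrder    : IsPartialOrder _≡_ _≤_
    +-mono-≤          : ∀ {a b c d} → a ≤ b → c ≤ d → a + c ≤ b + d
    0≤1               : 0# ≤ 1#
    0≤*               : ∀ {a b} → 0# ≤ a → 0# ≤ b → 0# ≤ a * b

  commutativeRing : CommutativeRing 0ℓ 0ℓ
  commutativeRing = record { isCommutativeRing = isCommutativeRing }

  open CommutativeRing commutativeRing public
    using (commutativeSemiring; semiring; +-assoc; +-comm; +-identityˡ; +-identityʳ; -‿inverseʳ; -‿inverseˡ;
           *-assoc; *-comm; *-identityˡ; *-identityʳ; distribˡ; distribʳ; zeroˡ; zeroʳ; ring;
             *-commutativeSemigroup)

  poset : Poset 0ℓ 0ℓ 0ℓ
  poset = record { isPartialOrder = isPartialOrder }

  open Poset poset public using () renaming (refl to ≤-refl; trans to ≤-trans; reflexive to ≤-reflexive)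

module Ordered (R : OrderedRing) where
  open OrderedRing R
  open Algebra.Properties.Semiring.Exp semiring public
  open Algebra.Properties.CommutativeSemiring.Exp commutativeSemiring public using (^-distrib-*)
  open Algebra.Properties.Semiring.Mult semiring using (×-homo-+; ×1-homo-*) renaming (_×_ to _·_)
  open Algebra.Properties.Ring ring using (-1*x≈-x; -‿distribˡ-*; -‿distribʳ-*)
  module Solver = Algebra.Solver.Ring.NaturalCoefficients.Default commutativeSemiring
  module ≤-Reasoning = Relation.Binary.Reasoning.PartialOrder poset

  +-monoʳ-≤ : ∀ a {b c} → b ≤ c → a + b ≤ a + c
  +-monoʳ-≤ a = +-mono-≤ ≤-refl

  +-monoˡ-≤ : ∀ a {b c} → b ≤ c → b + a ≤ c + a
  +-monoˡ-≤ a b≤c = +-mono-≤ b≤c ≤-refl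

  a-b+b : ∀ a b → (a + - b) + b ≡ a
  a-b+b a b = ≡.trans (+-assoc a (- b) b) (≡.trans (≡.cong (a +_) (-‿inverseˡ b)) (+-identityʳ a))

  *-neg-* : ∀ a b c → a * (- b * c) ≡ - 1# * (a * (b * c))
  *-neg-* a b c = ≡.trans (≡.cong (a *_) (≡.sym (-‿distribˡ-* b c)))
    (≡.trans (≡.sym (-‿distribʳ-* a (b * c))) (≡.sym (-1*x≈-x (a * (b * c)))))

  a≤b⇒0≤b-a : ∀ {a b} → a ≤ b → 0# ≤ b + - a
  a≤b⇒0≤b-a {a} a≤b = ≡.subst (_≤ _) (-‿inverseʳ a) (+-monoˡ-≤ (- a) a≤b)

  a≤b+c⇒a-b≤c : ∀ {a b c} → a ≤ b + c → a + - b ≤ c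
  a≤b+c⇒a-b≤c {a} {b} {c} a≤b+c = ≡.subst (a + - b ≤_)
    (≡.trans (≡.cong (_+ - b) (+-comm b c)) (≡.trans (+-assoc c b (- b))
      (≡.trans (≡.cong (c +_) (-‿inverseʳ b)) (+-identityʳ c))))
    (+-monoˡ-≤ (- b) a≤b+c)

  *-monoˡ-≤ : ∀ a {b c} → 0# ≤ a → b ≤ c → a * b ≤ a * c
  *-monoˡ-≤ a {b} {c} 0≤a b≤c = ≡.subst₂ _≤_ (+-identityˡ (a * b))
    (≡.trans (≡.sym (distribˡ a (c + - b) b)) (≡.cong (a *_) (a-b+b c b)))
    (+-monoˡ-≤ (a * b) (0≤* 0≤a (a≤b⇒0≤b-a b≤c)))

  *-monoʳ-≤ : ∀ a {b c} → 0# ≤ a → b ≤ c → b * a ≤ c * a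
  *-monoʳ-≤ a 0≤a b≤c = ≡.subst₂ _≤_ (*-comm a _) (*-comm a _) (*-monoˡ-≤ a 0≤a b≤c)

  *-mono-≤ : ∀ {a b c d} → 0# ≤ b → 0# ≤ c → a ≤ b → c ≤ d → a * c ≤ b * d
  *-mono-≤ {a} {b} {c} {d} 0≤b 0≤c a≤b c≤d = ≤-trans (*-monoʳ-≤ c 0≤c a≤b) (*-monoˡ-≤ b 0≤b c≤d)

  ι : ℕ → Carrier
  ι n = n · 1#

  ι-0 : ι 0 ≡ 0#
  ι-0 = ≡.refl

  ι-1 : ι 1 ≡ 1#
  ι-1 = +-identityʳ 1#

  ι-+ : ∀ m n → ι (m ℕ.+ n) ≡ ι m + ι n
  ι-+ = ×-homo-+ 1#

  ι-* : ∀ m n → ι (m ℕ.* n) ≡ ι m * ι n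
  ι-* = ×1-homo-*

  ι-^ : ∀ n a → ι (n ℕ.^ a) ≡ ι n ^ a
  ι-^ n zero    = ι-1
  ι-^ n (suc a) = ≡.trans (ι-* n (n ℕ.^ a)) (≡.cong (ι n *_) (ι-^ n a))

  0≤ι : ∀ n → 0# ≤ ι n
  0≤ι zero    = ≤-refl
  0≤ι (suc n) = ≡.subst (_≤ ι (suc n)) (+-identityʳ 0#) (+-mono-≤ 0≤1 (0≤ι n))

  ι-mono-≤ : ∀ {m n} → m ℕ.≤ n → ι m ≤ ι n
  ι-mono-≤ {m} m≤n with ℕ.m≤n⇒∃[o]m+o≡n m≤n
  ... | o , ≡.refl = ≡.subst₂ _≤_ (+-identityʳ (ι m)) (≡.sym (ι-+ m o)) (+-monoʳ-≤ (ι m) (0≤ι o))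

  0≤^ : ∀ {a} k → 0# ≤ a → 0# ≤ a ^ k
  0≤^ zero    0≤a = 0≤1
  0≤^ (suc k) 0≤a = 0≤* 0≤a (0≤^ k 0≤a)

  ^-mono-≤ : ∀ {a b} k → 0# ≤ a → a ≤ b → a ^ k ≤ b ^ k
  ^-mono-≤ zero    0≤a a≤b = ≤-refl
  ^-mono-≤ (suc k) 0≤a a≤b = *-mono-≤ (≤-trans 0≤a a≤b) (0≤^ k 0≤a) a≤b (^-mono-≤ k 0≤a a≤b)

  1≤^ : ∀ {a} k → 1# ≤ a → 1# ≤ a ^ k
  1≤^ zero    1≤a = ≤-refl
  1≤^ {a} (suc k) 1≤a = ≡.subst (_≤ a ^ suc k) (*-identityˡ 1#)
    (*-mono-≤ (≤-trans 0≤1 1≤a) 0≤1 1≤a (1≤^ k 1≤a))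

  module _ {δ s : Carrier} (0≤δ : 0# ≤ δ) (1+δ≤s : 1# + δ ≤ s) where

    1≤s : 1# ≤ s
    1≤s = ≤-trans (≡.subst (_≤ 1# + δ) (+-identityʳ 1#) (+-monoʳ-≤ 1# 0≤δ)) 1+δ≤s

    -- Bernoulli's inequality without the summand 1: each further factor adds at least δ · s ^ h ≥
    -- δ.
    bernoulli : ∀ h → ι h * δ ≤ s ^ h
    bernoulli zero    = ≡.subst (_≤ 1#) (≡.sym (≡.trans (≡.cong (_* δ) ι-0) (zeroˡ δ))) 0≤1
    bernoulli (suc h) = begin
      ι (suc h) * δ                   ≡⟨⟩
      (1# + ι h) * δ                ≡⟨ distribʳ δ 1# (ι h) ⟩
      1# * δ + ι h * δ            ≤⟨ +-mono-≤ (*-monoʳ-≤ δ 0≤δ (1≤^ h 1≤s)) (bernoulli h) ⟩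
      s ^ h * δ + s ^ h             ≡⟨ solve 2 (λ x d → x :* d :+ x := (con 1 :+ d) :* x) ≡.refl (s ^ h) δ ⟩
      (1# + δ) * s ^ h              ≤⟨ *-monoʳ-≤ (s ^ h) (≤-trans 0≤1 (1≤^ h 1≤s)) 1+δ≤s ⟩
      s ^ suc h                         ∎
      where
      open ≤-Reasoning
      open Solver

  -- Splitting s ^ b as the product of two powers with exponents about b / 2
  -- makes a linear lower bound for each of them quadratic in b.
  linear≤exponential : ∀ {δ} K M → 0# ≤ δ → (∀ h → M ℕ.≤ h → ι (3 ℕ.* K) ≤ ι h * (δ * δ)) →
    ∀ b → 2 ℕ.+ 2 ℕ.* M ℕ.≤ b → ∀ s → 1# + δ ≤ s → ι K * ι b ≤ s ^ b
  linear≤exponential {δ} K M 0≤δ large b N≤b s 1+δ≤s =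
    let h     = ℕ.⌊ b /2⌋
        h′    = ℕ.⌈ b /2⌉
        h≤h′  = ℕ.⌊n/2⌋≤⌈n/2⌉ b
        split = ℕ.⌊n/2⌋+⌈n/2⌉≡n b
        -- The threshold 2 + 2 M gives h ≥ M, as required by `large`, and also h ≥ 1, so that b ≤ 2
        -- h + 1 ≤ 3 h; the latter is the origin of the 3 in the hypothesis.
        1+M≤h : suc M ℕ.≤ h
        1+M≤h = ≡.subst (ℕ._≤ h) (⌊2+2m/2⌋ M) (ℕ.⌊n/2⌋-mono N≤b)
        h′≤1+h = ℕ.⌊n/2⌋-mono {suc b} {suc (suc b)} (ℕ.n≤1+n _)
        b≤3h  : b ℕ.≤ 3 ℕ.* h
        b≤3h  = ≡.subst (ℕ._≤ 3 ℕ.* h) split (ℕ.+-monoʳ-≤ h (ℕ.≤-trans h′≤1+h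
          (ℕ.≤-trans (ℕ.+-monoˡ-≤ h (ℕ.≤-trans (ℕ.s≤s ℕ.z≤n) 1+M≤h))
            (ℕ.+-monoʳ-≤ h (ℕ.≤-reflexive (≡.sym (ℕ.+-identityʳ h)))))))
        0≤s   = ≤-trans 0≤1 (1≤s 0≤δ 1+δ≤s)
    in begin
    ι K * ι b                          ≤⟨ *-monoˡ-≤ (ι K) (0≤ι K) (ι-mono-≤ b≤3h) ⟩
    ι K * ι (3 ℕ.* h)                  ≡⟨ ι-* K (3 ℕ.* h) ⟨
    ι (K ℕ.* (3 ℕ.* h))                  ≡⟨ ≡.cong ι
      (≡.trans (≡.sym (ℕ.*-assoc K 3 h)) (≡.cong (ℕ._* h) (ℕ.*-comm K 3))) ⟩
    ι (3 ℕ.* K ℕ.* h)                    ≡⟨ ι-* (3 ℕ.* K) h ⟩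
    ι (3 ℕ.* K) * ι h                  ≤⟨ *-monoʳ-≤ (ι h) (0≤ι h) (large h (ℕ.<⇒≤ 1+M≤h)) ⟩
    ι h * (δ * δ) * ι h            ≡⟨ solve 2 (λ h d → h :* (d :* d) :* h := (h :* d) :*
      (h :* d)) ≡.refl (ι h) δ ⟩
    (ι h * δ) * (ι h * δ)          ≤⟨ *-monoˡ-≤ (ι h * δ) (0≤* (0≤ι h) 0≤δ)
      (*-monoʳ-≤ δ 0≤δ (ι-mono-≤ h≤h′)) ⟩
    (ι h * δ) * (ι h′ * δ)         ≤⟨ *-mono-≤ (0≤^ h 0≤s) (0≤* (0≤ι h′) 0≤δ) (bernoulli 0≤δ 1+δ≤s h)
      (bernoulli 0≤δ 1+δ≤s h′) ⟩
    s ^ h * s ^ h′                     ≡⟨ ^-homo-* s h h′ ⟨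
    s ^ (h ℕ.+ h′)                       ≡⟨ ≡.cong (s ^_) split ⟩
    s ^ b                                ∎
    where
    open ≤-Reasoning
    open Solver
    ⌊2+2m/2⌋ : ∀ m → ℕ.⌊ 2 ℕ.+ 2 ℕ.* m /2⌋ ≡ suc m
    ⌊2+2m/2⌋ m = ≡.cong suc (≡.trans (≡.cong (λ k → ℕ.⌊ m ℕ.+ k /2⌋) (ℕ.+-identityʳ m))
      (≡.sym (ℕ.n≡⌊n+n/2⌋ m)))

  open Weighted commutativeSemiring
  open Binomial commutativeSemiring ι ι-0 ι-1 ι-+

  module _ {A : Set} where

    ∑-mono : ∀ (xs : List A) {f g} → (∀ x → f x ≤ g x) → ∑ xs f ≤ ∑ xs g
    ∑-mono []       f≤g = ≤-refl
    ∑-mono (x ∷ xs) f≤g = +-mono-≤ (f≤g x) (∑-mono xs f≤g)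

    0≤∑ : ∀ (xs : List A) {f} → (∀ x → 0# ≤ f x) → 0# ≤ ∑ xs f
    0≤∑ xs {f} 0≤f = ≡.subst (_≤ ∑ xs f) (∑-0 xs) (∑-mono xs 0≤f)

  0≤𝟙 : ∀ {P : Set} (P? : Dec P) → 0# ≤ 𝟙 P?
  0≤𝟙 (yes _) = 0≤1
  0≤𝟙 (no _)  = ≤-refl

  𝟙-mono : ∀ {P Q : Set} (P? : Dec P) (Q? : Dec Q) → (P → Q) → 𝟙 P? ≤ 𝟙 Q?
  𝟙-mono (yes p) Q? f = ≤-reflexive (≡.sym (𝟙-yes Q? (f p)))
  𝟙-mono (no _)  Q? f = 0≤𝟙 Q?

  module _ {n : ℕ} {Q : Pred (Subset n) 0ℓ} (Q? : Decidable Q) where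

    1≤∑𝟙 : ∃ Q → 1# ≤ ∑ (subsets n) (λ S → 𝟙 (Q? S))
    1≤∑𝟙 (S , QS) = ≡.subst (_≤ ∑ (subsets n) (λ S → 𝟙 (Q? S)))
      (∑-unique n (λ S′ → Vec.≡-dec Bool._≟_ S′ S) S ≡.refl (λ eq → eq))
      (∑-mono (subsets n) λ S′ → 𝟙-mono (Vec.≡-dec Bool._≟_ S′ S) (Q? S′) λ { ≡.refl → QS })

    ∑𝟙≤1 : (∀ {S S′} → Q S → Q S′ → S ≡ S′) → ∑ (subsets n) (λ S → 𝟙 (Q? S)) ≤ 1#
    ∑𝟙≤1 unique with Subset.anySubset? Q?
    ... | yes (S , QS) = ≤-reflexive (∑-unique n Q? S QS λ QS′ → unique QS′ QS)
    ... | no ¬Q = ≡.subst (_≤ 1#) (≡.sym (≡.trans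
      (∑-cong (subsets n) λ S → 𝟙-no (Q? S) λ QS → ¬Q (S , QS)) (∑-0 (subsets n)))) 0≤1

  module _ {φ : Bool × Bool → Carrier} (0≤φ : ∀ x → 0# ≤ φ x) where

    0≤rowWeight : ∀ {n} (r : Vec (Bool × Bool) n) → 0# ≤ Rows.rowWeight arcPairs φ r
    0≤rowWeight []      = 0≤1
    0≤rowWeight (x ∷ r) = 0≤* (0≤φ x) (0≤rowWeight r)

    0≤weightΔ : ∀ {n} (t : Triangle n) → 0# ≤ weightΔ φ t
    0≤weightΔ {zero}  _       = 0≤1
    0≤weightΔ {suc n} (r , t) = 0≤* (0≤rowWeight r) (0≤weightΔ t)

  -- Total weights of graphs and of tournaments with ties

  module _ (ρ : Carrier) where

    private
      φᵍ = graphWeight ρ 1#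
      φᵗ = tournamentWeight (ρ + - 1#)

    G : ℕ → Carrier
    G n = (1# + ρ) ^ triangular n

    connectedWeight : ℕ → Carrier
    connectedWeight = strongTotal φᵍ

    irreducibleWeight : ℕ → Carrier
    irreducibleWeight = strongTotal φᵗ

    total-graphs : ∀ n → total φᵍ n ≡ G n
    total-graphs n = ≡.trans (total≈ φᵍ n) (≡.cong (_^ triangular n)
      (solve 1 (λ ρ → con 1 :+ (con 0 :+ (con 0 :+ (ρ :+ con 0))) := con 1 :+ ρ) ≡.refl ρ))
      where open Solver

    -- A pair contributes 1 + 1 + (ρ - 1) for its two orientations and the tie, the same 1 + ρ as a
    -- non-edge and an edge.
    total-tournaments : ∀ n → total φᵗ n ≡ G n
    total-tournaments n = ≡.trans (total≈ φᵗ n) (≡.cong (_^ triangular n)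
      (≡.trans
        (solve 1 (λ x → con 0 :+ (con 1 :+ (con 1 :+ (x :+ con 0))) := con 1 :+ (x :+ con 1)) ≡.refl
          (ρ + - 1#))
        (≡.cong (1# +_) (a-b+b ρ 1#))))
      where open Solver

    d : ℕ → Carrier
    d zero    = 1#
    d (suc k) = - irreducibleWeight (suc k)

    tournament-convolution : ∀ n → G (suc n) ≡
      ∑ (upTo (suc n)) (λ j → ι (suc n C suc j) * (irreducibleWeight (suc j) * G (n ℕ.∸ j)))
    tournament-convolution n = begin
      G (suc n)
        ≡⟨ total-tournaments (suc n) ⟨
      total φᵗ (suc n)
        ≡⟨ tournament-recurrence (ρ + - 1#) n ⟩
      ∑ (subsets (suc n)) (λ S → 𝟙 (Subset.nonempty? S) *
        (irreducibleWeight (size S) * total φᵗ (size (∁ S))))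
        ≡⟨ ∑-cong (subsets (suc n)) (λ S → ≡.cong₂ _*_
             (𝟙-⇔ (Subset.nonempty? S) (1 ℕ.≤? size S) (0<size S) (nonempty S))
             (≡.cong (irreducibleWeight (size S) *_) (total-tournaments (size (∁ S))))) ⟩
      ∑ (subsets (suc n)) (λ S → F (size S) (size (∁ S)))
        ≡⟨ ∑-subsets-∁ (suc n) F ⟩
      ∑ (subsets (suc n)) (λ S → F (size (∁ S)) (size S))
        ≡⟨ ∑-subsets-size (suc n) F ⟩
      ∑ (upTo (suc (suc n))) (λ j → ι (suc n C j) * F j (suc n ℕ.∸ j))
        ≡⟨ ∑-upTo-suc (suc n) _ ⟩
      -- The empty digraph counts as strongly connected and `irreducibleWeight 0` is 1; it is the
      -- indicator of a nonempty set that removes the term j = 0.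
      ι (suc n C 0) * (0# * X) + ∑ (upTo (suc n)) (λ j → ι (suc n C suc j) * F (suc j) (n ℕ.∸ j))
        ≡⟨ ≡.cong₂ _+_ (≡.trans (≡.cong (ι (suc n C 0) *_) (zeroˡ X)) (zeroʳ (ι (suc n C 0))))
             (∑-cong (upTo (suc n)) λ j → ≡.cong (ι (suc n C suc j) *_) (*-identityˡ _)) ⟩
      0# + ∑ (upTo (suc n)) (λ j → ι (suc n C suc j) * (irreducibleWeight (suc j) * G (n ℕ.∸ j)))
        ≡⟨ +-identityˡ _ ⟩
      ∑ (upTo (suc n)) (λ j → ι (suc n C suc j) * (irreducibleWeight (suc j) * G (n ℕ.∸ j))) ∎
      where
      open ≡.≡-Reasoning
      F : ℕ → ℕ → Carrier
      F a b = 𝟙 (1 ℕ.≤? a) * (irreducibleWeight a * G b)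
      X = irreducibleWeight 0 * G (suc n)
      0<size : ∀ {m} (S : Subset m) → Nonempty S → 1 ℕ.≤ size S
      0<size S (x , x∈S) = ≡.subst (ℕ._≤ size S) (Subset.∣⁅x⁆∣≡1 x)
        (Subset.p⊆q⇒∣p∣≤∣q∣ λ y∈ → ≡.subst (_∈ S) (≡.sym (Subset.x∈⁅y⁆⇒x≡y x y∈)) x∈S)
      nonempty : ∀ {m} (S : Subset m) → 1 ℕ.≤ size S → Nonempty S
      nonempty {m} S 1≤ with Subset.nonempty? S
      ... | yes ne = ne
      ... | no ¬ne = contradiction 1≤ (ℕ.<⇒≱ (≡.subst (ℕ._< 1) (≡.sym (≡.trans
        (≡.cong size (Subset.Empty-unique ¬ne)) (Subset.∣⊥∣≡0 m))) (ℕ.s≤s ℕ.z≤n)))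

    d-convolution : ∀ n → ∑ (upTo (suc (suc n))) (λ j → ι (suc n C j) * (d j * G (suc n ℕ.∸ j))) ≡ 0#
    d-convolution n = begin
      ∑ (upTo (suc (suc n))) (λ j → ι (suc n C j) * (d j * G (suc n ℕ.∸ j)))
        ≡⟨ ∑-upTo-suc (suc n) _ ⟩
      ι (suc n C 0) * (1# * G (suc n)) +
      ∑ (upTo (suc n)) (λ j → ι (suc n C suc j) * (- irreducibleWeight (suc j) * G (n ℕ.∸ j)))
        ≡⟨ ≡.cong₂ _+_
             (≡.trans (≡.cong₂ _*_ (≡.trans (≡.cong ι (nC0≡1 (suc n))) ι-1) (*-identityˡ (G (suc n))))
               (*-identityˡ (G (suc n))))
             (≡.trans (∑-cong (upTo (suc n)) λ j → *-neg-* (ι (suc n C suc j))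
               (irreducibleWeight (suc j)) (G (n ℕ.∸ j)))
               (≡.sym (*-∑ (- 1#) (upTo (suc n)) _))) ⟩
      G (suc n) + - 1# * ∑ (upTo (suc n)) (λ j → ι (suc n C suc j) *
        (irreducibleWeight (suc j) * G (n ℕ.∸ j)))
        ≡⟨ ≡.cong (λ x → G (suc n) + - 1# * x) (tournament-convolution n) ⟨
      G (suc n) + - 1# * G (suc n)
        ≡⟨ ≡.trans (≡.cong (G (suc n) +_) (-1*x≈-x (G (suc n)))) (-‿inverseʳ (G (suc n))) ⟩
      0# ∎
      where
      open ≡.≡-Reasoning

    -- The total weight of the graphs on n vertices with a component of size at least n - r,
    -- provided that 3 r < n.
    principal : ℕ → ℕ → Carrier
    principal r n = ∑ (upTo (suc r)) λ j → ι (n C j) * (connectedWeight (n ℕ.∸ j) * G j)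

    -- Only an upper bound is required for the graphs without a large component, so both sides of
    -- the cut carry arbitrary graphs, and a graph may be counted for several cuts.
    middleTerm : ℕ → ℕ → Carrier
    middleTerm n j = ι (n C j) * (𝟙 (j ℕ.≤? n ℕ.∸ j) * (G (n ℕ.∸ j) * G j))

    module _ (0≤ρ : 0# ≤ ρ) (r n : ℕ) (large : r ℕ.+ r ℕ.+ r ℕ.< n) where

      private
        0≤φ : ∀ x → 0# ≤ φᵍ x
        0≤φ (true  , true)  = 0≤ρ
        0≤φ (false , false) = 0≤1
        0≤φ (true  , false) = ≤-refl
        0≤φ (false , true)  = ≤-refl

        c : Bool × Bool
        c = false , false

        LargeCut MiddleCut : Triangle n → Subset n → Set
        LargeCut  t S = size (∁ S) ℕ.≤ r × Cut c S t × Strong t S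
        MiddleCut t S = (r ℕ.< size (∁ S) × size (∁ S) ℕ.≤ size S) × Cut c S t

        strong? : ∀ t (S : Subset n) → Dec (Strong t S)
        strong? t S = stronglyConnected? (toDigraph (restrict S t))

        largeCut? : ∀ t S → Dec (LargeCut t S)
        largeCut? t S = (size (∁ S) ℕ.≤? r) ×-dec (cut? c S t ×-dec strong? t S)

        middleSize? : ∀ a b → Dec (r ℕ.< a × a ℕ.≤ b)
        middleSize? a b = (r ℕ.<? a) ×-dec (a ℕ.≤? b)

        middleCut? : ∀ t S → Dec (MiddleCut t S)
        middleCut? t S = middleSize? (size (∁ S)) (size S) ×-dec cut? c S t

        X Y : Triangle n → Carrier
        X t = ∑ (subsets n) λ S → 𝟙 (largeCut? t S)
        Y t = ∑ (subsets n) λ S → 𝟙 (middleCut? t S)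

        forced : ∀ (t : Triangle n) → (∀ i j → i ≢ j → IsEdge (arcs t i j)) →
          ∀ {i j} → i ≢ j → ¬ Arc (toDigraph t) j i → arcs t i j ≡ c
        forced t edges = forced-no t edges

        size∁⊤≤r : size (∁ (Subset.⊤ {n})) ℕ.≤ r
        size∁⊤≤r = ≡.subst (ℕ._≤ r) (≡.sym (ℕ.+-cancelˡ-≡ n _ 0 (≡.trans
          (≡.cong (ℕ._+ size (∁ (Subset.⊤ {n}))) (≡.sym (Subset.∣⊤∣≡n n)))
          (≡.trans (size+size∁ (Subset.⊤ {n})) (≡.sym (ℕ.+-identityʳ n)))))) ℕ.z≤n

        -- In a graph the large cut set is unique, so that X t ≤ 1; a triangle that is not a graph
        -- has weight 0, which makes the product bound hold for every t.
        W*X≤W : ∀ t → weightΔ φᵍ t * X t ≤ weightΔ φᵍ t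
        W*X≤W t with graphs⊎0 ρ 1# t
        ... | inj₂ w≡0 = ≤-reflexive (≡.trans (≡.cong (_* X t) w≡0) (≡.trans (zeroˡ (X t)) (≡.sym w≡0)))
        ... | inj₁ edges = ≡.subst (weightΔ φᵍ t * X t ≤_) (*-identityʳ _)
          (*-monoˡ-≤ (weightΔ φᵍ t) (0≤weightΔ 0≤φ t) (∑𝟙≤1 (largeCut? t) λ {S} {S′} (s , cut , str)
            (s′ , cut′ , str′) →
            large-unique t (forced t edges) r large (s , Cut⇒CutBy c S t cut , str)
              (s′ , Cut⇒CutBy c S′ t cut′ , str′)))

        1≤X+Y : ∀ (t : Triangle n) → (∀ i j → i ≢ j → IsEdge (arcs t i j)) → 1# ≤ X t + Y t
        1≤X+Y t edges with large⊎middle t (forced t edges) r large (⊂-wellFounded Subset.⊤) size∁⊤≤r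
          (fullCut t c)
        ... | inj₁ (S , s , cut , str) = ≡.subst (_≤ X t + Y t) (+-identityʳ 1#)
          (+-mono-≤ (1≤∑𝟙 (largeCut? t) (S , s , CutBy⇒Cut c S t cut , str))
            (0≤∑ (subsets n) λ S → 0≤𝟙 (middleCut? t S)))
        ... | inj₂ (S , r< , ∁≤ , cut) = ≡.subst (_≤ X t + Y t) (+-identityˡ 1#)
          (+-mono-≤ (0≤∑ (subsets n) λ S → 0≤𝟙 (largeCut? t S))
            (1≤∑𝟙 (middleCut? t) (S , (r< , ∁≤) , CutBy⇒Cut c S t cut)))

        W≤W*X+W*Y : ∀ t → weightΔ φᵍ t ≤ weightΔ φᵍ t * X t + weightΔ φᵍ t * Y t
        W≤W*X+W*Y t with graphs⊎0 ρ 1# t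
        ... | inj₂ w≡0 = ≤-reflexive (≡.trans w≡0 (≡.sym (≡.trans
                (≡.sym (distribˡ (weightΔ φᵍ t) (X t) (Y t)))
                (≡.trans (≡.cong (_* (X t + Y t)) w≡0) (zeroˡ (X t + Y t))))))
        ... | inj₁ edges = ≡.subst₂ _≤_ (*-identityʳ _) (distribˡ (weightΔ φᵍ t) (X t) (Y t))
          (*-monoˡ-≤ (weightΔ φᵍ t) (0≤weightΔ 0≤φ t) (1≤X+Y t edges))

        x*yz : ∀ x y z → x * (y * z) ≡ y * (x * z)
        x*yz = solve 3 (λ x y z → x :* (y :* z) := y :* (x :* z)) ≡.refl
          where open Solver

        ∑WX : ∑ (triangles n) (λ t → weightΔ φᵍ t * X t) ≡
          ∑ (subsets n) (λ S → 𝟙 (size (∁ S) ℕ.≤? r) * (connectedWeight (size S) * G (size (∁ S))))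
        ∑WX = begin
          ∑ (triangles n) (λ t → weightΔ φᵍ t * X t)
            ≡⟨ ∑-cong (triangles n) (λ t → *-∑ (weightΔ φᵍ t) (subsets n) _) ⟩
          ∑ (triangles n) (λ t → ∑ (subsets n) λ S → weightΔ φᵍ t * 𝟙 (largeCut? t S))
            ≡⟨ ∑-comm (triangles n) (subsets n) _ ⟩
          ∑ (subsets n) (λ S → ∑ (triangles n) λ t → weightΔ φᵍ t * 𝟙 (largeCut? t S))
            ≡⟨ ∑-cong (subsets n) (λ S → ≡.trans (∑-cong (triangles n) λ t → ≡.trans
                 (≡.cong (weightΔ φᵍ t *_) (≡.trans (𝟙-× (size (∁ S) ℕ.≤? r) (cut? c S t ×-dec strong? t S))
                   (≡.cong (𝟙 (size (∁ S) ℕ.≤? r) *_) (𝟙-× (cut? c S t) (strong? t S)))))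
                 (x*yz (weightΔ φᵍ t) (𝟙 (size (∁ S) ℕ.≤? r)) _))
                 (≡.trans (≡.sym (*-∑ (𝟙 (size (∁ S) ℕ.≤? r)) (triangles n) _))
                   (≡.cong (𝟙 (size (∁ S) ℕ.≤? r) *_) (≡.trans (∑-strong-cut φᵍ c ≡.refl ≡.refl S)
                     (≡.cong (connectedWeight (size S) *_) (total-graphs (size (∁ S)))))))) ⟩
          ∑ (subsets n) (λ S → 𝟙 (size (∁ S) ℕ.≤? r) * (connectedWeight (size S) * G (size (∁ S)))) ∎
          where open ≡.≡-Reasoning

        ∑WY : ∑ (triangles n) (λ t → weightΔ φᵍ t * Y t) ≡
          ∑ (subsets n) (λ S → 𝟙 (middleSize? (size (∁ S)) (size S)) * (G (size S) * G (size (∁ S))))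
        ∑WY = begin
          ∑ (triangles n) (λ t → weightΔ φᵍ t * Y t)
            ≡⟨ ∑-cong (triangles n) (λ t → *-∑ (weightΔ φᵍ t) (subsets n) _) ⟩
          ∑ (triangles n) (λ t → ∑ (subsets n) λ S → weightΔ φᵍ t * 𝟙 (middleCut? t S))
            ≡⟨ ∑-comm (triangles n) (subsets n) _ ⟩
          ∑ (subsets n) (λ S → ∑ (triangles n) λ t → weightΔ φᵍ t * 𝟙 (middleCut? t S))
            ≡⟨ ∑-cong (subsets n) (λ S → ≡.trans (∑-cong (triangles n) λ t → ≡.trans
                 (≡.cong (weightΔ φᵍ t *_) (𝟙-× (middleSize? (size (∁ S)) (size S)) (cut? c S t)))
                 (x*yz (weightΔ φᵍ t) (𝟙 (middleSize? (size (∁ S)) (size S))) _))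
                 (≡.trans (≡.sym (*-∑ (𝟙 (middleSize? (size (∁ S)) (size S))) (triangles n) _))
                   (≡.cong (𝟙 (middleSize? (size (∁ S)) (size S)) *_)
                     (≡.trans (∑-graph-cut φᵍ c ≡.refl ≡.refl S)
                     (≡.cong₂ _*_ (total-graphs (size S)) (total-graphs (size (∁ S)))))))) ⟩
          ∑ (subsets n) (λ S → 𝟙 (middleSize? (size (∁ S)) (size S)) * (G (size S) * G (size (∁ S)))) ∎
          where open ≡.≡-Reasoning

        r≤n : r ℕ.≤ n
        r≤n = ℕ.<⇒≤ (ℕ.≤-<-trans (ℕ.m≤n+m r (r ℕ.+ r)) large)

        suc-n : suc n ≡ suc r ℕ.+ (n ℕ.∸ r)
        suc-n = ≡.cong suc (≡.sym (ℕ.m+[n∸m]≡n r≤n))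

      private
        principal≡ : ∑ (triangles n) (λ t → weightΔ φᵍ t * X t) ≡ principal r n
        principal≡ = begin
          ∑ (triangles n) (λ t → weightΔ φᵍ t * X t)
            ≡⟨ ∑WX ⟩
          ∑ (subsets n) (λ S → F (size (∁ S)) (size S))
            ≡⟨ ∑-subsets-size n F ⟩
          ∑ (upTo (suc n)) f
            ≡⟨ ≡.cong (λ m → ∑ (upTo m) f) suc-n ⟩
          ∑ (upTo (suc r ℕ.+ (n ℕ.∸ r))) f
            ≡⟨ ∑-upTo-+ (suc r) (n ℕ.∸ r) f ⟩
          ∑ (upTo (suc r)) f + ∑ (upTo (n ℕ.∸ r)) (λ a → f (suc r ℕ.+ a))
            ≡⟨ ≡.cong₂ _+_
                 (∑-cong-< (suc r) λ j j≤r → ≡.cong (ι (n C j) *_)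
                   (≡.trans (≡.cong (_* _) (𝟙-yes (j ℕ.≤? r) (ℕ.s≤s⁻¹ j≤r))) (*-identityˡ _)))
                 (≡.trans (∑-cong (upTo (n ℕ.∸ r)) λ a → ≡.trans (≡.cong (ι (n C (suc r ℕ.+ a)) *_)
                     (≡.trans (≡.cong (_* (connectedWeight (n ℕ.∸ (suc r ℕ.+ a)) * G (suc r ℕ.+ a)))
                       (𝟙-no (suc r ℕ.+ a ℕ.≤? r) (ℕ.<⇒≱ (ℕ.m≤m+n (suc r) a)))) (zeroˡ _)))
                     (zeroʳ (ι (n C (suc r ℕ.+ a)))))
                   (∑-0 (upTo (n ℕ.∸ r)))) ⟩
          principal r n + 0#
            ≡⟨ +-identityʳ (principal r n) ⟩
          principal r n ∎
          where
          open ≡.≡-Reasoning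
          F : ℕ → ℕ → Carrier
          F a b = 𝟙 (a ℕ.≤? r) * (connectedWeight b * G a)
          f : ℕ → Carrier
          f j = ι (n C j) * F j (n ℕ.∸ j)

        middle≡ : ∑ (triangles n) (λ t → weightΔ φᵍ t * Y t) ≡ ∑ (upTo (n ℕ.∸ r))
          (λ a → middleTerm n (suc r ℕ.+ a))
        middle≡ = begin
          ∑ (triangles n) (λ t → weightΔ φᵍ t * Y t)
            ≡⟨ ∑WY ⟩
          ∑ (subsets n) (λ S → F (size (∁ S)) (size S))
            ≡⟨ ∑-subsets-size n F ⟩
          ∑ (upTo (suc n)) f
            ≡⟨ ≡.cong (λ m → ∑ (upTo m) f) suc-n ⟩
          ∑ (upTo (suc r ℕ.+ (n ℕ.∸ r))) f
            ≡⟨ ∑-upTo-+ (suc r) (n ℕ.∸ r) f ⟩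
          ∑ (upTo (suc r)) f + ∑ (upTo (n ℕ.∸ r)) (λ a → f (suc r ℕ.+ a))
            ≡⟨ ≡.cong₂ _+_
                 (≡.trans (∑-cong-< (suc r) {f} {λ _ → 0#} λ j j≤r → ≡.trans (≡.cong (ι (n C j) *_)
                     (≡.trans (≡.cong (_* _) (𝟙-no (middleSize? j (n ℕ.∸ j))
                       (λ (r<j , _) → ℕ.<⇒≱ r<j (ℕ.s≤s⁻¹ j≤r)))) (zeroˡ _)))
                     (zeroʳ (ι (n C j))))
                   (∑-0 (upTo (suc r))))
                 (∑-cong (upTo (n ℕ.∸ r)) λ a → ≡.cong (λ x → ι (n C (suc r ℕ.+ a)) *
                   (x * (G (n ℕ.∸ (suc r ℕ.+ a)) * G (suc r ℕ.+ a))))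
                   (𝟙-⇔ (middleSize? (suc r ℕ.+ a) (n ℕ.∸ (suc r ℕ.+ a)))
                     (suc r ℕ.+ a ℕ.≤? n ℕ.∸ (suc r ℕ.+ a))
                     proj₂ (λ j≤ → ℕ.m≤m+n (suc r) a , j≤))) ⟩
          0# + ∑ (upTo (n ℕ.∸ r)) (λ a → middleTerm n (suc r ℕ.+ a))
            ≡⟨ +-identityˡ _ ⟩
          ∑ (upTo (n ℕ.∸ r)) (λ a → middleTerm n (suc r ℕ.+ a)) ∎
          where
          open ≡.≡-Reasoning
          F : ℕ → ℕ → Carrier
          F a b = 𝟙 (middleSize? a b) * (G b * G a)
          f : ℕ → Carrier
          f j = ι (n C j) * F j (n ℕ.∸ j)

      principal≤G : principal r n ≤ G n
      principal≤G = ≡.subst₂ _≤_ principal≡ (total-graphs n) (∑-mono (triangles n) W*X≤W)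

      G≤principal+middle : G n ≤ principal r n + ∑ (upTo (n ℕ.∸ r)) (λ a → middleTerm n (suc r ℕ.+ a))
      G≤principal+middle = ≡.subst₂ _≤_ (total-graphs n)
        (≡.trans (∑-+ (triangles n) _ _) (≡.cong₂ _+_ principal≡ middle≡))
        (∑-mono (triangles n) W≤W*X+W*Y)

  -- The truncated convolution with the inverse sequence

  module _ (ρ : Carrier) where

    expansion : ℕ → ℕ → Carrier
    expansion r n = ∑ (upTo (suc r)) λ j → ι (n C j) * (d ρ j * G ρ (n ℕ.∸ j))

    defect : ℕ → ℕ → Carrier
    defect r n = G ρ n + - principal ρ r n

    -- Truncating at r - j for the argument n - j makes the double sum run over i + j ≤ r. By `C-∸`
    -- the antidiagonal m carries `connectedWeight` at n - m times the convolution `e m` of d with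
    -- G, which is 1 for m = 0 and 0 otherwise, so only the term at n itself survives.
    expansion-principal : ∀ r n → r ℕ.≤ n →
      ∑ (upTo (suc r)) (λ j → ι (n C j) * (d ρ j * principal ρ (r ℕ.∸ j) (n ℕ.∸ j))) ≡ connectedWeight ρ n
    expansion-principal r n r≤n = begin
      ∑ (upTo (suc r)) (λ j → ι (n C j) * (d ρ j * principal ρ (r ℕ.∸ j) (n ℕ.∸ j)))
        ≡⟨ ∑-cong (upTo (suc r)) (λ j → ≡.trans (≡.cong (ι (n C j) *_)
          (*-∑ (d ρ j) (upTo (suc (r ℕ.∸ j))) _))
             (*-∑ (ι (n C j)) (upTo (suc (r ℕ.∸ j))) _)) ⟩
      ∑ (upTo (suc r)) (λ j → ∑ (upTo (suc (r ℕ.∸ j))) (f j))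
        ≡⟨ ∑-triangle r f ⟩
      ∑ (upTo (suc r)) (λ m → ∑ (upTo (suc m)) (λ j → f j (m ℕ.∸ j)))
        ≡⟨ ∑-cong-< (suc r) (λ m m≤r → ≡.trans
             (∑-cong-< (suc m) λ j j≤m → f≡ (ℕ.s≤s⁻¹ j≤m) (ℕ.≤-trans (ℕ.s≤s⁻¹ m≤r) r≤n))
             (≡.sym (*-∑ (ι (n C m) * connectedWeight ρ (n ℕ.∸ m)) (upTo (suc m)) _))) ⟩
      ∑ (upTo (suc r)) (λ m → ι (n C m) * connectedWeight ρ (n ℕ.∸ m) * e m)
        ≡⟨ ∑-upTo-suc r _ ⟩
      ι (n C 0) * connectedWeight ρ n * e 0 + ∑ (upTo r)
        (λ m → ι (n C suc m) * connectedWeight ρ (n ℕ.∸ suc m) * e (suc m))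
        ≡⟨ ≡.cong₂ _+_
             (≡.cong₂ (λ x y → x * connectedWeight ρ n * y) (≡.trans (≡.cong ι (nC0≡1 n)) ι-1)
               (≡.trans (+-identityʳ _) (≡.trans (≡.cong₂ _*_ ι-1 (*-identityˡ 1#)) (*-identityˡ 1#))))
             (≡.trans (∑-cong (upTo r) λ m → ≡.trans
               (≡.cong (ι (n C suc m) * connectedWeight ρ (n ℕ.∸ suc m) *_) (d-convolution ρ m))
                 (zeroʳ _)) (∑-0 (upTo r))) ⟩
      1# * connectedWeight ρ n * 1# + 0#
        ≡⟨ ≡.trans (+-identityʳ _) (≡.trans (*-identityʳ _) (*-identityˡ _)) ⟩
      connectedWeight ρ n ∎
      where
      open ≡.≡-Reasoning
      f : ℕ → ℕ → Carrier
      f j i = ι (n C j) * (d ρ j * (ι ((n ℕ.∸ j) C i) * (connectedWeight ρ (n ℕ.∸ j ℕ.∸ i) * G ρ i)))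
      e : ℕ → Carrier
      e m = ∑ (upTo (suc m)) λ j → ι (m C j) * (d ρ j * G ρ (m ℕ.∸ j))
      f≡ : ∀ {j m} → j ℕ.≤ m → m ℕ.≤ n → f j (m ℕ.∸ j) ≡
        ι (n C m) * connectedWeight ρ (n ℕ.∸ m) * (ι (m C j) * (d ρ j * G ρ (m ℕ.∸ j)))
      f≡ {j} {m} j≤m m≤n = begin
        ι (n C j) * (d ρ j * (ι ((n ℕ.∸ j) C (m ℕ.∸ j)) *
          (connectedWeight ρ (n ℕ.∸ j ℕ.∸ (m ℕ.∸ j)) * G ρ (m ℕ.∸ j))))
          ≡⟨ ≡.cong (λ k → ι (n C j) * (d ρ j * (ι ((n ℕ.∸ j) C (m ℕ.∸ j)) *
            (connectedWeight ρ k * G ρ (m ℕ.∸ j)))))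
               (≡.trans (ℕ.∸-+-assoc n j (m ℕ.∸ j)) (≡.cong (n ℕ.∸_) (ℕ.m+[n∸m]≡n j≤m))) ⟩
        ι (n C j) * (d ρ j * (ι ((n ℕ.∸ j) C (m ℕ.∸ j)) * (connectedWeight ρ (n ℕ.∸ m) * G ρ (m ℕ.∸ j))))
          ≡⟨ solve 5 (λ a b c x y → a :* (b :* (c :* (x :* y))) := (a :* c) :* (x :* (b :* y))) ≡.refl
               (ι (n C j)) (d ρ j) (ι ((n ℕ.∸ j) C (m ℕ.∸ j))) (connectedWeight ρ (n ℕ.∸ m))
                 (G ρ (m ℕ.∸ j)) ⟩
        (ι (n C j) * ι ((n ℕ.∸ j) C (m ℕ.∸ j))) * (connectedWeight ρ (n ℕ.∸ m) * (d ρ j * G ρ (m ℕ.∸ j)))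
          ≡⟨ ≡.cong (_* (connectedWeight ρ (n ℕ.∸ m) * (d ρ j * G ρ (m ℕ.∸ j)))) (≡.trans
               (≡.sym (ι-* (n C j) ((n ℕ.∸ j) C (m ℕ.∸ j))))
                 (≡.trans (≡.cong ι (C-∸ j≤m m≤n)) (ι-* (n C m) (m C j)))) ⟩
        (ι (n C m) * ι (m C j)) * (connectedWeight ρ (n ℕ.∸ m) * (d ρ j * G ρ (m ℕ.∸ j)))
          ≡⟨ solve 5 (λ a b c x y → (a :* b) :* (c :* (x :* y)) := (a :* c) :* (b :* (x :* y))) ≡.refl
               (ι (n C m)) (ι (m C j)) (connectedWeight ρ (n ℕ.∸ m)) (d ρ j) (G ρ (m ℕ.∸ j)) ⟩
        ι (n C m) * connectedWeight ρ (n ℕ.∸ m) * (ι (m C j) * (d ρ j * G ρ (m ℕ.∸ j))) ∎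
        where open Solver

    expansion≡ : ∀ r n → r ℕ.≤ n → expansion r n ≡
      connectedWeight ρ n + ∑ (upTo (suc r)) (λ j → ι (n C j) * (d ρ j * defect (r ℕ.∸ j) (n ℕ.∸ j)))
    expansion≡ r n r≤n = begin
      expansion r n
        ≡⟨ ∑-cong (upTo (suc r)) (λ j → ≡.trans
             (≡.cong (λ x → ι (n C j) * (d ρ j * x)) (≡.sym
               (≡.trans (+-comm _ _) (a-b+b (G ρ (n ℕ.∸ j)) (principal ρ (r ℕ.∸ j) (n ℕ.∸ j))))))
             (≡.trans (≡.cong (ι (n C j) *_) (distribˡ (d ρ j) _ _)) (distribˡ (ι (n C j)) _ _))) ⟩
      ∑ (upTo (suc r)) (λ j → ι (n C j) * (d ρ j * principal ρ (r ℕ.∸ j) (n ℕ.∸ j)) +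
                              ι (n C j) * (d ρ j * defect (r ℕ.∸ j) (n ℕ.∸ j)))
        ≡⟨ ∑-+ (upTo (suc r)) _ _ ⟩
      ∑ (upTo (suc r)) (λ j → ι (n C j) * (d ρ j * principal ρ (r ℕ.∸ j) (n ℕ.∸ j))) +
      ∑ (upTo (suc r)) (λ j → ι (n C j) * (d ρ j * defect (r ℕ.∸ j) (n ℕ.∸ j)))
        ≡⟨ ≡.cong (_+ ∑ (upTo (suc r)) (λ j → ι (n C j) * (d ρ j * defect (r ℕ.∸ j) (n ℕ.∸ j))))
          (expansion-principal r n r≤n) ⟩
      connectedWeight ρ n + ∑ (upTo (suc r)) (λ j → ι (n C j) * (d ρ j * defect (r ℕ.∸ j) (n ℕ.∸ j))) ∎
      where open ≡.≡-Reasoning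

  -- The scale g without its common factor q ^ `triangular n`; see `scale≡`.
  base : Carrier → ℕ → ℕ → Carrier
  base ρ k n = ι (n C k) * G ρ (n ℕ.∸ k)

  -- Bounds for the defect and for the error of the expansion

  module Estimates (½ : Carrier) (0≤½ : 0# ≤ ½) (½+½≡1 : ½ + ½ ≡ 1#)
    (∣_∣ : Carrier → Carrier) (≤∣_∣ : ∀ x → x ≤ ∣ x ∣) (-≤∣_∣ : ∀ x → - x ≤ ∣ x ∣) where

    ½*2 : ∀ x → ½ * (ι 2 * x) ≡ x
    ½*2 x = begin
      ½ * ((1# + (1# + 0#)) * x)     ≡⟨ ≡.cong (λ y → ½ * ((1# + y) * x)) (+-identityʳ 1#) ⟩
      ½ * ((1# + 1#) * x)            ≡⟨ *-assoc ½ (1# + 1#) x ⟨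
      ½ * (1# + 1#) * x              ≡⟨ ≡.cong (_* x)
        (≡.trans (distribˡ ½ 1# 1#) (≡.trans (≡.cong₂ _+_ (*-identityʳ ½) (*-identityʳ ½)) ½+½≡1)) ⟩
      1# * x                         ≡⟨ *-identityˡ x ⟩
      x ∎
      where open ≡.≡-Reasoning

    ∑½^ : ∀ m → ∑ (upTo m) (½ ^_) + ½ ^ m * ι 2 ≡ ι 2
    ∑½^ zero    = ≡.trans (+-identityˡ _) (*-identityˡ _)
    ∑½^ (suc m) = begin
      ∑ (upTo (suc m)) (½ ^_) + ½ * ½ ^ m * ι 2
        ≡⟨ ≡.cong₂ _+_ (∑-upTo-∷ʳ m (½ ^_)) (≡.trans (*-assoc ½ (½ ^ m) (ι 2))
          (≡.trans (≡.cong (½ *_) (*-comm (½ ^ m) (ι 2))) (½*2 (½ ^ m)))) ⟩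
      ∑ (upTo m) (½ ^_) + ½ ^ m + ½ ^ m
        ≡⟨ +-assoc _ _ _ ⟩
      ∑ (upTo m) (½ ^_) + (½ ^ m + ½ ^ m)
        ≡⟨ ≡.cong (∑ (upTo m) (½ ^_) +_) (solve 1 (λ x → x :+ x := x :*
          (con 1 :+ (con 1 :+ con 0))) ≡.refl (½ ^ m)) ⟩
      ∑ (upTo m) (½ ^_) + ½ ^ m * (1# + (1# + 0#))
        ≡⟨ ∑½^ m ⟩
      ι 2 ∎
      where
      open ≡.≡-Reasoning
      open Solver

    ∑½^≤2 : ∀ m → ∑ (upTo m) (½ ^_) ≤ ι 2
    ∑½^≤2 m = ≡.subst₂ _≤_ (+-identityʳ _) (∑½^ m) (+-monoʳ-≤ (∑ (upTo m) (½ ^_)) (0≤* (0≤^ m 0≤½) (0≤ι 2)))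

    -- The 2 bounds the geometric series, `suc r C j` is the factor left over by `C-∸`, and
    -- `G ρ (suc r ℕ.∸ j)` is the weight of the graphs on the smaller side of the smallest cut
    -- beyond the truncation at r - j.
    errorConstant : Carrier → ℕ → Carrier
    errorConstant ρ r = ∑ (upTo (suc r)) λ j → ∣ d ρ j ∣ * (ι 2 * (ι (suc r C j) * G ρ (suc r ℕ.∸ j)))

    module _ (ρ : Carrier) (0≤ρ : 0# ≤ ρ) (N₀ : ℕ) (exp : ∀ b → N₀ ℕ.≤ b → ι 8 * ι b ≤ (1# + ρ) ^ b) where

      private
        s = 1# + ρ
        0≤s : 0# ≤ s
        0≤s = ≡.subst (_≤ s) (+-identityʳ 0#) (+-mono-≤ 0≤1 0≤ρ)

        0≤G : ∀ n → 0# ≤ G ρ n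
        0≤G n = 0≤^ (triangular n) 0≤s

      -- The two-sided product for the smallest middle size j = r + 1; all other middle terms are
      -- compared with it.
      bound : ℕ → ℕ → Carrier
      bound r n = ι (n C suc r) * (G ρ (suc r) * G ρ (n ℕ.∸ suc r))

      0≤bound : ∀ r n → 0# ≤ bound r n
      0≤bound r n = 0≤* (0≤ι (n C suc r)) (0≤* (0≤G (suc r)) (0≤G (n ℕ.∸ suc r)))

      -- With n = 2k + a + b, moving a vertices across the cut costs a factor at most n ^ a in
      -- the binomial coefficient and gains a factor (s ^ b) ^ a, where 2 n ≤ s ^ b.
      split-bound : ∀ k a b → a ℕ.≤ b → k ℕ.≤ b → N₀ ℕ.≤ b → let n = (k ℕ.+ a) ℕ.+ (k ℕ.+ b) in
        ι (n C (k ℕ.+ a)) * (G ρ (k ℕ.+ b) * G ρ (k ℕ.+ a)) ≤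
        ½ ^ a * (ι (n C k) * (G ρ k * G ρ (a ℕ.+ (k ℕ.+ b))))
      split-bound k a b a≤b k≤b N₀≤b = begin
        ι (n C (k ℕ.+ a)) * (G ρ (k ℕ.+ b) * G ρ (k ℕ.+ a))
          ≤⟨ *-monoʳ-≤ GG (0≤* (0≤G (k ℕ.+ b)) (0≤G (k ℕ.+ a))) (ι-mono-≤ (C-+-≤ n k a)) ⟩
        ι (n ℕ.^ a ℕ.* (n C k)) * GG
          ≡⟨ ≡.cong (_* GG) (ι-* (n ℕ.^ a) (n C k)) ⟩
        ι (n ℕ.^ a) * ι (n C k) * GG
          ≤⟨ *-monoʳ-≤ GG (0≤* (0≤G (k ℕ.+ b)) (0≤G (k ℕ.+ a))) (*-monoʳ-≤ (ι (n C k)) (0≤ι (n C k)) n^a≤) ⟩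
        ½ ^ a * s ^ (b ℕ.* a) * ι (n C k) * GG
          ≡⟨ solve 4 (λ h p c g → h :* p :* c :* g := h :* (c :* (p :* g))) ≡.refl (½ ^ a)
            (s ^ (b ℕ.* a)) (ι (n C k)) GG ⟩
        ½ ^ a * (ι (n C k) * (s ^ (b ℕ.* a) * GG))
          ≡⟨ ≡.cong (λ x → ½ ^ a * (ι (n C k) * x)) exponents ⟩
        ½ ^ a * (ι (n C k) * (G ρ k * G ρ (a ℕ.+ (k ℕ.+ b)))) ∎
        where
        open ≤-Reasoning
        open Solver
        n = (k ℕ.+ a) ℕ.+ (k ℕ.+ b)
        GG = G ρ (k ℕ.+ b) * G ρ (k ℕ.+ a)
        -- All of k, a and b are at most b, so n ≤ 4 b; this is why `exp` is assumed with the
        -- constant 8.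
        2n≤8b : 2 ℕ.* n ℕ.≤ 8 ℕ.* b
        2n≤8b = ℕ.≤-trans (ℕ.*-monoʳ-≤ 2 (ℕ.+-mono-≤ (ℕ.+-mono-≤ k≤b a≤b) (ℕ.+-monoˡ-≤ b k≤b)))
          (ℕ.≤-reflexive (ℕSolver.solve 1 (λ b → ℕSolver.con 2 ℕSolver.:*
            ((b ℕSolver.:+ b) ℕSolver.:+ (b ℕSolver.:+ b)) ℕSolver.:= ℕSolver.con 8 ℕSolver.:* b) ≡.refl b))
        2n≤s^b : ι 2 * ι n ≤ s ^ b
        2n≤s^b = ≤-trans (≡.subst₂ _≤_ (ι-* 2 n) (ι-* 8 b) (ι-mono-≤ 2n≤8b)) (exp b N₀≤b)
        n^a≤ : ι (n ℕ.^ a) ≤ ½ ^ a * s ^ (b ℕ.* a)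
        n^a≤ = begin
          ι (n ℕ.^ a)                    ≡⟨ ι-^ n a ⟩
          ι n ^ a                        ≡⟨ ≡.cong (_^ a) (½*2 (ι n)) ⟨
          (½ * (ι 2 * ι n)) ^ a          ≡⟨ ^-distrib-* ½ (ι 2 * ι n) a ⟩
          ½ ^ a * (ι 2 * ι n) ^ a        ≤⟨ *-monoˡ-≤ (½ ^ a) (0≤^ a 0≤½)
            (^-mono-≤ a (0≤* (0≤ι 2) (0≤ι n)) 2n≤s^b) ⟩
          ½ ^ a * (s ^ b) ^ a            ≡⟨ ≡.cong (½ ^ a *_) (^-assocʳ s b a) ⟩
          ½ ^ a * s ^ (b ℕ.* a)          ∎
        -- The a vertices exchange their pairs with k vertices for pairs with k + b vertices, which
        -- accounts for the summand b a.
        exponent : b ℕ.* a ℕ.+ (triangular (k ℕ.+ b) ℕ.+ triangular (k ℕ.+ a)) ≡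
                   triangular k ℕ.+ triangular (a ℕ.+ (k ℕ.+ b))
        exponent = ≡.trans (≡.cong (λ x → b ℕ.* a ℕ.+ (triangular (k ℕ.+ b) ℕ.+ x)) (triangular-+ k a))
          (≡.trans (ℕSolver.solve 6 (λ a b k s t u →
              b ℕSolver.:* a ℕSolver.:+ (s ℕSolver.:+ (t ℕSolver.:+ u ℕSolver.:+ k ℕSolver.:* a)) ℕSolver.:=
              t ℕSolver.:+ (u ℕSolver.:+ s ℕSolver.:+ a ℕSolver.:* (k ℕSolver.:+ b))) ≡.refl
              a b k (triangular (k ℕ.+ b)) (triangular k) (triangular a))
            (≡.cong (triangular k ℕ.+_) (≡.sym (triangular-+ a (k ℕ.+ b)))))
        exponents : s ^ (b ℕ.* a) * GG ≡ G ρ k * G ρ (a ℕ.+ (k ℕ.+ b))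
        exponents = ≡.trans (≡.cong (s ^ (b ℕ.* a) *_)
          (≡.sym (^-homo-* s (triangular (k ℕ.+ b)) (triangular (k ℕ.+ a)))))
          (≡.trans (≡.sym (^-homo-* s (b ℕ.* a) _)) (≡.trans (≡.cong (s ^_) exponent)
            (^-homo-* s (triangular k) (triangular (a ℕ.+ (k ℕ.+ b))))))

      -- With k = r + 1 and n = 2 k + a + b ≤ 2 k + 2 b, this is the bound on n that yields b ≥ k +
      -- N₀.
      threshold : ℕ → ℕ
      threshold r = 4 ℕ.* suc r ℕ.+ 2 ℕ.* N₀

      middleTerm≤ : ∀ r n a → threshold r ℕ.≤ n → middleTerm ρ n (suc r ℕ.+ a) ≤ ½ ^ a * bound r n
      middleTerm≤ r n a thr≤n = by-cases (j ℕ.≤? n ℕ.∸ j)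
        where
        j = suc r ℕ.+ a
        X = G ρ (n ℕ.∸ j) * G ρ j
        by-cases : (j≤? : Dec (j ℕ.≤ n ℕ.∸ j)) → ι (n C j) * (𝟙 j≤? * X) ≤ ½ ^ a * bound r n
        by-cases (no _) = ≡.subst (_≤ ½ ^ a * bound r n)
          (≡.sym (≡.trans (≡.cong (ι (n C j) *_) (zeroˡ X)) (zeroʳ (ι (n C j)))))
          (0≤* (0≤^ a 0≤½) (0≤bound r n))
        by-cases (yes j≤n-j) with ℕ.m≤n⇒∃[o]m+o≡n (ℕ.≤-trans (ℕ.m≤m+n (suc r) a) j≤n-j)
        ... | b , k+b≡n-j = ≡.subst₂ _≤_
            (≡.trans (≡.cong₂ (λ n l → ι (n C j) * (G ρ l * G ρ j)) (≡.sym n≡) k+b≡n-j)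
              (≡.cong (ι (n C j) *_) (≡.sym (*-identityˡ X))))
            (≡.cong₂ (λ n l → ½ ^ a * (ι (n C suc r) * (G ρ (suc r) * G ρ l))) (≡.sym n≡)
              (≡.trans (≡.sym (ℕ.m+n∸m≡n (suc r) (a ℕ.+ (suc r ℕ.+ b))))
                (≡.cong (ℕ._∸ suc r) (≡.trans (≡.sym (ℕ.+-assoc (suc r) a (suc r ℕ.+ b))) (≡.sym n≡)))))
            (split-bound (suc r) a b a≤b (ℕ.≤-trans (ℕ.m≤m+n (suc r) N₀) k+N₀≤b)
              (ℕ.≤-trans (ℕ.m≤n+m N₀ (suc r)) k+N₀≤b))
          where
          n≡ : n ≡ j ℕ.+ (suc r ℕ.+ b)
          n≡ = ≡.trans (≡.sym (ℕ.m+[n∸m]≡n (ℕ.≤-trans j≤n-j (ℕ.m∸n≤m n j))))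
            (≡.cong (j ℕ.+_) (≡.sym k+b≡n-j))
          a≤b : a ℕ.≤ b
          a≤b = ℕ.+-cancelˡ-≤ (suc r) a b (≡.subst (j ℕ.≤_) (≡.sym k+b≡n-j) j≤n-j)
          k+N₀≤b : suc r ℕ.+ N₀ ℕ.≤ b
          k+N₀≤b = ℕ.*-cancelˡ-≤ 2 (ℕ.+-cancelˡ-≤ (2 ℕ.* suc r) _ _ (ℕ.≤-trans
            (ℕ.≤-reflexive (ℕSolver.solve 2
              (λ k m → ℕSolver.con 2 ℕSolver.:* k ℕSolver.:+ ℕSolver.con 2 ℕSolver.:* (k ℕSolver.:+ m)
              ℕSolver.:= ℕSolver.con 4 ℕSolver.:* k ℕSolver.:+ ℕSolver.con 2 ℕSolver.:* m) ≡.refl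
                (suc r) N₀))
            (ℕ.≤-trans thr≤n (ℕ.≤-trans (ℕ.≤-reflexive n≡)
              (ℕ.≤-trans (ℕ.+-monoˡ-≤ (suc r ℕ.+ b) (ℕ.+-monoʳ-≤ (suc r) a≤b))
            (ℕ.≤-reflexive (ℕSolver.solve 2 (λ k b → (k ℕSolver.:+ b) ℕSolver.:+ (k ℕSolver.:+ b) ℕSolver.:=
              ℕSolver.con 2 ℕSolver.:* k ℕSolver.:+ ℕSolver.con 2 ℕSolver.:* b) ≡.refl (suc r) b)))))))

      large : ∀ r n → threshold r ℕ.≤ n → r ℕ.+ r ℕ.+ r ℕ.< n
      large r n thr≤n = ℕ.≤-trans (ℕ.≤-trans (ℕ.m≤m+n (suc (r ℕ.+ r ℕ.+ r)) (3 ℕ.+ r ℕ.+ 2 ℕ.* N₀))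
        (ℕ.≤-reflexive
        (ℕSolver.solve 2 (λ r m → (ℕSolver.con 1 ℕSolver.:+ (r ℕSolver.:+ r ℕSolver.:+ r)) ℕSolver.:+
          (ℕSolver.con 3 ℕSolver.:+ r ℕSolver.:+ ℕSolver.con 2 ℕSolver.:* m)
          ℕSolver.:= ℕSolver.con 4 ℕSolver.:*
            (ℕSolver.con 1 ℕSolver.:+ r) ℕSolver.:+ ℕSolver.con 2 ℕSolver.:* m) ≡.refl r N₀))) thr≤n

      0≤defect : ∀ r n → threshold r ℕ.≤ n → 0# ≤ defect ρ r n
      0≤defect r n thr≤n = a≤b⇒0≤b-a (principal≤G ρ 0≤ρ r n (large r n thr≤n))

      defect≤ : ∀ r n → threshold r ℕ.≤ n → defect ρ r n ≤ ι 2 * bound r n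
      defect≤ r n thr≤n = a≤b+c⇒a-b≤c (begin
        G ρ n
          ≤⟨ G≤principal+middle ρ 0≤ρ r n (large r n thr≤n) ⟩
        principal ρ r n + ∑ (upTo (n ℕ.∸ r)) (λ a → middleTerm ρ n (suc r ℕ.+ a))
          ≤⟨ +-monoʳ-≤ (principal ρ r n) (∑-mono (upTo (n ℕ.∸ r)) λ a → middleTerm≤ r n a thr≤n) ⟩
        principal ρ r n + ∑ (upTo (n ℕ.∸ r)) (λ a → ½ ^ a * bound r n)
          ≡⟨ ≡.cong (principal ρ r n +_) (∑-* (bound r n) (upTo (n ℕ.∸ r)) (½ ^_)) ⟨
        principal ρ r n + ∑ (upTo (n ℕ.∸ r)) (½ ^_) * bound r n
          ≤⟨ +-monoʳ-≤ (principal ρ r n) (*-monoʳ-≤ (bound r n) (0≤bound r n) (∑½^≤2 (n ℕ.∸ r))) ⟩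
        principal ρ r n + ι 2 * bound r n ∎)
        where open ≤-Reasoning

      error : ℕ → ℕ → Carrier
      error r n = ∑ (upTo (suc r)) λ j → ι (n C j) * (d ρ j * defect ρ (r ℕ.∸ j) (n ℕ.∸ j))

      module _ (r n : ℕ) (thr≤n : threshold r ℕ.≤ n) where

        private
          suc-r≤n : suc r ℕ.≤ n
          suc-r≤n = ℕ.≤-trans (ℕ.≤-trans (ℕ.m≤m+n (suc r) (3 ℕ.* suc r)) (ℕ.m≤m+n _ _)) thr≤n

          -- Lowering r by j lowers the threshold by 4 j, while its argument n drops only by j.
          thr-∸ : ∀ {j} → j ℕ.≤ r → threshold (r ℕ.∸ j) ℕ.≤ n ℕ.∸ j
          thr-∸ {j} j≤r = ℕ.≤-trans (ℕ.≤-reflexive (≡.sym (ℕ.m+n∸m≡n j _))) (ℕ.∸-monoˡ-≤ j (ℕ.≤-trans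
            (ℕ.≤-trans (ℕ.+-monoˡ-≤ (threshold (r ℕ.∸ j)) (ℕ.m≤m+n j (3 ℕ.* j))) (ℕ.≤-reflexive
              (≡.trans (solve 3 (λ j i m → con 4 :* j :+ (con 4 :* (con 1 :+ i) :+ con 2 :* m)
                := con 4 :* (con 1 :+ (j :+ i)) :+ con 2 :* m) ≡.refl j (r ℕ.∸ j) N₀)
                (≡.cong (λ x → 4 ℕ.* suc x ℕ.+ 2 ℕ.* N₀) (ℕ.m+[n∸m]≡n j≤r))))) thr≤n))
            where open ℕSolver

          -- The average of the two bounds assumed for x and - x.
          0≤∣∣ : ∀ x → 0# ≤ ∣ x ∣
          0≤∣∣ x = ≡.subst₂ _≤_ (-‿inverseʳ x) (≡.trans (≡.sym (distribˡ ∣ x ∣ ½ ½) )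
            (≡.trans (≡.cong (∣ x ∣ *_) ½+½≡1) (*-identityʳ _)))
            (half x)
            where
            half : ∀ x → x + - x ≤ ∣ x ∣ * ½ + ∣ x ∣ * ½
            half x = ≡.subst₂ _≤_
              (≡.trans (≡.sym (distribʳ ½ x (- x))) (≡.trans (≡.cong (_* ½) (-‿inverseʳ x))
                (≡.trans (zeroˡ ½) (≡.sym (-‿inverseʳ x)))))
              ≡.refl (+-mono-≤ (*-monoʳ-≤ ½ 0≤½ (≤∣ x ∣)) (*-monoʳ-≤ ½ 0≤½ (-≤∣ x ∣)))

          -- By `C-∸` every j gives a multiple of the same `base ρ (suc r) n`, although the
          -- truncation at n - j is lower. The factor x is `d ρ` or its negative, so that one proof
          -- yields both one-sided bounds.
          error-term : ∀ (x : ℕ → Carrier) → (∀ j → x j ≤ ∣ d ρ j ∣) → ∀ j → j ℕ.< suc r →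
            ι (n C j) * (x j * defect ρ (r ℕ.∸ j) (n ℕ.∸ j)) ≤
            ∣ d ρ j ∣ * (ι 2 * (ι (suc r C j) * G ρ (suc r ℕ.∸ j))) * base ρ (suc r) n
          error-term x x≤∣d∣ j j<1+r = begin
            ι (n C j) * (x j * defect ρ r′ n′)
              ≤⟨ *-monoˡ-≤ (ι (n C j)) (0≤ι (n C j)) (≤-trans
                   (*-monoʳ-≤ (defect ρ r′ n′) (0≤defect r′ n′ (thr-∸ j≤r)) (x≤∣d∣ j))
                   (*-monoˡ-≤ ∣ d ρ j ∣ (0≤∣∣ (d ρ j)) (defect≤ r′ n′ (thr-∸ j≤r)))) ⟩
            ι (n C j) * (∣ d ρ j ∣ * (ι 2 * (ι (n′ C suc r′) * (G ρ (suc r′) * G ρ (n′ ℕ.∸ suc r′)))))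
              ≡⟨ solve 6 (λ a b c e x y → a :* (b :* (c :* (e :* (x :* y)))) := (a :* e) :*
                (b :* (c :* (x :* y)))) ≡.refl
                   (ι (n C j)) ∣ d ρ j ∣ (ι 2) (ι (n′ C suc r′)) (G ρ (suc r′)) (G ρ (n′ ℕ.∸ suc r′)) ⟩
            ι (n C j) * ι (n′ C suc r′) * (∣ d ρ j ∣ * (ι 2 * (G ρ (suc r′) * G ρ (n′ ℕ.∸ suc r′))))
              ≡⟨ ≡.cong₂ (λ a k → ι (n C j) * ι (n′ C a) * (∣ d ρ j ∣ * (ι 2 * (G ρ a * G ρ k)))) suc-r′
                   (≡.trans (≡.cong (n′ ℕ.∸_) suc-r′) (≡.trans (ℕ.∸-+-assoc n j (suc r ℕ.∸ j))
                     (≡.cong (n ℕ.∸_) (ℕ.m+[n∸m]≡n j≤1+r)))) ⟩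
            ι (n C j) * ι (n′ C (suc r ℕ.∸ j)) * (∣ d ρ j ∣ *
              (ι 2 * (G ρ (suc r ℕ.∸ j) * G ρ (n ℕ.∸ suc r))))
              ≡⟨ ≡.cong (_* (∣ d ρ j ∣ * (ι 2 * (G ρ (suc r ℕ.∸ j) * G ρ (n ℕ.∸ suc r))))) (≡.trans
                   (≡.sym (ι-* (n C j) (n′ C (suc r ℕ.∸ j))))
                     (≡.trans (≡.cong ι (C-∸ j≤1+r suc-r≤n)) (ι-* (n C suc r) (suc r C j)))) ⟩
            ι (n C suc r) * ι (suc r C j) * (∣ d ρ j ∣ * (ι 2 * (G ρ (suc r ℕ.∸ j) * G ρ (n ℕ.∸ suc r))))
              ≡⟨ solve 6 (λ a e b c x y → (a :* e) :* (b :* (c :* (x :* y))) := b :* (c :* (e :* x)) :*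
                (a :* y)) ≡.refl
                   (ι (n C suc r)) (ι (suc r C j)) ∣ d ρ j ∣ (ι 2) (G ρ (suc r ℕ.∸ j)) (G ρ (n ℕ.∸ suc r)) ⟩
            ∣ d ρ j ∣ * (ι 2 * (ι (suc r C j) * G ρ (suc r ℕ.∸ j))) * base ρ (suc r) n ∎
            where
            open ≤-Reasoning
            open Solver
            r′ = r ℕ.∸ j
            n′ = n ℕ.∸ j
            j≤r : j ℕ.≤ r
            j≤r = ℕ.s≤s⁻¹ j<1+r
            j≤1+r : j ℕ.≤ suc r
            j≤1+r = ℕ.<⇒≤ j<1+r
            suc-r′ : suc r′ ≡ suc r ℕ.∸ j
            suc-r′ = ≡.sym (ℕ.+-∸-assoc 1 j≤r)

          ∑-mono-< : ∀ m {f g} → (∀ j → j ℕ.< m → f j ≤ g j) → ∑ (upTo m) f ≤ ∑ (upTo m) g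
          ∑-mono-< zero    f≤g = ≤-refl
          ∑-mono-< (suc m) {f} {g} f≤g = ≡.subst₂ _≤_ (≡.sym (∑-upTo-∷ʳ m f)) (≡.sym (∑-upTo-∷ʳ m g))
            (+-mono-≤ (∑-mono-< m λ j j<m → f≤g j (ℕ.m<n⇒m<1+n j<m)) (f≤g m ℕ.≤-refl))

          errors : ∀ (x : ℕ → Carrier) → (∀ j → x j ≤ ∣ d ρ j ∣) →
            ∑ (upTo (suc r)) (λ j → ι (n C j) * (x j * defect ρ (r ℕ.∸ j)
              (n ℕ.∸ j))) ≤ errorConstant ρ r * base ρ (suc r) n
          errors x x≤∣d∣ = ≤-trans (∑-mono-< (suc r) (error-term x x≤∣d∣))
            (≤-reflexive (≡.sym (∑-* (base ρ (suc r) n) (upTo (suc r)) _)))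

        error≤ : error r n ≤ errorConstant ρ r * base ρ (suc r) n
        error≤ = errors (d ρ) (λ j → ≤∣ d ρ j ∣)

        -error≤ : - error r n ≤ errorConstant ρ r * base ρ (suc r) n
        -error≤ = ≡.subst (_≤ errorConstant ρ r * base ρ (suc r) n)
          (≡.trans (∑-cong (upTo (suc r)) λ j → *-neg-* (ι (n C j)) (d ρ j) (defect ρ (r ℕ.∸ j) (n ℕ.∸ j)))
            (≡.trans (≡.sym (*-∑ (- 1#) (upTo (suc r)) _)) (-1*x≈-x (error r n))))
          (errors (λ j → - d ρ j) (λ j → -≤∣ d ρ j ∣))

        expansion-error : expansion ρ r n ≡ connectedWeight ρ n + error r n
        expansion-error = expansion≡ ρ r n (ℕ.≤-trans (ℕ.n≤1+n r) suc-r≤n)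

  -- From the weights ρ and 1 to the probabilities p and q

  module _ (p q s : Carrier) (qs≡1 : q * s ≡ 1#) (p+q≡1 : p + q ≡ 1#) where

    private
      ρ = p * s

    1+ρ≡s : 1# + ρ ≡ s
    1+ρ≡s = ≡.trans (+-comm 1# ρ) (≡.trans (≡.cong (ρ +_) (≡.sym qs≡1))
      (≡.trans (≡.sym (distribʳ s p q)) (≡.trans (≡.cong (_* s) p+q≡1) (*-identityˡ s))))

    qρ≡p : q * ρ ≡ p
    qρ≡p = ≡.trans (≡.cong (q *_) (*-comm p s)) (≡.trans (≡.sym (*-assoc q s p))
      (≡.trans (≡.cong (_* p) qs≡1) (*-identityˡ p)))

    q^*s^≡1 : ∀ m → q ^ m * s ^ m ≡ 1#
    q^*s^≡1 zero    = *-identityˡ 1#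
    q^*s^≡1 (suc m) = ≡.trans (solve 4 (λ q x s y → (q :* x) :* (s :* y) := (q :* s) :*
      (x :* y)) ≡.refl q (q ^ m) s (s ^ m))
      (≡.trans (≡.cong₂ _*_ qs≡1 (q^*s^≡1 m)) (*-identityˡ 1#))
      where open Solver

    connectedProbability≡ : ∀ n → strongTotal (graphWeight p q) n ≡ q ^ triangular n * connectedWeight ρ n
    connectedProbability≡ = strongTotal-scale q λ where
      (true  , true)  → ≡.sym qρ≡p
      (false , false) → ≡.sym (*-identityʳ q)
      (true  , false) → ≡.sym (zeroʳ q)
      (false , true)  → ≡.sym (zeroʳ q)

    scale : ℕ → ℕ → Carrier
    scale k n = ι (n C k) * (q ^ (n ℕ.* k) * s ^ (k ℕ.* (k ℕ.+ 1) ℕ./ 2))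

    -- With m = n - k both sides are the binomial times q ^ e, where e = `triangular k` + k m equals
    -- n k - k (k + 1) / 2 and also `triangular n` - `triangular m`; multiplication by powers of s,
    -- the inverse of q, takes the place of subtraction.
    scale≡ : ∀ {k n} → k ℕ.≤ n → scale k n ≡ q ^ triangular n * base ρ k n
    scale≡ {k} {n} k≤n with ℕ.m≤n⇒∃[o]m+o≡n k≤n
    ... | m , ≡.refl = begin
      ι c * (q ^ ((k ℕ.+ m) ℕ.* k) * s ^ (k ℕ.* (k ℕ.+ 1) ℕ./ 2))
        ≡⟨ ≡.cong (λ x → ι c * x) (cancel ((k ℕ.+ m) ℕ.* k) (k ℕ.* (k ℕ.+ 1) ℕ./ 2) e e₁) ⟩
      ι c * q ^ e
        ≡⟨ ≡.cong (λ x → ι c * x) (cancel (triangular (k ℕ.+ m)) (triangular (k ℕ.+ m ℕ.∸ k)) e e₂) ⟨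
      ι c * (q ^ triangular (k ℕ.+ m) * s ^ triangular (k ℕ.+ m ℕ.∸ k))
        ≡⟨ solve 3 (λ a b c → a :* (b :* c) := b :* (a :* c)) ≡.refl (ι c) (q ^ triangular (k ℕ.+ m))
          (s ^ triangular (k ℕ.+ m ℕ.∸ k)) ⟩
      q ^ triangular (k ℕ.+ m) * (ι c * s ^ triangular (k ℕ.+ m ℕ.∸ k))
        ≡⟨ ≡.cong (λ x → q ^ triangular (k ℕ.+ m) * (ι c * x ^ triangular (k ℕ.+ m ℕ.∸ k))) 1+ρ≡s ⟨
      q ^ triangular (k ℕ.+ m) * base ρ k (k ℕ.+ m) ∎
      where
      open ≡.≡-Reasoning
      open Solver
      c = (k ℕ.+ m) C k
      e = triangular k ℕ.+ k ℕ.* m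
      cancel : ∀ a b e → a ≡ e ℕ.+ b → q ^ a * s ^ b ≡ q ^ e
      cancel a b e ≡.refl = ≡.trans (≡.cong (_* s ^ b) (^-homo-* q e b))
        (≡.trans (*-assoc (q ^ e) (q ^ b) (s ^ b))
        (≡.trans (≡.cong (q ^ e *_) (q^*s^≡1 b)) (*-identityʳ (q ^ e))))
      e₁ : (k ℕ.+ m) ℕ.* k ≡ e ℕ.+ k ℕ.* (k ℕ.+ 1) ℕ./ 2
      e₁ = ≡.trans (ℕ.*-distribʳ-+ k k m) (≡.trans (≡.cong₂ ℕ._+_ (square k) (ℕ.*-comm m k))
        (≡.trans (ℕSolver.solve 3
          (λ a b c → a ℕSolver.:+ b ℕSolver.:+ c ℕSolver.:= a ℕSolver.:+ c ℕSolver.:+ b) ≡.refl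
          (triangular k) (triangular (suc k)) (k ℕ.* m))
          (≡.cong (e ℕ.+_) (≡.sym (triangular-suc k)))))
      e₂ : triangular (k ℕ.+ m) ≡ e ℕ.+ triangular (k ℕ.+ m ℕ.∸ k)
      e₂ = ≡.trans (triangular-+ k m) (≡.trans
        (ℕSolver.solve 3 (λ a b c →
          a ℕSolver.:+ b ℕSolver.:+ c ℕSolver.:= a ℕSolver.:+ c ℕSolver.:+ b) ≡.refl (triangular k)
          (triangular m) (k ℕ.* m))
        (≡.cong (λ x → e ℕ.+ triangular x) (≡.sym (ℕ.m+n∸m≡n k m))))

    expansion-scale : ∀ r n → suc r ℕ.≤ n →
      ∑ (upTo (suc r)) (λ k → d ρ k * scale k n) ≡ q ^ triangular n * expansion ρ r n
    expansion-scale r n r<n = ≡.trans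
      (∑-cong-< (suc r) λ k k≤r → ≡.trans (≡.cong (d ρ k *_) (scale≡ (ℕ.≤-trans (ℕ.s≤s⁻¹ k≤r) (ℕ.<⇒≤ r<n))))
        (solve 4 (λ d w c g → d :* (w :* (c :* g)) := w :* (c :* (d :* g))) ≡.refl (d ρ k)
          (q ^ triangular n) (ι (n C k)) (G ρ (n ℕ.∸ k))))
      (≡.sym (*-∑ (q ^ triangular n) (upTo (suc r)) _))
      where open Solver

    -- One more vertex costs a factor at most n and gains s ^ b with b = n - k - 1. The condition on
    -- n gives b ≥ k + 1, hence n ≤ 2 b, and b ≥ N, hence 2 b ≤ ε K b ≤ ε s ^ b.
    scale-suc≤ : 0# ≤ q → 0# ≤ s → ∀ ε K N → 0# ≤ ε → ι 2 ≤ ε * ι K → (∀ b → N ℕ.≤ b → ι K * ι b ≤ s ^ b) →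
      ∀ k n → N ℕ.+ 2 ℕ.* suc k ℕ.≤ n → scale (suc k) n ≤ ε * scale k n
    scale-suc≤ 0≤q 0≤s ε K N 0≤ε 2≤εK exp k n N≤n = begin
      scale (suc k) n
        ≡⟨ scale≡ k<n ⟩
      q ^ triangular n * (ι (n C suc k) * G ρ b)
        ≤⟨ *-monoˡ-≤ (q ^ triangular n) (0≤^ (triangular n) 0≤q) (*-monoʳ-≤ (G ρ b) 0≤G (begin
             ι (n C suc k)                 ≤⟨ ι-mono-≤ (C-suc-≤ n k) ⟩
             ι (n ℕ.* (n C k))             ≡⟨ ι-* n (n C k) ⟩
             ι n * ι (n C k)               ≤⟨ *-monoʳ-≤ (ι (n C k)) (0≤ι (n C k)) n≤ ⟩
             ε * s ^ b * ι (n C k)         ∎)) ⟩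
      q ^ triangular n * (ε * s ^ b * ι (n C k) * G ρ b)
        ≡⟨ solve 5 (λ w e x c g → w :* (e :* x :* c :* g) := e :* (w :* (c :* (x :* g)))) ≡.refl
          (q ^ triangular n) ε (s ^ b) (ι (n C k)) (G ρ b) ⟩
      ε * (q ^ triangular n * (ι (n C k) * (s ^ b * G ρ b)))
        ≡⟨ ≡.cong (λ x → ε * (q ^ triangular n * (ι (n C k) * x))) G-suc ⟩
      ε * (q ^ triangular n * base ρ k n)
        ≡⟨ ≡.cong (ε *_) (scale≡ (ℕ.<⇒≤ k<n)) ⟨
      ε * scale k n ∎
      where
      open ≤-Reasoning
      open Solver
      b = n ℕ.∸ suc k
      2k<n : 2 ℕ.* suc k ℕ.≤ n
      2k<n = ℕ.≤-trans (ℕ.m≤n+m _ N) N≤n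
      k<n : suc k ℕ.≤ n
      k<n = ℕ.≤-trans (ℕ.m≤m+n (suc k) _) 2k<n
      n≡ : suc k ℕ.+ b ≡ n
      n≡ = ℕ.m+[n∸m]≡n k<n
      k<b : suc k ℕ.≤ b
      k<b = ℕ.+-cancelˡ-≤ (suc k) (suc k) b (ℕ.≤-trans
        (ℕ.≤-reflexive (≡.cong (suc k ℕ.+_) (≡.sym (ℕ.+-identityʳ (suc k)))))
        (ℕ.≤-trans 2k<n (ℕ.≤-reflexive (≡.sym n≡))))
      N≤b : N ℕ.≤ b
      N≤b = ℕ.+-cancelˡ-≤ (suc k) N b (ℕ.≤-trans (ℕ.≤-reflexive (ℕ.+-comm (suc k) N))
        (ℕ.≤-trans (ℕ.+-monoʳ-≤ N (ℕ.m≤m+n (suc k) _)) (ℕ.≤-trans N≤n (ℕ.≤-reflexive (≡.sym n≡)))))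
      0≤G : 0# ≤ G ρ b
      0≤G = 0≤^ (triangular b) (≡.subst (0# ≤_) (≡.sym 1+ρ≡s) 0≤s)
      n≤ : ι n ≤ ε * s ^ b
      n≤ = begin
        ι n                        ≤⟨ ι-mono-≤ (ℕ.≤-trans (ℕ.≤-reflexive (≡.sym n≡)) (ℕ.+-monoˡ-≤ b k<b)) ⟩
        ι (b ℕ.+ b)                ≡⟨ ≡.cong (λ x → ι (b ℕ.+ x)) (ℕ.+-identityʳ b) ⟨
        ι (2 ℕ.* b)                ≡⟨ ι-* 2 b ⟩
        ι 2 * ι b                  ≤⟨ *-monoʳ-≤ (ι b) (0≤ι b) 2≤εK ⟩
        ε * ι K * ι b              ≡⟨ *-assoc ε (ι K) (ι b) ⟩
        ε * (ι K * ι b)            ≤⟨ *-monoˡ-≤ ε 0≤ε (exp b N≤b) ⟩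
        ε * s ^ b                  ∎
      G-suc : s ^ b * G ρ b ≡ G ρ (n ℕ.∸ k)
      G-suc = ≡.trans (≡.cong (λ x → x ^ b * G ρ b) (≡.sym 1+ρ≡s))
        (≡.trans (≡.sym (^-homo-* (1# + ρ) b (triangular b)))
        (≡.cong (G ρ) (≡.trans (≡.sym (ℕ.m+n∸m≡n k (suc b))) (≡.cong (ℕ._∸ k) (≡.trans (ℕ.+-suc k b) n≡)))))

-- Rational sequences and real numbers

open import Defs
open import Data.Integer as ℤ using (+_)
import Data.Integer.Properties as ℤ
open import Data.Rational as ℚ using (ℚ; 0ℚ; 1ℚ; ½)
import Data.Rational.Properties as ℚ
open import Data.Rational.Solver using (module +-*-Solver)
import Data.Rational.Unnormalised as ℚᵘ
import Data.Rational.Unnormalised.Properties as ℚᵘ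
open import Function.Bundles using (_⇔_; mk⇔)

0≤*ℚ : ∀ {a b} → 0ℚ ℚ.≤ a → 0ℚ ℚ.≤ b → 0ℚ ℚ.≤ a ℚ.* b
0≤*ℚ {a} {b} 0≤a 0≤b = ℚ.nonNegative⁻¹ (a ℚ.* b)
  {{ℚ.nonNeg*nonNeg⇒nonNeg a {{ℚ.nonNegative 0≤a}} b {{ℚ.nonNegative 0≤b}}}}

ℚ-orderedRing : OrderedRing
ℚ-orderedRing = record
  { Carrier           = ℚ
  ; _≤_               = ℚ._≤_
  ; _+_               = ℚ._+_
  ; _*_               = ℚ._*_
  ; -_                = ℚ.-_
  ; 0#                = 0ℚ
  ; 1#                = 1ℚ
  ; isCommutativeRing = ℚ.+-*-isCommutativeRing
  ; isPartialOrder    = ℚ.≤-isPartialOrder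
  ; +-mono-≤          = ℚ.+-mono-≤
  ; 0≤1               = ℚ.nonNegative⁻¹ 1ℚ
  ; 0≤*               = 0≤*ℚ
  }

module ℚR = Ordered ℚ-orderedRing
module ℚΣ = Weighted (OrderedRing.commutativeSemiring ℚ-orderedRing)

/1-suc : ∀ n → (+ suc n) ℚ./ 1 ≡ 1ℚ ℚ.+ (+ n ℚ./ 1)
/1-suc n = ℚ.toℚᵘ-injective (begin
  ℚ.toℚᵘ (+ suc n ℚ./ 1)                            ≈⟨ ℚ.toℚᵘ-fromℚᵘ (ℚᵘ.mkℚᵘ (+ suc n) 0) ⟩
  ℚᵘ.mkℚᵘ (+ suc n) 0                               ≈⟨ ℚᵘ.*≡*
    (≡.cong (ℤ._* + 1) (≡.sym (≡.cong (λ x → + 1 ℤ.+ x) (ℤ.*-identityʳ (+ n))))) ⟩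
  ℚᵘ.mkℚᵘ (+ 1) 0 ℚᵘ.+ ℚᵘ.mkℚᵘ (+ n) 0              ≈⟨ ℚᵘ.+-cong (ℚ.toℚᵘ-fromℚᵘ (ℚᵘ.mkℚᵘ (+ 1) 0))
    (ℚ.toℚᵘ-fromℚᵘ (ℚᵘ.mkℚᵘ (+ n) 0)) ⟨
  ℚ.toℚᵘ 1ℚ ℚᵘ.+ ℚ.toℚᵘ (+ n ℚ./ 1)                 ≈⟨ ℚ.toℚᵘ-homo-+ 1ℚ (+ n ℚ./ 1) ⟨
  ℚ.toℚᵘ (1ℚ ℚ.+ (+ n ℚ./ 1))                       ∎)
  where open ℚᵘ.≃-Reasoning

ι≡/1 : ∀ n → ℚR.ι n ≡ + n ℚ./ 1
ι≡/1 zero    = ≡.refl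
ι≡/1 (suc n) = ≡.trans (≡.cong (1ℚ ℚ.+_) (ι≡/1 n)) (≡.sym (/1-suc n))

archimedean : ∀ x → ∃ λ n → x ℚ.≤ ℚR.ι n
archimedean x@(ℚ.mkℚ i e _) = ℤ.∣ i ∣ , ≡.subst (x ℚ.≤_) (≡.sym (ι≡/1 ℤ.∣ i ∣)) (ℚ.toℚᵘ-cancel-≤ (begin
  ℚ.toℚᵘ x                       ≤⟨ ℚᵘ.*≤* (≡.subst (ℤ._≤ + ℤ.∣ i ∣ ℤ.* + suc e)
    (≡.sym (ℤ.*-identityʳ i)) (bound i)) ⟩
  ℚᵘ.mkℚᵘ (+ ℤ.∣ i ∣) 0          ≃⟨ ℚ.toℚᵘ-fromℚᵘ (ℚᵘ.mkℚᵘ (+ ℤ.∣ i ∣) 0) ⟨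
  ℚ.toℚᵘ (+ ℤ.∣ i ∣ ℚ./ 1)       ∎))
  where
  open ℚᵘ.≤-Reasoning
  bound : ∀ i → i ℤ.≤ + ℤ.∣ i ∣ ℤ.* + suc e
  bound (+ n)        = ≡.subst (+ n ℤ.≤_) (ℤ.pos-* n (suc e)) (ℤ.+≤+ (ℕ.m≤m*n n (suc e)))
  bound ℤ.-[1+ n ]   = ≡.subst (ℤ.-[1+ n ] ℤ.≤_) (ℤ.pos-* (suc n) (suc e)) ℤ.-≤+

*-recip : ∀ a → 0ℚ ℚ.< a → a ℚ.* recip a ≡ 1ℚ
*-recip a 0<a with a ℚ.≟ 0ℚ
... | yes a≡0 = contradiction (≡.sym a≡0) (ℚ.<⇒≢ 0<a)
... | no a≢0 = ℚ.*-inverseʳ a {{ℚ.≢-nonZero a≢0}}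

0<recip : ∀ a → 0ℚ ℚ.< a → 0ℚ ℚ.< recip a
0<recip a 0<a with a ℚ.≟ 0ℚ
... | yes a≡0 = contradiction (≡.sym a≡0) (ℚ.<⇒≢ 0<a)
... | no a≢0 = ℚ.positive⁻¹ _ {{ℚ.1/pos⇒pos a {{ℚ.positive 0<a}}}}

0<* : ∀ {a b} → 0ℚ ℚ.< a → 0ℚ ℚ.< b → 0ℚ ℚ.< a ℚ.* b
0<* {a} {b} 0<a 0<b = ℚ.positive⁻¹ _ {{ℚ.pos*pos⇒pos a {{ℚ.positive 0<a}} b {{ℚ.positive 0<b}}}}

archimedean-* : ∀ x y → 0ℚ ℚ.< y → ∃ λ N → ∀ n → N ℕ.≤ n → x ℚ.≤ ℚR.ι n ℚ.* y
archimedean-* x y 0<y with archimedean (x ℚ.* recip y)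
... | N , x/y≤N = N , λ n N≤n → ≡.subst (ℚ._≤ ℚR.ι n ℚ.* y)
  (≡.trans (ℚ.*-assoc x (recip y) y) (≡.trans (≡.cong (x ℚ.*_)
    (≡.trans (ℚ.*-comm (recip y) y) (*-recip y 0<y))) (ℚ.*-identityʳ x)))
  (ℚR.*-monoʳ-≤ y (ℚ.<⇒≤ 0<y) (ℚ.≤-trans x/y≤N (ℚR.ι-mono-≤ N≤n)))

-- N is chosen from δ and K, before s. This uniformity lets one threshold for n serve almost all
-- terms of the Cauchy sequence at once.
exponential-bound : ∀ {δ} → 0ℚ ℚ.< δ → ∀ K → ∃ λ N → ∀ s → 1ℚ ℚ.+ δ ℚ.≤ s →
  ∀ b → N ℕ.≤ b → ℚR.ι K ℚ.* ℚR.ι b ℚ.≤ s ℚR.^ b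
exponential-bound {δ} 0<δ K with archimedean-* (ℚR.ι (3 ℕ.* K)) (δ ℚ.* δ) (0<* 0<δ 0<δ)
... | M , large = 2 ℕ.+ 2 ℕ.* M , λ s 1+δ≤s b N≤b → ℚR.linear≤exponential K M
  (ℚ.<⇒≤ 0<δ) large b N≤b s 1+δ≤s

≤∣∣ : ∀ x → x ℚ.≤ ℚ.∣ x ∣
≤∣∣ x with ℚ.≤-total 0ℚ x
... | inj₁ 0≤x = ℚ.≤-reflexive (≡.sym (ℚ.0≤p⇒∣p∣≡p 0≤x))
... | inj₂ x≤0 = ℚ.≤-trans x≤0 (ℚ.0≤∣p∣ x)

-≤∣∣ : ∀ x → ℚ.- x ℚ.≤ ℚ.∣ x ∣
-≤∣∣ x = ≡.subst (ℚ.- x ℚ.≤_) (ℚ.∣-p∣≡∣p∣ x) (≤∣∣ (ℚ.- x))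

∣∣≤ : ∀ {x y} → x ℚ.≤ y → ℚ.- x ℚ.≤ y → ℚ.∣ x ∣ ℚ.≤ y
∣∣≤ {x} {y} x≤y -x≤y with ℚ.∣p∣≡p∨∣p∣≡-p x
... | inj₁ eq = ≡.subst (ℚ._≤ y) (≡.sym eq) x≤y
... | inj₂ eq = ≡.subst (ℚ._≤ y) (≡.sym eq) -x≤y

-- Terms of the real numbers that occur in the statement

module _ {A : Set} (f : A → ℝ) (m : ℕ) where

  seq-sum : ∀ xs → seq (sum (List.map f xs)) m ≡ ℚΣ.∑ xs (λ x → seq (f x) m)
  seq-sum []       = ≡.refl
  seq-sum (x ∷ xs) = ≡.cong (seq (f x) m ℚ.+_) (seq-sum xs)

  seq-product : ∀ xs → seq (product (List.map f xs)) m ≡ ℚΣ.∏.⨁ xs (λ x → seq (f x) m)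
  seq-product []       = ≡.refl
  seq-product (x ∷ xs) = ≡.cong (seq (f x) m ℚ.*_) (seq-product xs)

seq-^ : ∀ x n m → seq (x ^ n) m ≡ seq x m ℚR.^ n
seq-^ x zero    m = ≡.refl
seq-^ x (suc n) m = ≡.cong (seq x m ℚ.*_) (seq-^ x n m)

seq-if : ∀ b x y m → seq (if b then x else y) m ≡ (if b then seq x m else seq y m)
seq-if true  x y m = ≡.refl
seq-if false x y m = ≡.refl

seq-ℙ : ∀ n p m → seq (ℙ[G n , p ∈ connected? ]) m ≡
  ℚΣ.strongTotal (ℚΣ.graphWeight (seq p m) (seq (1ℝ - p) m)) n
seq-ℙ n p m = ≡.trans (seq-sum (graphProbability p) m (filter connected? (graphs n)))
  (≡.trans (ℚΣ.∑-cong (filter connected? (graphs n)) λ A → ≡.trans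
      (seq-product (λ (i , j) → if adj A i j then p else 1ℝ - p) m (pairs n))
      (ℚΣ.∏.⨁-cong (pairs n) λ (i , j) → seq-if (adj A i j) p (1ℝ - p) m))
    (ℚΣ.connectedGraphs (seq p m) (seq (1ℝ - p) m) n))

seq-P : ∀ k ρ m → seq (P k ρ) m ≡ ℚR.irreducibleWeight (seq ρ m) k
seq-P k ρ m = ≡.trans (seq-sum (weight ρ) m (irreducibleTournaments k))
  (≡.trans (ℚΣ.∑-cong (irreducibleTournaments k) λ t → seq-^ (ρ - 1ℝ) (ties t) m)
    (ℚΣ.irreducibleTournaments≈ (seq ρ m ℚ.+ ℚ.- 1ℚ) k))

seq-coefficient : ∀ k ρ m → seq (coefficient ρ k) m ≡ ℚR.d (seq ρ m) k
seq-coefficient zero    ρ m = ≡.refl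
seq-coefficient (suc k) ρ m = ≡.cong (ℚ.-_) (seq-P (suc k) ρ m)

½+½≡1 : ½ ℚ.+ ½ ≡ 1ℚ
½+½≡1 = ≡.refl

0≤½ : 0ℚ ℚ.≤ ½
0≤½ = ℚ.nonNegative⁻¹ ½

module ℚE = ℚR.Estimates ½ 0≤½ ½+½≡1 ℚ.∣_∣ ≤∣∣ -≤∣∣

-- The bounds that hold for almost all terms of the Cauchy sequence of p.
record Admissible (α β a : ℚ) : Set where
  field
    0<α : 0ℚ ℚ.< α
    0<β : 0ℚ ℚ.< β
    α≤p : α ℚ.≤ a
    β≤q : β ℚ.≤ 1ℚ ℚ.+ ℚ.- a

module _ {α β a : ℚ} (adm : Admissible α β a) where
  open Admissible adm

  private
    b = 1ℚ ℚ.+ ℚ.- a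
    s = recip b

  0≤p : 0ℚ ℚ.≤ a
  0≤p = ℚ.≤-trans (ℚ.<⇒≤ 0<α) α≤p

  0<q : 0ℚ ℚ.< b
  0<q = ℚ.<-≤-trans 0<β β≤q

  0≤q : 0ℚ ℚ.≤ b
  0≤q = ℚ.<⇒≤ 0<q

  0≤s : 0ℚ ℚ.≤ s
  0≤s = ℚ.<⇒≤ (0<recip b 0<q)

  qs≡1 : b ℚ.* s ≡ 1ℚ
  qs≡1 = *-recip b 0<q

  p+q≡1 : a ℚ.+ b ≡ 1ℚ
  p+q≡1 = solve 1 (λ a → a :+ (con 1ℚ :+ (:- a)) := con 1ℚ) ≡.refl a
    where open +-*-Solver

  q≤1 : b ℚ.≤ 1ℚ
  q≤1 = ≡.subst₂ ℚ._≤_ (ℚ.+-identityˡ b) p+q≡1 (ℚ.+-monoˡ-≤ b 0≤p)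

  1≤s : 1ℚ ℚ.≤ s
  1≤s = ≡.subst₂ ℚ._≤_ qs≡1 (ℚ.*-identityˡ s) (ℚR.*-monoʳ-≤ s 0≤s q≤1)

  α≤ρ : α ℚ.≤ a ℚ.* s
  α≤ρ = ℚ.≤-trans α≤p (≡.subst (ℚ._≤ a ℚ.* s) (ℚ.*-identityʳ a) (ℚR.*-monoˡ-≤ a 0≤p 1≤s))

  0≤ρ : 0ℚ ℚ.≤ a ℚ.* s
  0≤ρ = ℚ.≤-trans (ℚ.<⇒≤ 0<α) α≤ρ

  qρ≡p : b ℚ.* (a ℚ.* s) ≡ a
  qρ≡p = ℚR.qρ≡p a b s qs≡1 p+q≡1

  1+α≤1+ρ : 1ℚ ℚ.+ α ℚ.≤ 1ℚ ℚ.+ a ℚ.* s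
  1+α≤1+ρ = ℚ.+-monoʳ-≤ 1ℚ α≤ρ

  scale : ℕ → ℕ → ℚ
  scale = ℚR.scale a b s qs≡1 p+q≡1

  0≤scale : ∀ k n → 0ℚ ℚ.≤ scale k n
  0≤scale k n = 0≤*ℚ (ℚR.0≤ι (n C k)) (0≤*ℚ (ℚR.0≤^ (n ℕ.* k) 0≤q) (ℚR.0≤^ (k ℕ.* (k ℕ.+ 1) ℕ./ 2) 0≤s))

  ∣scale∣ : ∀ k n → ℚ.∣ scale k n ∣ ≡ scale k n
  ∣scale∣ k n = ℚ.0≤p⇒∣p∣≡p (0≤scale k n)

  constant : ℕ → ℚ
  constant = ℚE.errorConstant (a ℚ.* s)

  -- The difference is minus the error of the weighted expansion times q ^ `triangular n`. Both
  -- one-sided bounds for the error are needed for its absolute value, and the common factor turns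
  -- `base` into `scale`.
  expansion-bound : ∀ N₀ → (∀ t → 1ℚ ℚ.+ α ℚ.≤ t → ∀ c → N₀ ℕ.≤ c → ℚR.ι 8 ℚ.* ℚR.ι c ℚ.≤ t ℚR.^ c) →
    ∀ r n → 4 ℕ.* suc r ℕ.+ 2 ℕ.* N₀ ℕ.≤ n →
    ℚ.∣ ℚΣ.strongTotal (ℚΣ.graphWeight a b) n ℚ.+ ℚ.- ℚΣ.∑ (upTo (suc r))
      (λ k → ℚR.d (a ℚ.* s) k ℚ.* scale k n) ∣ ℚ.≤
    constant r ℚ.* scale (suc r) n
  expansion-bound N₀ exp r n thr≤n = ∣∣≤ (bounded negated upper) (bounded plain lower)
    where
    ρ = a ℚ.* s
    E = ℚE.error ρ 0≤ρ N₀ (exp (1ℚ ℚ.+ ρ) 1+α≤1+ρ) r n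
    upper : ℚ.- E ℚ.≤ constant r ℚ.* ℚR.base ρ (suc r) n
    upper = ℚE.-error≤ ρ 0≤ρ N₀ (exp (1ℚ ℚ.+ ρ) 1+α≤1+ρ) r n thr≤n
    lower : E ℚ.≤ constant r ℚ.* ℚR.base ρ (suc r) n
    lower = ℚE.error≤ ρ 0≤ρ N₀ (exp (1ℚ ℚ.+ ρ) 1+α≤1+ρ) r n thr≤n
    r<n : suc r ℕ.≤ n
    r<n = ℕ.≤-trans (ℕ.≤-trans (ℕ.m≤m+n (suc r) (3 ℕ.* suc r)) (ℕ.m≤m+n _ _)) thr≤n
    w = b ℚR.^ triangular n
    X = ℚΣ.strongTotal (ℚΣ.graphWeight a b) n
    Y = ℚΣ.∑ (upTo (suc r)) (λ k → ℚR.d ρ k ℚ.* scale k n)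
    c = ℚR.connectedWeight ρ n
    Y≡ : Y ≡ w ℚ.* (c ℚ.+ E)
    Y≡ = ≡.trans (ℚR.expansion-scale a b s qs≡1 p+q≡1 r n r<n) (≡.cong (w ℚ.*_)
      (ℚE.expansion-error ρ 0≤ρ N₀ (exp (1ℚ ℚ.+ ρ) 1+α≤1+ρ) r n thr≤n))
    X≡ : X ≡ w ℚ.* c
    X≡ = ℚR.connectedProbability≡ a b s qs≡1 p+q≡1 n
    open +-*-Solver
    negated : X ℚ.+ ℚ.- Y ≡ w ℚ.* ℚ.- E
    negated = ≡.trans (≡.cong₂ (λ x y → x ℚ.+ ℚ.- y) X≡ Y≡)
      (solve 3 (λ w c e → w :* c :+ (:- (w :* (c :+ e))) := w :* (:- e)) ≡.refl w c E)
    plain : ℚ.- (X ℚ.+ ℚ.- Y) ≡ w ℚ.* E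
    plain = ≡.trans (≡.cong₂ (λ x y → ℚ.- (x ℚ.+ ℚ.- y)) X≡ Y≡)
      (solve 3 (λ w c e → :- (w :* c :+ (:- (w :* (c :+ e)))) := w :* e) ≡.refl w c E)
    bounded : ∀ {x y} → x ≡ w ℚ.* y → y ℚ.≤ constant r ℚ.* ℚR.base ρ (suc r) n →
      x ℚ.≤ constant r ℚ.* scale (suc r) n
    bounded {x} {y} x≡ y≤ = ≡.subst₂ ℚ._≤_ (≡.sym x≡)
      (≡.trans (solve 3 (λ w k u → w :* (k :* u) := k :* (w :* u)) ≡.refl w (constant r)
        (ℚR.base ρ (suc r) n))
        (≡.cong (constant r ℚ.*_) (≡.sym (ℚR.scale≡ a b s qs≡1 p+q≡1 r<n))))
      (ℚR.*-monoˡ-≤ w (ℚR.0≤^ (triangular n) 0≤q) y≤)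

-- For x ≤ 0 the hypotheses give |x| ≤ e ≤ 1, so every positive power has absolute value at most e,
-- whatever its sign; the power 0 is 1.
power-lower-bound : ∀ {e x} → 0ℚ ℚ.≤ e → e ℚ.≤ 1ℚ → ℚ.- e ℚ.≤ x → ∀ k → ℚ.- e ℚ.≤ x ℚR.^ k
power-lower-bound {e} {x} 0≤e e≤1 -e≤x k with ℚ.≤-total 0ℚ x
... | inj₁ 0≤x = ℚ.≤-trans (ℚ.neg-antimono-≤ 0≤e) (ℚR.0≤^ k 0≤x)
... | inj₂ x≤0 = go k
  where
  ∣x∣≤e : ℚ.∣ x ∣ ℚ.≤ e
  ∣x∣≤e = ∣∣≤ (ℚ.≤-trans x≤0 0≤e) (≡.subst (ℚ.- x ℚ.≤_) (solve 1 (λ e → :- (:- e) := e) ≡.refl e)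
    (ℚ.neg-antimono-≤ -e≤x))
    where open +-*-Solver
  ∣x^k∣≤1 : ∀ k → ℚ.∣ x ℚR.^ k ∣ ℚ.≤ 1ℚ
  ∣x^k∣≤1 zero    = ℚ.≤-refl
  ∣x^k∣≤1 (suc k) = ≡.subst₂ ℚ._≤_ (≡.sym (ℚ.∣p*q∣≡∣p∣*∣q∣ x (x ℚR.^ k))) (ℚ.*-identityˡ 1ℚ)
    (ℚR.*-mono-≤ (ℚ.nonNegative⁻¹ 1ℚ) (ℚ.0≤∣p∣ (x ℚR.^ k)) (ℚ.≤-trans ∣x∣≤e e≤1) (∣x^k∣≤1 k))
  ∣x^1+k∣≤e : ∀ k → ℚ.∣ x ℚR.^ suc k ∣ ℚ.≤ e
  ∣x^1+k∣≤e k = ≡.subst₂ ℚ._≤_ (≡.sym (ℚ.∣p*q∣≡∣p∣*∣q∣ x (x ℚR.^ k))) (ℚ.*-identityʳ e)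
    (ℚR.*-mono-≤ 0≤e (ℚ.0≤∣p∣ (x ℚR.^ k)) ∣x∣≤e (∣x^k∣≤1 k))
  go : ∀ k → ℚ.- e ℚ.≤ x ℚR.^ k
  go zero    = ℚ.≤-trans (ℚ.neg-antimono-≤ 0≤e) (ℚ.nonNegative⁻¹ 1ℚ)
  go (suc k) = ≡.subst (ℚ.- e ℚ.≤_) (solve 1 (λ y → :- (:- y) := y) ≡.refl (x ℚR.^ suc k))
    (ℚ.neg-antimono-≤ (ℚ.≤-trans (-≤∣∣ (x ℚR.^ suc k)) (∣x^1+k∣≤e k)))
    where open +-*-Solver

∑-lower-bound : ∀ {A : Set} (xs : List A) (f : A → ℚ) {c} → (∀ x → c ℚ.≤ f x) →
  ℚR.ι (length xs) ℚ.* c ℚ.≤ ℚΣ.∑ xs f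
∑-lower-bound []       f {c} c≤f = ℚ.≤-reflexive (ℚ.*-zeroˡ c)
∑-lower-bound (x ∷ xs) f {c} c≤f = ≡.subst (ℚ._≤ ℚΣ.∑ (x ∷ xs) f)
  (≡.sym (≡.trans (ℚ.*-distribʳ-+ c 1ℚ (ℚR.ι (length xs)))
    (≡.cong (ℚ._+ ℚR.ι (length xs) ℚ.* c) (ℚ.*-identityˡ c))))
  (ℚ.+-mono-≤ (c≤f x) (∑-lower-bound xs f c≤f))

-- The terms of a sequence representing ρ - 1 ≥ 0 may be slightly negative, so a termwise
-- argument has to allow for an error.
P-nonneg : ∀ ρ → 1ℝ ≤ ρ → ∀ k → 0ℝ ≤ P k ρ
P-nonneg ρ 1≤ρ k ε 0<ε = lift (1≤ρ e 0<e)
  where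
  L = irreducibleTournaments k
  -- One more than the number of summands, so that B is positive even if there are none.
  B = ℚR.ι (suc (length L))
  0<B : 0ℚ ℚ.< B
  0<B = ℚ.<-≤-trans (ℚ.positive⁻¹ 1ℚ) (≡.subst (ℚ._≤ B) ℚR.ι-1
    (ℚR.ι-mono-≤ {1} {suc (length L)} (ℕ.s≤s ℕ.z≤n)))
  0<ε/B : 0ℚ ℚ.< ε ℚ.* recip B
  0<ε/B = 0<* 0<ε (0<recip B 0<B)
  -- The bound e ≤ 1 is required by `power-lower-bound`; e ≤ ε / B keeps the total loss, at most e
  -- for each summand, below ε.
  e = 1ℚ ℚ.⊓ (ε ℚ.* recip B)
  0<e : 0ℚ ℚ.< e
  0<e with ℚ.⊓-sel 1ℚ (ε ℚ.* recip B)
  ... | inj₁ eq = ≡.subst (0ℚ ℚ.<_) (≡.sym eq) (ℚ.positive⁻¹ 1ℚ)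
  ... | inj₂ eq = ≡.subst (0ℚ ℚ.<_) (≡.sym eq) 0<ε/B
  0≤e = ℚ.<⇒≤ 0<e
  Le≤ε : ℚR.ι (length L) ℚ.* e ℚ.≤ ε
  Le≤ε = ≡.subst (ℚR.ι (length L) ℚ.* e ℚ.≤_)
    (≡.trans (solve 3 (λ b x r → b :* (x :* r) := x :* (b :* r)) ≡.refl B ε (recip B))
      (≡.trans (≡.cong (ε ℚ.*_) (*-recip B 0<B)) (ℚ.*-identityʳ ε)))
    (ℚR.*-mono-≤ (ℚ.<⇒≤ 0<B) 0≤e (ℚR.ι-mono-≤ {length L} {suc (length L)} (ℕ.n≤1+n (length L)))
      (ℚ.p⊓q≤q 1ℚ (ε ℚ.* recip B)))
    where open +-*-Solver
  lift : Eventually (λ m → 1ℚ ℚ.≤ seq ρ m ℚ.+ e) → Eventually (λ m → 0ℚ ℚ.≤ seq (P k ρ) m ℚ.+ ε)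
  lift (N , h) = N , λ m N≤m → begin
    0ℚ                                              ≡⟨ solve 2
      (λ l e → con 0ℚ := l :* (:- e) :+ l :* e) ≡.refl (ℚR.ι (length L)) e ⟩
    ℚR.ι (length L) ℚ.* ℚ.- e ℚ.+ ℚR.ι (length L) ℚ.* e
      ≤⟨ ℚ.+-mono-≤ (∑-lower-bound L (λ t → (seq ρ m ℚ.+ ℚ.- 1ℚ) ℚR.^ ties t) λ t →
           power-lower-bound 0≤e (ℚ.p⊓q≤p 1ℚ (ε ℚ.* recip B)) (-e≤ρ-1 m (h m N≤m)) (ties t)) Le≤ε ⟩
    ℚΣ.∑ L (λ t → (seq ρ m ℚ.+ ℚ.- 1ℚ) ℚR.^ ties t) ℚ.+ ε
      ≡⟨ ≡.cong (ℚ._+ ε) (≡.trans (seq-sum (weight ρ) m L) (ℚΣ.∑-cong L λ t → seq-^ (ρ - 1ℝ) (ties t) m)) ⟨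
    seq (P k ρ) m ℚ.+ ε                             ∎
    where
    open ℚ.≤-Reasoning
    open +-*-Solver
    -e≤ρ-1 : ∀ m → 1ℚ ℚ.≤ seq ρ m ℚ.+ e → ℚ.- e ℚ.≤ seq ρ m ℚ.+ ℚ.- 1ℚ
    -e≤ρ-1 m 1≤ = ≡.subst₂ ℚ._≤_
      (solve 1 (λ e → con 1ℚ :+ (:- con 1ℚ :- e) := :- e) ≡.refl e)
      (solve 2 (λ r e → (r :+ e) :+ (:- con 1ℚ :- e) := r :+ (:- con 1ℚ)) ≡.refl (seq ρ m) e)
      (ℚ.+-monoˡ-≤ (ℚ.- 1ℚ ℚ.- e) 1≤)

-- The estimates for a real p

module _ (p : ℝ) (0<p : 0ℝ < p) (p<1 : p < 1ℝ) where

  private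
    q = 1ℝ - p
    0<q′ = 0<1-p p p<1
    ρ = p * inv q 0<q′
    α = proj₁ 0<p
    β = proj₁ p<1
    0<α = proj₁ (proj₂ 0<p)
    0<β = proj₁ (proj₂ p<1)

  admissible : Eventually λ m → Admissible α β (seq p m)
  admissible with proj₂ (proj₂ 0<p) | proj₂ (proj₂ p<1)
  ... | M , α≤ | N , ≤1 = M ℕ.⊔ N , λ m ≤m → record
    { 0<α = 0<α
    ; 0<β = 0<β
    ; α≤p = ≡.subst (ℚ._≤ seq p m) (ℚ.+-identityˡ α) (α≤ m (ℕ.m⊔n≤o⇒m≤o M N ≤m))
    ; β≤q = ≡.subst (ℚ._≤ 1ℚ ℚ.+ ℚ.- seq p m) (solve 2 (λ a b → (a :+ b) :+ (:- a) := b) ≡.refl (seq p m) β)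
              (ℚ.+-monoˡ-≤ (ℚ.- seq p m) (≤1 m (ℕ.m⊔n≤o⇒n≤o M N ≤m)))
    }
    where open +-*-Solver

  seq-g : ∀ k n m (adm : Admissible α β (seq p m)) → seq (g q 0<q′ k n) m ≡ scale adm k n
  seq-g k n m adm = ≡.cong₂ ℚ._*_ (≡.sym (ι≡/1 (n C k)))
    (≡.cong₂ ℚ._*_ (seq-^ q (n ℕ.* k) m) (seq-^ (inv q 0<q′) (k ℕ.* (k ℕ.+ 1) ℕ./ 2) m))

  -- The constant of an O-bound has to be a single real number, whereas `errorConstant` varies with
  -- the rational terms of ρ. Its formula is therefore repeated with real operations, so that the
  -- two agree term by term.
  constantTerm : ℕ → ℕ → ℝ
  constantTerm r j = ∣ coefficient ρ j ∣ * (fromℕ 2 *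
    (fromℕ (suc r C j) * (1ℝ + ρ) ^ triangular (suc r ℕ.∸ j)))

  constantℝ : ℕ → ℝ
  constantℝ r = sum (List.map (constantTerm r) (upTo (suc r)))

  seq-constant : ∀ r m (adm : Admissible α β (seq p m)) → seq (constantℝ r) m ≡ constant adm r
  seq-constant r m adm = ≡.trans (seq-sum (constantTerm r) m (upTo (suc r))) (ℚΣ.∑-cong (upTo (suc r)) λ j →
    ≡.cong₂ ℚ._*_ (≡.cong ℚ.∣_∣ (seq-coefficient j ρ m)) (≡.cong₂ ℚ._*_ (≡.sym (ι≡/1 2))
      (≡.cong₂ ℚ._*_ (≡.sym (ι≡/1 (suc r C j))) (seq-^ (1ℝ + ρ) (triangular (suc r ℕ.∸ j)) m))))

  -- η is the positive rational lower bound that comes with `0ℝ < ε`. The threshold for n is built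
  -- from η and α, since it has to be fixed before the precision e and the term m are given.
  scale-decreasing : ∀ k → g q 0<q′ (suc k) =o g q 0<q′ k
  scale-decreasing k ε (η , 0<η , E , η≤) =
    let K , 2≤   = archimedean-* (ℚR.ι 2) η 0<η
        N₀ , exp = exponential-bound 0<α K
        M , adm  = admissible
    in N₀ ℕ.+ 2 ℕ.* suc k , λ n N≤n e 0<e → M ℕ.⊔ E , λ m ≤m →
    let ad = adm m (ℕ.m⊔n≤o⇒m≤o M E ≤m)
        sc = scale ad
        η≤ε = ≡.subst (ℚ._≤ seq ε m) (ℚ.+-identityˡ η) (η≤ m (ℕ.m⊔n≤o⇒n≤o M E ≤m))
        s  = recip (1ℚ ℚ.+ ℚ.- seq p m)
        1+α≤s = ≡.subst (1ℚ ℚ.+ α ℚ.≤_) (ℚR.1+ρ≡s (seq p m) (1ℚ ℚ.+ ℚ.- seq p m) s (qs≡1 ad) (p+q≡1 ad))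
          (1+α≤1+ρ ad)
    in begin
    ℚ.∣ seq (g q 0<q′ (suc k) n) m ∣            ≡⟨ ≡.cong ℚ.∣_∣ (seq-g (suc k) n m ad) ⟩
    ℚ.∣ sc (suc k) n ∣                          ≡⟨ ∣scale∣ ad (suc k) n ⟩
    sc (suc k) n
      ≤⟨ ℚR.scale-suc≤ (seq p m) (1ℚ ℚ.+ ℚ.- seq p m) s (qs≡1 ad) (p+q≡1 ad) (0≤q ad) (0≤s ad)
           η K N₀ (ℚ.<⇒≤ 0<η) (≡.subst (ℚR.ι 2 ℚ.≤_) (ℚ.*-comm (ℚR.ι K) η) (2≤ K ℕ.≤-refl))
             (exp s 1+α≤s) k n N≤n ⟩
    η ℚ.* sc k n                                ≤⟨ ℚR.*-monoʳ-≤ (sc k n) (0≤scale ad k n) η≤ε ⟩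
    seq ε m ℚ.* sc k n                          ≡⟨ ≡.cong (seq ε m ℚ.*_) (∣scale∣ ad k n) ⟨
    seq ε m ℚ.* ℚ.∣ sc k n ∣                    ≡⟨ ≡.cong (λ x → seq ε m ℚ.* ℚ.∣ x ∣) (seq-g k n m ad) ⟨
    seq ε m ℚ.* ℚ.∣ seq (g q 0<q′ k n) m ∣      ≡⟨ ℚ.+-identityʳ _ ⟨
    seq ε m ℚ.* ℚ.∣ seq (g q 0<q′ k n) m ∣ ℚ.+ 0ℚ   ≤⟨ ℚ.+-monoʳ-≤
      (seq ε m ℚ.* ℚ.∣ seq (g q 0<q′ k n) m ∣) (ℚ.<⇒≤ 0<e) ⟩
    seq ε m ℚ.* ℚ.∣ seq (g q 0<q′ k n) m ∣ ℚ.+ e    ∎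
    where open ℚ.≤-Reasoning

  remainder : ∀ r → (λ n → ℙ[G n , p ∈ connected? ] - sum
    (List.map (λ k → coefficient ρ k * g q 0<q′ k n) (upTo (suc r)))) =O g q 0<q′ (suc r)
  remainder r =
    let N₀ , exp = exponential-bound 0<α 8
        M , adm  = admissible
    in constantℝ r , 4 ℕ.* suc r ℕ.+ 2 ℕ.* N₀ , λ n thr≤n e 0<e → M , λ m M≤m →
    let ad = adm m M≤m
        sc = scale ad
    in begin
    ℚ.∣ seq (ℙ[G n , p ∈ connected? ]) m ℚ.+ ℚ.- seq
      (sum (List.map (λ k → coefficient ρ k * g q 0<q′ k n) (upTo (suc r)))) m ∣
      ≡⟨ ≡.cong₂ (λ x y → ℚ.∣ x ℚ.+ ℚ.- y ∣) (seq-ℙ n p m)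
        (≡.trans (seq-sum (λ k → coefficient ρ k * g q 0<q′ k n) m (upTo (suc r)))
           (ℚΣ.∑-cong (upTo (suc r)) λ k → ≡.cong₂ ℚ._*_ (seq-coefficient k ρ m) (seq-g k n m ad))) ⟩
    ℚ.∣ ℚΣ.strongTotal (ℚΣ.graphWeight (seq p m) (seq q m)) n ℚ.+ ℚ.- ℚΣ.∑ (upTo (suc r))
      (λ k → ℚR.d (seq ρ m) k ℚ.* sc k n) ∣
      ≤⟨ expansion-bound ad N₀ exp r n thr≤n ⟩
    constant ad r ℚ.* sc (suc r) n
      ≡⟨ ≡.cong₂ ℚ._*_ (seq-constant r m ad) (≡.trans (≡.cong ℚ.∣_∣ (seq-g (suc r) n m ad))
        (∣scale∣ ad (suc r) n)) ⟨
    seq (constantℝ r) m ℚ.* ℚ.∣ seq (g q 0<q′ (suc r) n) m ∣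
      ≡⟨ ℚ.+-identityʳ _ ⟨
    seq (constantℝ r) m ℚ.* ℚ.∣ seq (g q 0<q′ (suc r) n) m ∣ ℚ.+ 0ℚ
      ≤⟨ ℚ.+-monoʳ-≤ (seq (constantℝ r) m ℚ.* ℚ.∣ seq (g q 0<q′ (suc r) n) m ∣) (ℚ.<⇒≤ 0<e) ⟩
    seq (constantℝ r) m ℚ.* ℚ.∣ seq (g q 0<q′ (suc r) n) m ∣ ℚ.+ e ∎
    where open ℚ.≤-Reasoning

  ½≤p⇒1≤ρ : fromℚ ½ ≤ p → 1ℝ ≤ ρ
  ½≤p⇒1≤ρ ½≤p ε 0<ε =
    -- Writing 1 as ½ + ½ doubles this slack to ε β, which is at most ε q and becomes ε after
    -- multiplication by s, the inverse of q.
    let N , h   = ½≤p (½ ℚ.* (ε ℚ.* β)) (0<* (ℚ.positive⁻¹ ½) (0<* 0<ε 0<β))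
        M , adm = admissible
    in N ℕ.⊔ M , λ m ≤m →
    let ad = adm m (ℕ.m⊔n≤o⇒n≤o N M ≤m)
        a  = seq p m
        b  = 1ℚ ℚ.+ ℚ.- a
        s  = recip b
    in begin
    1ℚ                                      ≡⟨ qs≡1 ad ⟨
    b ℚ.* s                                 ≤⟨ ℚR.*-monoʳ-≤ s (0≤s ad) (begin
      b                                       ≡⟨ solve 1
        (λ a → con 1ℚ :+ (:- a) := (con ½ :+ con ½) :+ (:- a)) ≡.refl a ⟩
      (½ ℚ.+ ½) ℚ.+ ℚ.- a                     ≤⟨ ℚ.+-monoˡ-≤ (ℚ.- a)
        (ℚ.+-mono-≤ (h m (ℕ.m⊔n≤o⇒m≤o N M ≤m)) (h m (ℕ.m⊔n≤o⇒m≤o N M ≤m))) ⟩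
      (a ℚ.+ ½ ℚ.* (ε ℚ.* β) ℚ.+ (a ℚ.+ ½ ℚ.* (ε ℚ.* β))) ℚ.+ ℚ.- a
        ≡⟨ solve 3 (λ a e b → (a :+ con ½ :* (e :* b) :+ (a :+ con ½ :* (e :* b))) :+ (:- a)
          := a :+ e :* b) ≡.refl a ε β ⟩
      a ℚ.+ ε ℚ.* β                           ≤⟨ ℚ.+-monoʳ-≤ a
        (ℚR.*-monoˡ-≤ ε (ℚ.<⇒≤ 0<ε) (Admissible.β≤q ad)) ⟩
      a ℚ.+ ε ℚ.* b                           ∎) ⟩
    (a ℚ.+ ε ℚ.* b) ℚ.* s                   ≡⟨ solve 4
      (λ a e b s → (a :+ e :* b) :* s := a :* s :+ e :* (b :* s)) ≡.refl a ε b s ⟩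
    a ℚ.* s ℚ.+ ε ℚ.* (b ℚ.* s)             ≡⟨ ≡.cong (λ x → a ℚ.* s ℚ.+ x)
      (≡.trans (≡.cong (ε ℚ.*_) (qs≡1 ad)) (ℚ.*-identityʳ ε)) ⟩
    a ℚ.* s ℚ.+ ε                           ∎
    where
    open ℚ.≤-Reasoning
    open +-*-Solver

  -- Up to the slack, q ≤ q (ρ + ε) ≤ p + ε; averaging with p turns this into a bound for ½ = ½ q +
  -- ½ p.
  1≤ρ⇒½≤p : 1ℝ ≤ ρ → fromℚ ½ ≤ p
  1≤ρ⇒½≤p 1≤ρ ε 0<ε =
    let N , h   = 1≤ρ ε 0<ε
        M , adm = admissible
    in N ℕ.⊔ M , λ m ≤m →
    let ad = adm m (ℕ.m⊔n≤o⇒n≤o N M ≤m)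
        a  = seq p m
        b  = 1ℚ ℚ.+ ℚ.- a
        s  = recip b
    in begin
    ½                                       ≡⟨ solve 1
      (λ a → con ½ := con ½ :* (con 1ℚ :+ (:- a)) :+ con ½ :* a) ≡.refl a ⟩
    ½ ℚ.* b ℚ.+ ½ ℚ.* a                     ≤⟨ ℚ.+-monoˡ-≤ (½ ℚ.* a) (ℚR.*-monoˡ-≤ ½ 0≤½ (begin
      b                                       ≡⟨ ℚ.*-identityʳ b ⟨
      b ℚ.* 1ℚ                                ≤⟨ ℚR.*-monoˡ-≤ b (0≤q ad) (h m (ℕ.m⊔n≤o⇒m≤o N M ≤m)) ⟩
      b ℚ.* (a ℚ.* s ℚ.+ ε)                   ≡⟨ ℚ.*-distribˡ-+ b (a ℚ.* s) ε ⟩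
      b ℚ.* (a ℚ.* s) ℚ.+ b ℚ.* ε             ≤⟨ ℚ.+-mono-≤ (ℚ.≤-reflexive (qρ≡p ad))
        (ℚR.*-monoʳ-≤ ε (ℚ.<⇒≤ 0<ε) (q≤1 ad)) ⟩
      a ℚ.+ 1ℚ ℚ.* ε                          ∎)) ⟩
    ½ ℚ.* (a ℚ.+ 1ℚ ℚ.* ε) ℚ.+ ½ ℚ.* a      ≡⟨ solve 2
      (λ a e → con ½ :* (a :+ con 1ℚ :* e) :+ con ½ :* a := a :+ con ½ :* e) ≡.refl a ε ⟩
    a ℚ.+ ½ ℚ.* ε                           ≤⟨ ℚ.+-monoʳ-≤ a
      (≡.subst (½ ℚ.* ε ℚ.≤_) (ℚ.*-identityˡ ε) (ℚR.*-monoʳ-≤ ε (ℚ.<⇒≤ 0<ε) ½≤1)) ⟩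
    a ℚ.+ ε                                 ∎
    where
    open ℚ.≤-Reasoning
    open +-*-Solver
    ½≤1 : ½ ℚ.≤ 1ℚ
    ½≤1 = ℚ.*≤* (ℤ.+≤+ (ℕ.s≤s ℕ.z≤n))

theorem4p7 : (p : ℝ) → 0ℝ < p → (p<1 : p < 1ℝ) →
    let q = 1ℝ - p
        0<q = 0<1-p p p<1
        ρ = p * inv q 0<q
    in Expansion (λ n → ℙ[G n , p ∈ connected? ]) (coefficient ρ) (g q 0<q)
       × (fromℚ ½ ≤ p ⇔ 1ℝ ≤ ρ)
       × (fromℚ ½ ≤ p → (k : ℕ) → 1 ℕ.≤ k → 0ℝ ≤ P k ρ)
theorem4p7 p 0<p p<1 =
    (scale-decreasing p 0<p p<1 , remainder p 0<p p<1)
  , mk⇔ (½≤p⇒1≤ρ p 0<p p<1) (1≤ρ⇒½≤p p 0<p p<1)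
  , λ ½≤p k _ → P-nonneg (p * inv (1ℝ - p) (0<1-p p p<1)) (½≤p⇒1≤ρ p 0<p p<1 ½≤p) k
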